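{- Let $\mathcal{Q}=(Q,\leq^Q)$ and $\mathcal{P}=(P,\leq^P)$ be finite posets. Then the problem of deciding whether there is an embedding from $\mathcal{Q}$ into $\mathcal{P}$ is fixed-parameter tractable (with parameters $\mathrm{width}(\mathcal{P})$ and $|Q|$); more precisely, it can be solved in time $O\big(\mathrm{width}(\mathcal{P})^{|Q|}\cdot|Q|^4\cdot|P|^4\big)$.
   Context: The width of a poset is the maximum size of a set of pairwise incomparable elements. An embedding from $\mathcal{Q}$ into $\mathcal{P}$ is an injective function $e:Q\to P$ such that for all $q,q'\in Q$: $q\leq^Q q'$ if and only if $e(q)\leq^P e(q')$. -}

module Defs where

open import Data.Bool.Base using (if_then_else_)
open import Data.Fin.Base using (Fin)
open import Data.Fin.Properties using (all?) renaming (_≟_ to _≟ᶠ_)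
open import Data.Fin.Subset using (Subset; _∈_; ∣_∣; ⊥)
open import Data.Fin.Subset.Properties using (_∈?_; anySubset?; ∣p∣≤n; ∣⊥∣≡0; ∉⊥)
open import Data.List.Base using (List; []; _∷_; _++_; concat; tabulate; length)
open import Data.Nat.Base using (ℕ; zero; suc; _+_; _*_; _∸_; _^_; _≤_; _≡ᵇ_)
open import Data.Nat.Properties using (_≟_; ≤∧≢⇒<; ≤-pred)
open import Data.Product.Base using (∃; ∃-syntax; _×_; _,_; proj₁; proj₂)
open import Data.Sum.Base using (_⊎_)
open import Data.Vec.Base using (Vec; toList)
open import Function.Bundles using (_⇔_)
open import Function.Definitions using (Injective)
open import Level using (0ℓ)
open import Relation.Binary.Core using (Rel)
open import Relation.Binary.PropositionalEquality.Core using (_≡_; _≢_; refl)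
open import Relation.Binary.Structures using (IsDecPartialOrder)
open import Relation.Nullary.Decidable.Core using (Dec; yes; no; does; _×-dec_; _→-dec_; ¬?)
open import Relation.Nullary.Negation.Core using (¬_; contradiction)

------------------------------------------------------------------------
-- Finite posets, width, embeddings

-- As an input to an algorithm a finite poset comes with its elements listed;
-- the carrier is therefore Fin size.
record FinitePoset : Set₁ where
  field
    size              : ℕ
    _≼_               : Rel (Fin size) 0ℓ
    isDecPartialOrder : IsDecPartialOrder _≡_ _≼_

  open IsDecPartialOrder isDecPartialOrder public
    using (antisym) renaming (refl to ≼-refl; trans to ≼-trans; _≤?_ to _≼?_)

  Incomparable : Rel (Fin size) 0ℓ
  Incomparable x y = ¬ (x ≼ y) × ¬ (y ≼ x)

  Antichain : Subset size → Set
  Antichain S = ∀ x y → x ∈ S → y ∈ S → x ≢ y → Incomparable x y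

  IsWidth : ℕ → Set
  IsWidth w = (∃[ S ] Antichain S × ∣ S ∣ ≡ w) × (∀ S → Antichain S → ∣ S ∣ ≤ w)

  antichain? : ∀ S → Dec (Antichain S)
  antichain? S = all? λ x → all? λ y →
    (x ∈? S) →-dec ((y ∈? S) →-dec (¬? (x ≟ᶠ y) →-dec (¬? (x ≼? y) ×-dec ¬? (y ≼? x))))

  private
    search : ∀ k → (∀ S → Antichain S → ∣ S ∣ ≤ k) → ∃ IsWidth
    search zero    bound =
      0 , (⊥ , (λ x _ x∈⊥ → contradiction x∈⊥ ∉⊥) , ∣⊥∣≡0 size) , bound
    search (suc k) bound with anySubset? (λ S → antichain? S ×-dec (∣ S ∣ ≟ suc k))
    ... | yes found = suc k , found , bound
    ... | no  none  = search k λ S anti →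
      ≤-pred (≤∧≢⇒< (bound S anti) λ eq → none (S , anti , eq))

  width∃ : ∃ IsWidth
  width∃ = search size λ S _ → ∣p∣≤n S

  width : ℕ
  width = proj₁ width∃

  width-isWidth : IsWidth width
  width-isWidth = proj₂ width∃

open FinitePoset public using (size; width)

Embedding : FinitePoset → FinitePoset → Set
Embedding Q P = ∃[ e ] Injective _≡_ _≡_ e × (∀ q q′ → (q ≤Q q′) ⇔ (e q ≤P e q′))
  where
  open FinitePoset Q using () renaming (_≼_ to _≤Q_)
  open FinitePoset P using () renaming (_≼_ to _≤P_)

------------------------------------------------------------------------
-- Model of computation: a unit-cost random access machine whose arithmetic
-- is addition and truncated subtraction, programmed with structured control
-- flow.  A program names finitely many registers; the memory is addressed
-- indirectly.  Multiplication is deliberately not a unit-cost operation.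

data Exp : Set where
  #_      : ℕ → Exp
  reg     : ℕ → Exp
  mem[_]  : Exp → Exp
  _⊕_ _⊖_ : Exp → Exp → Exp

infixl 6 _⊕_ _⊖_
infix  8 #_

infix  4 _≔_ mem[_]≔_
infixr 3 _⨟_

data Program : Set where
  skip           : Program
  _≔_            : ℕ → Exp → Program
  mem[_]≔_       : Exp → Exp → Program
  _⨟_            : Program → Program → Program
  if_then_else′_ : Exp → Program → Program → Program
  while_do′_     : Exp → Program → Program

record State : Set where
  constructor ⟪_,_⟫
  field
    regs : ℕ → ℕ
    mem  : ℕ → ℕ

open State public

_[_↦_] : (ℕ → ℕ) → ℕ → ℕ → (ℕ → ℕ)
(f [ a ↦ v ]) b = if a ≡ᵇ b then v else f b

eval : Exp → State → ℕ
eval (# k)      s = k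
eval (reg r)    s = regs s r
eval (mem[ a ]) s = mem s (eval a s)
eval (a ⊕ b)    s = eval a s + eval b s
eval (a ⊖ b)    s = eval a s ∸ eval b s

cost : Exp → ℕ
cost (# k)      = 1
cost (reg r)    = 1
cost (mem[ a ]) = suc (cost a)
cost (a ⊕ b)    = suc (cost a + cost b)
cost (a ⊖ b)    = suc (cost a + cost b)

infix 2 _,_⇓[_]_

-- p , s ⇓[ t ] s′ : started in s, p halts in s′ after exactly t steps.
-- A test succeeds when its value is nonzero.
data _,_⇓[_]_ : Program → State → ℕ → State → Set where
  ⇓-skip   : ∀ {s} → skip , s ⇓[ 1 ] s
  ⇓-assign : ∀ {s r e} →
             (r ≔ e) , s ⇓[ suc (cost e) ] ⟪ regs s [ r ↦ eval e s ] , mem s ⟫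
  ⇓-store  : ∀ {s a e} →
             (mem[ a ]≔ e) , s ⇓[ suc (cost a + cost e) ]
               ⟪ regs s , mem s [ eval a s ↦ eval e s ] ⟫
  ⇓-seq    : ∀ {s s′ s″ p q t u} → p , s ⇓[ t ] s′ → q , s′ ⇓[ u ] s″ →
             (p ⨟ q) , s ⇓[ t + u ] s″
  ⇓-then   : ∀ {s s′ e p q t} → eval e s ≢ 0 → p , s ⇓[ t ] s′ →
             (if e then p else′ q) , s ⇓[ suc (cost e + t) ] s′
  ⇓-else   : ∀ {s s′ e p q t} → eval e s ≡ 0 → q , s ⇓[ t ] s′ →
             (if e then p else′ q) , s ⇓[ suc (cost e + t) ] s′
  ⇓-loop   : ∀ {s s′ s″ e p t u} → eval e s ≢ 0 →
             p , s ⇓[ t ] s′ → (while e do′ p) , s′ ⇓[ u ] s″ →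
             (while e do′ p) , s ⇓[ suc (cost e + t + u) ] s″
  ⇓-exit   : ∀ {s e p} → eval e s ≡ 0 →
             (while e do′ p) , s ⇓[ suc (cost e) ] s

⇓-deterministic : ∀ {p s t u s′ s″} → p , s ⇓[ t ] s′ → p , s ⇓[ u ] s″ → t ≡ u × s′ ≡ s″
⇓-deterministic ⇓-skip   ⇓-skip   = refl , refl
⇓-deterministic ⇓-assign ⇓-assign = refl , refl
⇓-deterministic ⇓-store  ⇓-store  = refl , refl
⇓-deterministic (⇓-seq a b) (⇓-seq c d) with ⇓-deterministic a c
... | refl , refl with ⇓-deterministic b d
... | refl , refl = refl , refl
⇓-deterministic (⇓-then _ a) (⇓-then _ b) with ⇓-deterministic a b
... | refl , refl = refl , refl
⇓-deterministic (⇓-then n _) (⇓-else z _) = contradiction z n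
⇓-deterministic (⇓-else z _) (⇓-then n _) = contradiction z n
⇓-deterministic (⇓-else _ a) (⇓-else _ b) with ⇓-deterministic a b
... | refl , refl = refl , refl
⇓-deterministic (⇓-loop _ a b) (⇓-loop _ c d) with ⇓-deterministic a c
... | refl , refl with ⇓-deterministic b d
... | refl , refl = refl , refl
⇓-deterministic (⇓-loop n _ _) (⇓-exit z) = contradiction z n
⇓-deterministic (⇓-exit z) (⇓-loop n _ _) = contradiction z n
⇓-deterministic (⇓-exit _) (⇓-exit _) = refl , refl

-- The input occupies memory cells 0, 1, …; all other cells, and all
-- registers, start at 0.  The output is read from register 0.
contents : List ℕ → ℕ → ℕ
contents []       _       = 0
contents (x ∷ xs) zero    = x
contents (x ∷ xs) (suc a) = contents xs a

initial : List ℕ → State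
initial input = ⟪ (λ _ → 0) , contents input ⟫

output : State → ℕ
output s = regs s 0

------------------------------------------------------------------------
-- Decision problems and fixed-parameter tractability

record DecisionProblem : Set₂ where
  field
    Instance : Set₁
    encode   : Instance → List ℕ
    Yes      : Instance → Set

  inputLength : Instance → ℕ
  inputLength x = length (encode x)

open DecisionProblem public

CorrectAnswer : Set → ℕ → Set
CorrectAnswer A v = (A × v ≡ 1) ⊎ (¬ A × v ≡ 0)

DecidesWithin : (Π : DecisionProblem) → Program → (Instance Π → ℕ) → Set₁
DecidesWithin Π p T = ∀ x → ∃[ t ] ∃[ s ]
  (p , initial (encode Π x) ⇓[ t ] s) × CorrectAnswer (Yes Π x) (output s) × t ≤ T x

-- Solvable in time O(g).  Where g x is nonzero, 1 + g x ≤ 2 * g x, so the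
-- summand 1 matters only on instances with g x ≡ 0 (no program takes zero
-- steps), where it allows constant time.
SolvableInTimeO : (Π : DecisionProblem) → (Instance Π → ℕ) → Set₁
SolvableInTimeO Π g = ∃[ p ] ∃[ c ] DecidesWithin Π p (λ x → c * (1 + g x))

Computable : ∀ {r} → (Vec ℕ r → ℕ) → Set
Computable f = ∃[ p ] ∀ v → ∃[ t ] ∃[ s ]
  (p , initial (toList v) ⇓[ t ] s) × output s ≡ f v

-- κ lists the r parameters of an instance.
FixedParameterTractable : ∀ {r} (Π : DecisionProblem) → (Instance Π → Vec ℕ r) → Set₁
FixedParameterTractable Π κ = ∃[ p ] ∃[ f ] ∃[ d ]
  Computable f × DecidesWithin Π p (λ x → f (κ x) * inputLength Π x ^ d)

------------------------------------------------------------------------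
-- The embedding problem

-- Row-major 0/1 matrix of the order relation.
orderMatrix : FinitePoset → List ℕ
orderMatrix P = concat (tabulate λ x → tabulate λ y → if does (x ≼? y) then 1 else 0)
  where open FinitePoset P using (_≼?_)

-- An instance (Q , P) asks whether Q embeds into P.
EmbeddingProblem : DecisionProblem
EmbeddingProblem = record
  { Instance = FinitePoset × FinitePoset
  ; encode   = λ (Q , P) → size Q ∷ size P ∷ orderMatrix Q ++ orderMatrix P
  ; Yes      = λ (Q , P) → Embedding Q P
  }

{-# OPTIONS --safe #-}
module Submission where

-- Partition P into w chains, where w is the width.  For each of the w ^ |Q| ways
-- to prescribe the chain that each element of Q is sent to, the least candidate
-- m is computed greedily: m starts at the bottoms of the chains, and a violated
-- requirement always forces one particular element upwards.  If p ≤ q but not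
-- m p ≤ m q, then every embedding above m moves q strictly above m q; if p ≰ q
-- but m p ≤ m q, then it moves p strictly above m p.  So m stays below every
-- embedding respecting the prescription, and after at most |Q| |P| moves it is
-- an embedding or there is none.
--
-- A minimum chain partition is a maximum matching between the elements and their
-- successors.  It is found by an auction: an element without successor buys the
-- cheapest larger element, evicting its owner and raising its price by one.
-- When everybody without successor finds the prices too high, some price is used
-- by nobody, and the cut at that price yields an antichain with as many elements
-- as there are chains.
--
-- The machine program is compiled from a language of bounded loops over numbered
-- variables and arrays, whose total semantics is what the proofs reason about.

open import Defs
open import Data.Bool.Base using (Bool; true; false; T; not; _∧_; _∨_; if_then_else_)
open import Data.Bool.Properties using (T-∧)
open import Data.Empty using (⊥)
import Data.Fin as Fin
open import Data.Fin.Base using (Fin; toℕ; fromℕ<; zero; suc)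
open import Data.Fin.Properties using (toℕ-injective; toℕ<n; toℕ-fromℕ<; pigeonhole; any?; ¬∀⟶∃¬)
open import Data.Fin.Subset using (Subset; _∈_; ∣_∣)
open import Data.List.Base using (List; []; _∷_; _++_; concat; map; tabulate; length)
open import Data.List.Properties using (length-++; length-tabulate)
open import Data.List.Relation.Binary.Pointwise.Base using (Pointwise; []; _∷_)
open import Data.List.Relation.Unary.All using (All; []; _∷_)
open import Data.Nat.Base
open import Data.Nat.DivMod using ([m+kn]%n≡m%n; m<n⇒m%n≡m; m≡m%n+[m/n]*n; m%n<n)
open import Data.Nat.GeneralisedArithmetic using (iterate)
open import Data.Nat.ListAction using (product)
open import Data.Nat.Properties
open import Data.Nat.Solver using (module +-*-Solver)
open import Data.Product.Base using (_×_; _,_; proj₁; proj₂; ∃-syntax)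
open import Data.Sum.Base using (_⊎_; inj₁; inj₂; [_,_]′)
open import Data.Unit.Base using (⊤; tt)
import Data.Vec.Base as Vec
open import Data.Vec.Base using (Vec; []; _∷_)
open import Data.Vec.Properties using (lookup∘tabulate; []=⇒lookup)
open import Function.Base using (id)
open import Function.Bundles using (Equivalence; mk⇔)
open import Relation.Binary.Definitions using (tri<; tri≈; tri>)
open import Relation.Binary.PropositionalEquality
open import Relation.Nullary.Decidable using (dec-true; dec-false)
open import Relation.Nullary.Decidable.Core using (Dec; yes; no; does)
open import Relation.Nullary.Negation.Core using (¬_; contradiction)

-- A language of bounded loops

-- Two potentials bound the work. A round of the auction in which somebody wants to bid raises the
-- sum of the prices, and no price exceeds |P| + 2; so O(|P|^2) rounds of |P| bids, each scanning
-- |P| elements, suffice, which gives |P|^4. For one prescription the potential is the total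
-- distance along the chains from m up to an embedding, at most |Q| |P|. A sweep over all pairs that
-- meets a violation uses up part of it, so |Q| |P| sweeps of |Q|^2 pairs suffice. The machine
-- shapes the rest. It cannot multiply, so row offsets, loop bounds and powers come from repeated
-- addition, at a cost that has to be covered as well. It is not told where its input ends, so the
-- start of the free memory is computed before any array is used. Finally a loop costs a failing
-- test even when it makes no round, so times appear as products of successors of loop bounds. These
-- are within a constant factor of the products of the bounds when all bounds are positive, which is
-- why empty posets are answered separately.

T-≡ᵇ : ∀ {a b} → T (a ≡ᵇ b) → a ≡ b
T-≡ᵇ = ≡ᵇ⇒≡ _ _

≡ᵇ-refl : ∀ a → (a ≡ᵇ a) ≡ true
≡ᵇ-refl zero    = refl
≡ᵇ-refl (suc a) = ≡ᵇ-refl a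

≢⇒≡ᵇ-false : ∀ {a b} → a ≢ b → (a ≡ᵇ b) ≡ false
≢⇒≡ᵇ-false {a} {b} a≢b with a ≡ᵇ b in eq
... | true  = contradiction (T-≡ᵇ (subst T (sym eq) tt)) a≢b
... | false = refl

update-same : ∀ f a {v} → (f [ a ↦ v ]) a ≡ v
update-same f a {v} = cong (if_then v else f a) (≡ᵇ-refl a)

update-other : ∀ f {a b v} → a ≢ b → (f [ a ↦ v ]) b ≡ f b
update-other f {b = b} {v} a≢b = cong (if_then v else f b) (≢⇒≡ᵇ-false a≢b)

infix  9 _at_
infixl 7 _∔_ _⊝_
infix  6 _⇐_ _at_←_
infixr 4 _▸_
infixr 5 when_then_else_ for_below_do′_

data Expr : Set where
  lit     : ℕ → Expr
  var     : ℕ → Expr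
  _at_    : Fin 16 → Expr → Expr
  _∔_ _⊝_ : Expr → Expr → Expr

-- The loop counter is the first argument of for_below_do′_, the variable
-- holding the number of rounds is the second.
data Cmd : Set where
  noop           : Cmd
  _⇐_           : ℕ → Expr → Cmd
  _at_←_        : Fin 16 → Expr → Expr → Cmd
  _▸_            : Cmd → Cmd → Cmd
  when_then_else_  : Expr → Cmd → Cmd → Cmd
  for_below_do′_  : ℕ → ℕ → Cmd → Cmd

record Store : Set where
  constructor store
  field
    vars  : ℕ → ℕ
    cells : Fin 16 → ℕ → ℕ
open Store public

setVar : ℕ → ℕ → Store → Store
setVar r v s = store (vars s [ r ↦ v ]) (cells s)

setCell : Fin 16 → ℕ → ℕ → Store → Store
setCell j i v s = store (vars s)
  λ j′ → if toℕ j ≡ᵇ toℕ j′ then cells s j′ [ i ↦ v ] else cells s j′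

val : Expr → Store → ℕ
val (lit c)  s = c
val (var r)  s = vars s r
val (j at e) s = cells s j (val e s)
val (d ∔ e)  s = val d s + val e s
val (d ⊝ e)  s = val d s ∸ val e s

choose : ∀ {A : Set} → ℕ → A → A → A
choose zero    a b = b
choose (suc _) a b = a

advance : ℕ → Store → Store
advance r s = setVar r (vars s r + 1) s

run : Cmd → Store → Store
run noop                  s = s
run (r ⇐ e)              s = setVar r (val e s) s
run (j at d ← e)         s = setCell j (val d s) (val e s) s
run (c ▸ d)               s = run d (run c s)
run (when e then c else d)  s = choose (val e s) (run c s) (run d s)
run (for r below v do′ c)  s = iterate (λ z → advance r (run c z)) (setVar r 0 s) (vars s v)

-- Boolean, so that for the concrete commands below `T (keeps c x)` computes to the unit type and a
-- frame condition is proved by `tt`. It is syntactic: a variable assigned in either branch counts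
-- as changed.
keeps : Cmd → ℕ → Bool
keeps noop                 x = true
keeps (r ⇐ _)             x = not (r ≡ᵇ x)
keeps (_ at _ ← _)        x = true
keeps (c ▸ d)              x = keeps c x ∧ keeps d x
keeps (when _ then c else d) x = keeps c x ∧ keeps d x
keeps (for r below _ do′ c) x = not (r ≡ᵇ x) ∧ keeps c x

keepsArray : Cmd → Fin 16 → Bool
keepsArray noop                 j = true
keepsArray (_ ⇐ _)             j = true
keepsArray (i at _ ← _)        j = not (toℕ i ≡ᵇ toℕ j)
keepsArray (c ▸ d)              j = keepsArray c j ∧ keepsArray d j
keepsArray (when _ then c else d) j = keepsArray c j ∧ keepsArray d j
keepsArray (for _ below _ do′ c) j = keepsArray c j

∧-split : ∀ {a b} → T (a ∧ b) → T a × T b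
∧-split = Equivalence.to T-∧

if-not : ∀ {A : Set} {a} {x y : A} → T (not a) → (if a then x else y) ≡ y
if-not {a = false} _ = refl

iterate-invariant : ∀ {A B : Set} {f : A → A} (g : A → B) → (∀ z → g (f z) ≡ g z) →
                    ∀ n z → g (iterate f z n) ≡ g z
iterate-invariant g inv zero    z = refl
iterate-invariant g inv (suc n) z = trans (iterate-invariant g inv n _) (inv z)

frame : ∀ c {x} → T (keeps c x) → ∀ s → vars (run c s) x ≡ vars s x
frame noop                k s = refl
frame (r ⇐ e)            k s = if-not k
frame (j at d ← e)       k s = refl
frame (c ▸ d)             k s = trans (frame d (proj₂ (∧-split k)) _) (frame c (proj₁ (∧-split k)) s)
frame (when e then c else d) k s with val e s
... | zero  = frame d (proj₂ (∧-split {keeps c _} k)) s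
... | suc _ = frame c (proj₁ (∧-split k)) s
frame (for r below v do′ c) {x} k s = trans
  (iterate-invariant (λ z → vars z x)
    (λ z → trans (if-not r≢x) (frame c (proj₂ (∧-split {not (r ≡ᵇ x)} k)) z)) (vars s v) _)
  (if-not r≢x)
  where r≢x = proj₁ (∧-split {not (r ≡ᵇ x)} k)

frameArray : ∀ c {j} → T (keepsArray c j) → ∀ s → cells (run c s) j ≡ cells s j
frameArray noop                k s = refl
frameArray (r ⇐ e)            k s = refl
frameArray (j at d ← e)       k s = if-not k
frameArray (c ▸ d)             k s =
  trans (frameArray d (proj₂ (∧-split k)) _) (frameArray c (proj₁ (∧-split k)) s)
frameArray (when e then c else d) k s with val e s
... | zero  = frameArray d (proj₂ (∧-split {keepsArray c _} k)) s
... | suc _ = frameArray c (proj₁ (∧-split k)) s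
frameArray (for r below v do′ c) {j} k s =
  iterate-invariant (λ z → cells z j) (frameArray c k) (vars s v) _

for-rule : ∀ {r v c} (I : ℕ → Store → Set) {s N} → vars s v ≡ N → T (keeps c r) →
           I 0 (setVar r 0 s) →
           (∀ i z → i < N → vars z r ≡ i → I i z → I (suc i) (advance r (run c z))) →
           I N (run (for r below v do′ c) s)
for-rule {r} {v} {c} I {s} refl kr start step =
  go (vars s v) 0 (setVar r 0 s) refl (update-same (vars s) r) start
  where
  go : ∀ m i z → i + m ≡ vars s v → vars z r ≡ i → I i z →
       I (vars s v) (iterate (λ y → advance r (run c y)) z m)
  go zero    i z i+0≡N zr inv = subst (λ k → I k z) (trans (sym (+-identityʳ i)) i+0≡N) inv
  go (suc m) i z i+m≡N zr inv =
    go m (suc i) (advance r (run c z)) (trans (sym (+-suc i m)) i+m≡N)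
      (trans (update-same (vars (run c z)) r)
        (trans (cong (_+ 1) (trans (frame c kr z) zr)) (+-comm i 1)))
      (step i z (subst (i <_) i+m≡N (m<m+n i (s≤s z≤n))) zr inv)

-- Variable r lives in register suc r.  Register 0 holds the address behind the
-- input; from there on the sixteen arrays are interleaved, so that arrays of
-- any length never overlap.
double : Exp → Exp
double e = e ⊕ e

-- Sixteen is a power of two because the stride must be reached without multiplication, by four
-- doublings. Performing the same additions as `double` makes the compiled address evaluate to
-- `address` by computation.
times16 : ℕ → ℕ
times16 i = let d = λ x → x + x in d (d (d (d i)))

address : ℕ → Fin 16 → ℕ → ℕ
address b j i = b + (times16 i + toℕ j)

compileExpr : Expr → Exp
compileExpr (lit c)  = # c
compileExpr (var r)  = reg (suc r)
compileExpr (j at e) = mem[ reg 0 ⊕ (double (double (double (double (compileExpr e)))) ⊕ # (toℕ j)) ]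
compileExpr (d ∔ e)  = compileExpr d ⊕ compileExpr e
compileExpr (d ⊝ e)  = compileExpr d ⊖ compileExpr e

-- Unlike `run`, which fixes the number of rounds on entry, this rereads the bound before every
-- round. The two agree because `Nested` forbids the body to change the bound.
loop : ℕ → ℕ → Program → Program
loop r v p = while (reg v ⊖ reg r) do′ (p ⨟ (r ≔ reg r ⊕ # 1))

compile : Cmd → Program
compile noop                 = skip
compile (r ⇐ e)             = suc r ≔ compileExpr e
compile (j at d ← e)        =
  mem[ reg 0 ⊕ (double (double (double (double (compileExpr d)))) ⊕ # (toℕ j)) ]≔ compileExpr e
compile (c ▸ d)              = compile c ⨟ compile d
compile (when e then c else d) = if compileExpr e then compile c else′ compile d
compile (for r below v do′ c) = (suc r ≔ # 0) ⨟ loop (suc r) (suc v) (compile c)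

times16≡ : ∀ i → times16 i ≡ i * 16
times16≡ = solve 1 (λ i → let d = λ x → x :+ x in d (d (d (d i))) := i :* con 16) refl
  where open +-*-Solver

address-injective : ∀ b {j i j′ i′} → address b j i ≡ address b j′ i′ → j ≡ j′ × i ≡ i′
address-injective b {j} {i} {j′} {i′} eq = j≡j′ , i≡i′
  where
  eq₁ : toℕ j + i * 16 ≡ toℕ j′ + i′ * 16
  eq₁ = trans (+-comm (toℕ j) _) (trans (cong (_+ toℕ j) (sym (times16≡ i)))
    (trans (+-cancelˡ-≡ b _ _ eq) (trans (cong (_+ toℕ j′) (times16≡ i′)) (+-comm _ (toℕ j′)))))
  rem : ∀ (j : Fin 16) i → (toℕ j + i * 16) % 16 ≡ toℕ j
  rem j i = trans ([m+kn]%n≡m%n (toℕ j) i 16) (m<n⇒m%n≡m (toℕ<n j))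
  j≡j′ : j ≡ j′
  j≡j′ = toℕ-injective (trans (sym (rem j i)) (trans (cong (_% 16) eq₁) (rem j′ i′)))
  i≡i′ : i ≡ i′
  i≡i′ = *-cancelʳ-≡ i i′ 16 (+-cancelˡ-≡ (toℕ j) _ _
    (trans eq₁ (cong (λ k → toℕ k + i′ * 16) (sym j≡j′))))

-- Nothing is said about the cells below `b`: there the original input remains.
record Represents (b : ℕ) (σ : State) (s : Store) : Set where
  field
    base      : regs σ 0 ≡ b
    registers : ∀ r → regs σ (suc r) ≡ vars s r
    memory    : ∀ j i → mem σ (address b j i) ≡ cells s j i
open Represents public

eval-compile : ∀ {b σ s} e → Represents b σ s → eval (compileExpr e) σ ≡ val e s
eval-compile (lit c) R = refl
eval-compile (var r) R = registers R r
eval-compile {σ = σ} (j at e) R = trans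
  (cong₂ (λ b i → mem σ (address b j i)) (base R) (eval-compile e R)) (memory R j _)
eval-compile (d ∔ e) R = cong₂ _+_ (eval-compile d R) (eval-compile e R)
eval-compile (d ⊝ e) R = cong₂ _∸_ (eval-compile d R) (eval-compile e R)

represents-setVar : ∀ {b σ s} r {u v} → Represents b σ s → u ≡ v →
                    Represents b ⟪ regs σ [ suc r ↦ u ] , mem σ ⟫ (setVar r v s)
represents-setVar r R refl = record
  { base = base R ; registers = λ x → cong (if r ≡ᵇ x then _ else_) (registers R x) ; memory = memory R }

represents-setCell : ∀ {b σ s} j {a i u v} → Represents b σ s → a ≡ address b j i → u ≡ v →
                     Represents b ⟪ regs σ , mem σ [ a ↦ u ] ⟫ (setCell j i v s)
represents-setCell {b} {σ} {s} j {i = i} {v = v} R refl refl = record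
  { base = base R ; registers = registers R ; memory = cell }
  where
  cell : ∀ j′ i′ → (mem σ [ address b j i ↦ v ]) (address b j′ i′) ≡ cells (setCell j i v s) j′ i′
  cell j′ i′ with toℕ j ≡ᵇ toℕ j′ in eqj
  ... | false = trans (update-other (mem σ) λ eq → subst T eqj
                  (≡⇒≡ᵇ _ _ (cong toℕ (proj₁ (address-injective b {j} {i} {j′} {i′} eq))))) (memory R j′ i′)
  ... | true with toℕ-injective {i = j} {j′} (T-≡ᵇ (subst T (sym eqj) tt))
  ... | refl with i ≟ i′
  ... | yes refl = trans (update-same (mem σ) (address b j i)) (sym (update-same (cells s j) i))
  ... | no i≢i′ = trans (update-other (mem σ) λ eq → i≢i′ (proj₂ (address-injective b {j} {i} {j} {i′} eq)))
                    (trans (memory R j i′) (sym (update-other (cells s j) i≢i′)))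

-- Running time of compiled loops

opaque
  weight : Cmd → ℕ
  weight noop                 = 1
  weight (r ⇐ e)             = suc (cost (compileExpr e))
  weight (j at d ← e)        =
    suc (cost (reg 0 ⊕ (double (double (double (double (compileExpr d)))) ⊕ # (toℕ j))) + cost (compileExpr e))
  weight (c ▸ d)              = weight c + weight d
  weight (when e then c else d) = suc (cost (compileExpr e) + (weight c + weight d))
  -- Initialising the counter takes 2 steps and the failing test 4; each round adds 4 for the test
  -- and 4 for the increment.
  weight (for r below v do′ c) = 14 + weight c

Kept : List ℕ → Cmd → Set
Kept []      c = ⊤
Kept (u ∷ l) c = T (keeps c u) × Kept l c

-- The loops of c nest as a subsequence of l, and no loop bound is modified.
Nested : List ℕ → Cmd → Set
Nested l       noop                 = ⊤
Nested l       (_ ⇐ _)             = ⊤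
Nested l       (_ at _ ← _)        = ⊤
Nested l       (c ▸ d)              = Nested l c × Nested l d × Kept l c
Nested l       (when _ then c else d) = Nested l c × Nested l d
Nested []      (for r below v do′ c) = ⊥
Nested (u ∷ l) (for r below v do′ c) =
  if u ≡ᵇ v
  then T (keeps (r ⇐ lit 0 ▸ c) v) × T (keeps c r) × Kept l (for r below v do′ c) × Nested l c
  else Nested l (for r below v do′ c)

-- The successors make room for the failing test of a loop without rounds. They also keep the volume
-- positive, so that a command using only some of the bounds fits as well.
volume : List ℕ → (ℕ → ℕ) → ℕ
volume []      ρ = 1
volume (u ∷ l) ρ = suc (ρ u) * volume l ρ

1≤volume : ∀ l ρ → 1 ≤ volume l ρ
1≤volume []      ρ = ≤-refl
1≤volume (u ∷ l) ρ = ≤-trans (1≤volume l ρ) (m≤m+n _ _)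

volume-kept : ∀ l c s → Kept l c → volume l (vars (run c s)) ≡ volume l (vars s)
volume-kept []      c s _        = refl
volume-kept (u ∷ l) c s (k , ks) = cong₂ (λ a b → suc a * b) (frame c k s) (volume-kept l c s ks)

kept-initialised : ∀ l {r v c} → Kept l (for r below v do′ c) → Kept l (r ⇐ lit 0)
kept-initialised []      _        = _
kept-initialised (u ∷ l) (k , ks) = proj₁ (∧-split k) , kept-initialised l ks

kept-body : ∀ l {r v c e} → Kept l (for r below v do′ c) → Kept l (c ▸ r ⇐ e)
kept-body []      _        = _
kept-body (u ∷ l) {r} (k , ks) =
  Equivalence.from T-∧ (proj₂ (∧-split {not (r ≡ᵇ u)} k) , proj₁ (∧-split k)) , kept-body l ks

record Outcome (b : ℕ) (p : Program) (σ : State) (s′ : Store) (bound : ℕ) : Set where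
  constructor outcome
  field
    {time}  : ℕ
    {final} : State
    run⇓    : p , σ ⇓[ time ] final
    result  : Represents b final s′
    time≤   : time ≤ bound

1*volume : ∀ l ρ {m n} → m ≤ n → m ≤ n * volume l ρ
1*volume l ρ {m} {n} m≤n = ≤-trans (≤-trans m≤n (≤-reflexive (sym (*-identityʳ n)))) (*-monoʳ-≤ n (1≤volume l ρ))

loop-time : ∀ m k V {t} → 1 ≤ V → t ≤ k * V → (4 + (t + 4)) + (4 + m * (k * V + 8)) ≤ 4 + suc m * (k * V + 8)
loop-time m k V {t} 1≤V t≤ = ≤-trans (≤-reflexive (rearrange t (m * (k * V + 8))))
  (+-monoʳ-≤ 4 (+-monoˡ-≤ (m * (k * V + 8)) (+-monoˡ-≤ 8 t≤)))
  where
  open +-*-Solver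
  rearrange : ∀ t x → (4 + (t + 4)) + (4 + x) ≡ 4 + ((t + 8) + x)
  rearrange = solve 2 (λ t x → (con 4 :+ (t :+ con 4)) :+ (con 4 :+ x) := con 4 :+ ((t :+ con 8) :+ x)) refl

for-time : ∀ N k V → 1 ≤ V → 2 + (4 + N * (k * V + 8)) ≤ (14 + k) * (suc N * V)
-- The slack is the difference of the two sides; written in the predecessor of the volume it has no
-- negative coefficient.
for-time N k (suc V) _ = m+n≤o⇒m≤o _ {14 * V + 8 + N * (8 * V) + N * 6 + k * suc V + N * V * 6} (≤-reflexive (identity N k V))
  where
  open +-*-Solver
  identity : ∀ N k V → 2 + (4 + N * (k * suc V + 8)) + (14 * V + 8 + N * (8 * V) + N * 6 + k * suc V + N * V * 6)
                       ≡ (14 + k) * (suc N * suc V)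
  identity = solve 3 (λ N k V → let V′ = con 1 :+ V in
    con 2 :+ (con 4 :+ N :* (k :* V′ :+ con 8))
      :+ (con 14 :* V :+ con 8 :+ N :* (con 8 :* V) :+ N :* con 6 :+ k :* V′ :+ N :* V :* con 6)
    := (con 14 :+ k) :* ((con 1 :+ N) :* V′)) refl

opaque
  unfolding weight

  -- Along a sequence the weights add up, since `Kept` lets both commands see the same volume. A
  -- bound in `l` that does not match the loop at hand is skipped, which only lowers the volume. At
  -- a matching bound the body is charged to the rest of the list, once per round.
  simulate : ∀ l c → Nested l c → ∀ {b s σ} → Represents b σ s →
             Outcome b (compile c) σ (run c s) (weight c * volume l (vars s))
  simulate l noop     _ {s = s} R = outcome ⇓-skip R (1*volume l (vars s) ≤-refl)
  simulate l (r ⇐ e) _ {s = s} R =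
    outcome ⇓-assign (represents-setVar r R (eval-compile e R)) (1*volume l (vars s) ≤-refl)
  simulate l (j at d ← e) _ {s = s} R =
    outcome ⇓-store (represents-setCell j {i = val d s} R
      (cong₂ (λ b i → address b j i) (base R) (eval-compile d R)) (eval-compile e R)) (1*volume l (vars s) ≤-refl)
  simulate l (c ▸ d) (nc , nd , kc) {s = s} R
    with outcome run₁ R₁ t₁ ← simulate l c nc R
    with outcome run₂ R₂ t₂ ← simulate l d nd R₁ = outcome (⇓-seq run₁ run₂) R₂
      (≤-trans (+-mono-≤ t₁ (≤-trans t₂ (≤-reflexive (cong (weight d *_) (volume-kept l c s kc)))))
        (≤-reflexive (sym (*-distribʳ-+ (volume l (vars s)) (weight c) (weight d)))))
  simulate l (when e then c else d) (nc , nd) {s = s} R with val e s in eq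
  ... | suc _ with outcome run₁ R₁ t₁ ← simulate l c nc R =
    outcome (⇓-then (λ z → 1+n≢0 (trans (sym eq) (trans (sym (eval-compile e R)) z))) run₁) R₁
      (≤-trans (+-mono-≤ (1*volume l (vars s) (≤-refl {suc (cost (compileExpr e))}))
          (≤-trans t₁ (*-monoˡ-≤ _ (m≤m+n (weight c) (weight d)))))
        (≤-reflexive (sym (*-distribʳ-+ (volume l (vars s)) (suc (cost (compileExpr e))) (weight c + weight d)))))
  ... | zero with outcome run₁ R₁ t₁ ← simulate l d nd R =
    outcome (⇓-else (trans (eval-compile e R) eq) run₁) R₁
      (≤-trans (+-mono-≤ (1*volume l (vars s) (≤-refl {suc (cost (compileExpr e))}))
          (≤-trans t₁ (*-monoˡ-≤ _ (m≤n+m (weight d) (weight c)))))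
        (≤-reflexive (sym (*-distribʳ-+ (volume l (vars s)) (suc (cost (compileExpr e))) (weight c + weight d)))))
  simulate (u ∷ l) (for r below v do′ c) nested {b} {s} {σ} R with u ≡ᵇ v in u≡v
  ... | false with outcome run₁ R₁ t₁ ← simulate l (for r below v do′ c) nested R =
    outcome run₁ R₁ (≤-trans t₁ (*-monoʳ-≤ (14 + weight c) (m≤m+n (volume l (vars s)) _)))
  ... | true with T-≡ᵇ {u} {v} (subst T (sym u≡v) tt) | nested
  ... | refl | kv , kr , kl , nc =
    let outcome run₁ R₁ t₁ = go (vars s v) (setVar r 0 s) _ (update-same (vars s) r)
                               (if-not (proj₁ (∧-split {not (r ≡ᵇ v)} kv)))
                               (volume-kept l (r ⇐ lit 0) s (kept-initialised l kl))
                               (represents-setVar r R refl)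
    in outcome (⇓-seq ⇓-assign run₁) R₁
         (≤-trans (+-monoʳ-≤ 2 t₁) (for-time (vars s v) (weight c) (volume l (vars s)) (1≤volume l (vars s))))
    where
    go : ∀ m z i {τ} → vars z r ≡ i → vars z v ≡ i + m → volume l (vars z) ≡ volume l (vars s) → Represents b τ z →
         Outcome b (loop (suc r) (suc v) (compile c)) τ
           (iterate (λ y → advance r (run c y)) z m) (4 + m * (weight c * volume l (vars s) + 8))
    go zero z i zr zv _ R = outcome (⇓-exit (trans
      (cong₂ _∸_ (trans (registers R v) zv) (trans (registers R r) zr)) (m≤n⇒m∸n≡0 (≤-reflexive (+-identityʳ i))))) R ≤-refl
    go (suc m) z i {τ} zr zv zV R
      with outcome run₁ R₁ t₁ ← simulate l c nc R
      with outcome run₂ R₂ t₂ ← go m (run (c ▸ r ⇐ var r ∔ lit 1) z) (i + 1)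
             (trans (update-same (vars (run c z)) r) (cong (_+ 1) (trans (frame c kr z) zr)))
             (trans (trans (if-not (proj₁ (∧-split {not (r ≡ᵇ v)} kv)))
               (frame c (proj₂ (∧-split {not (r ≡ᵇ v)} kv)) z)) (trans zv (sym (+-assoc i 1 m))))
             (trans (volume-kept l (c ▸ r ⇐ var r ∔ lit 1) z (kept-body l kl)) zV)
             (represents-setVar r R₁ (cong (_+ 1) (registers R₁ r)))
      = outcome (⇓-loop test (⇓-seq run₁ ⇓-assign) run₂) R₂
          (≤-trans (+-monoʳ-≤ (4 + _) t₂) (loop-time m (weight c) (volume l (vars s)) (1≤volume l (vars s))
            (subst (λ x → _ ≤ weight c * x) zV t₁)))
      where
      test : eval (reg (suc v) ⊖ reg (suc r)) τ ≢ 0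
      test eq = 1+n≢0 (trans (sym (m+n∸m≡n i (suc m)))
        (trans (sym (cong₂ _∸_ (trans (registers R v) zv) (trans (registers R r) zr))) eq))

-- Counting

bit : Bool → ℕ
bit b = if b then 1 else 0

total : ℕ → (ℕ → ℕ) → ℕ
total zero    f = 0
total (suc n) f = total n f + f n

total-mono : ∀ n {f g} → (∀ i → i < n → f i ≤ g i) → total n f ≤ total n g
total-mono zero    f≤g = z≤n
total-mono (suc n) f≤g = +-mono-≤ (total-mono n λ i i<n → f≤g i (m<n⇒m<1+n i<n)) (f≤g n ≤-refl)

total-cong : ∀ n {f g} → (∀ i → i < n → f i ≡ g i) → total n f ≡ total n g
total-cong n f≡g = ≤-antisym (total-mono n λ i i<n → ≤-reflexive (f≡g i i<n))
                             (total-mono n λ i i<n → ≤-reflexive (sym (f≡g i i<n)))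

total≤ : ∀ n {f b} → (∀ i → i < n → f i ≤ b) → total n f ≤ n * b
total≤ zero    f≤b = z≤n
total≤ (suc n) {f} {b} f≤b = ≤-trans
  (+-mono-≤ (total≤ n λ i i<n → f≤b i (m<n⇒m<1+n i<n)) (f≤b n ≤-refl)) (≤-reflexive (+-comm (n * b) b))

total≡0 : ∀ n {f} → total n f ≡ 0 → ∀ i → i < n → f i ≡ 0
total≡0 (suc n) {f} eq i i<1+n with i ≟ n
... | yes refl = m+n≡0⇒n≡0 (total n f) eq
... | no i≢n   = total≡0 n (m+n≡0⇒m≡0 (total n f) eq) i (≤∧≢⇒< (≤-pred i<1+n) i≢n)

total-update : ∀ n f {i v} → i < n → total n (f [ i ↦ v ]) + f i ≡ total n f + v
total-update (suc n) f {i} {v} i<1+n with i ≟ n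
... | yes refl = begin
  total n (f [ n ↦ v ]) + (f [ n ↦ v ]) n + f n
    ≡⟨ cong₂ (λ a b → a + b + f n)
         (total-cong n (λ j j<n → update-other f (λ n≡j → <⇒≢ j<n (sym n≡j)))) (update-same f n) ⟩
  total n f + v + f n
    ≡⟨ +-assoc (total n f) v (f n) ⟩
  total n f + (v + f n)
    ≡⟨ cong (total n f +_) (+-comm v (f n)) ⟩
  total n f + (f n + v)
    ≡⟨ +-assoc (total n f) (f n) v ⟨
  total n f + f n + v ∎
  where open ≡-Reasoning
... | no i≢n = begin
  total n (f [ i ↦ v ]) + (f [ i ↦ v ]) n + f i
    ≡⟨ cong (λ b → total n (f [ i ↦ v ]) + b + f i) (update-other f i≢n) ⟩
  total n (f [ i ↦ v ]) + f n + f i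
    ≡⟨ swap (total n (f [ i ↦ v ])) (f n) (f i) ⟩
  total n (f [ i ↦ v ]) + f i + f n
    ≡⟨ cong (_+ f n) (total-update n f (≤∧≢⇒< (≤-pred i<1+n) i≢n)) ⟩
  total n f + v + f n
    ≡⟨ swap (total n f) v (f n) ⟩
  total n f + f n + v ∎
  where
  open ≡-Reasoning
  swap : ∀ a b c → a + b + c ≡ a + c + b
  swap a b c = trans (+-assoc a b c) (trans (cong (a +_) (+-comm b c)) (sym (+-assoc a c b)))

total-front : ∀ n f → total (suc n) f ≡ f 0 + total n (λ i → f (suc i))
total-front zero    f = sym (+-identityʳ (f 0))
total-front (suc n) f = trans (cong (_+ f (suc n)) (total-front n f)) (+-assoc (f 0) _ _)

count : ℕ → (ℕ → Bool) → ℕ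
count n p = total n (λ i → bit (p i))

bit≤1 : ∀ b → bit b ≤ 1
bit≤1 true  = ≤-refl
bit≤1 false = z≤n

count≤ : ∀ n p → count n p ≤ n
count≤ n p = ≤-trans (total≤ n λ i _ → bit≤1 (p i)) (≤-reflexive (*-identityʳ n))

count-not : ∀ n p → count n p + count n (λ i → not (p i)) ≡ n
count-not zero    p = refl
count-not (suc n) p = begin
  c + bit (p n) + (c′ + bit (not (p n)))   ≡⟨ +-assoc c (bit (p n)) _ ⟩
  c + (bit (p n) + (c′ + bit (not (p n)))) ≡⟨ cong (c +_) (last (p n)) ⟩
  c + (c′ + 1)                             ≡⟨ +-assoc c c′ 1 ⟨
  c + c′ + 1                               ≡⟨ cong (_+ 1) (count-not n p) ⟩
  n + 1                                    ≡⟨ +-comm n 1 ⟩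
  suc n                                    ∎
  where
  open ≡-Reasoning
  c  = count n p
  c′ = count n (λ i → not (p i))
  last : ∀ b → bit b + (c′ + bit (not b)) ≡ c′ + 1
  last true  = trans (cong suc (+-identityʳ c′)) (+-comm 1 c′)
  last false = refl

remove : (ℕ → Bool) → ℕ → ℕ → Bool
remove q a y = if a ≡ᵇ y then false else q y

count-remove : ∀ n q {a} → a < n → q a ≡ true → suc (count n (remove q a)) ≡ count n q
count-remove n q {a} a<n qa = begin
  suc (count n (remove q a))                           ≡⟨ +-comm 1 _ ⟩
  count n (remove q a) + 1                             ≡⟨ cong (count n (remove q a) +_) (cong bit qa) ⟨
  count n (remove q a) + bit (q a)                     ≡⟨ cong (_+ bit (q a)) (total-cong n λ y _ → bits y) ⟩
  total n ((λ i → bit (q i)) [ a ↦ 0 ]) + bit (q a)    ≡⟨ total-update n (λ i → bit (q i)) a<n ⟩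
  count n q + 0                                        ≡⟨ +-identityʳ _ ⟩
  count n q                                            ∎
  where
  open ≡-Reasoning
  bits : ∀ y → bit (remove q a y) ≡ ((λ i → bit (q i)) [ a ↦ 0 ]) y
  bits y with a ≡ᵇ y
  ... | true  = refl
  ... | false = refl

-- Induction on the domain: the image of its last element is removed from `q`, and by injectivity
-- the other images avoid it.
count-injection : ∀ n {m p q} (f : ℕ → ℕ) →
  (∀ x → x < n → p x ≡ true → f x < m × q (f x) ≡ true) →
  (∀ x y → x < n → y < n → p x ≡ true → p y ≡ true → f x ≡ f y → x ≡ y) →
  count n p ≤ count m q
count-injection zero    f into inj = z≤n
count-injection (suc n) {m} {p} {q} f into inj with p n in pn
... | false = ≤-trans (≤-reflexive (+-identityʳ _)) (count-injection n f
  (λ x x<n → into x (m<n⇒m<1+n x<n)) λ x y x<n y<n → inj x y (m<n⇒m<1+n x<n) (m<n⇒m<1+n y<n))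
... | true  = ≤-trans (≤-reflexive (+-comm _ 1)) (≤-trans
  (s≤s (count-injection n {m} {p} {remove q (f n)} f into′
    λ x y x<n y<n → inj x y (m<n⇒m<1+n x<n) (m<n⇒m<1+n y<n)))
  (≤-reflexive (count-remove m q (proj₁ (into n ≤-refl pn)) (proj₂ (into n ≤-refl pn)))))
  where
  into′ : ∀ x → x < n → p x ≡ true → f x < m × remove q (f n) (f x) ≡ true
  into′ x x<n px = proj₁ fx , trans (cong (if_then false else q (f x)) (≢⇒≡ᵇ-false fn≢fx)) (proj₂ fx)
    where
    fx = into x (m<n⇒m<1+n x<n) px
    fn≢fx : f n ≢ f x
    fn≢fx eq = <⇒≢ x<n (sym (inj n x ≤-refl (m<n⇒m<1+n x<n) pn px eq))

≡true⇒T : ∀ {b} → b ≡ true → T b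
≡true⇒T refl = tt

T⇒≡true : ∀ {b} → T b → b ≡ true
T⇒≡true {true} _ = refl

≢true⇒≡false : ∀ {b} → b ≢ true → b ≡ false
≢true⇒≡false {true}  b≢ = contradiction refl b≢
≢true⇒≡false {false} _  = refl

≡true⇒≢false : ∀ {b} → b ≡ true → b ≢ false
≡true⇒≢false refl ()

-- Numerals in base w, least significant digit at index 0

value : ℕ → ℕ → (ℕ → ℕ) → ℕ
value w q g = total q (λ i → g i * w ^ i)

value< : ∀ w q {g} → (∀ i → i < q → g i < w) → value w q g < w ^ q
value< w zero    g<w = s≤s z≤n
value< w (suc q) {g} g<w = ≤-trans
  (+-monoˡ-< (g q * w ^ q) (value< w q λ i i<q → g<w i (m<n⇒m<1+n i<q)))
  (*-monoˡ-≤ (w ^ q) (g<w q ≤-refl))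

-- Turns the running number of an attempt back into the prescription itself: reaching the number of
-- a prescription means trying that prescription.
value-injective : ∀ w q {g h} → (∀ i → i < q → g i < w) → (∀ i → i < q → h i < w) →
                  value w q g ≡ value w q h → ∀ i → i < q → g i ≡ h i
value-injective w (suc q) {g} {h} g<w h<w eq = λ i i<1+q → digit i (≤-pred i<1+q)
  where
  lower : ∀ {f} → (∀ i → i < suc q → f i < w) → ∀ i → i < q → f i < w
  lower f<w i i<q = f<w i (m<n⇒m<1+n i<q)
  -- A larger leading digit outweighs all the lower ones.
  dominated : ∀ {f e} → (∀ i → i < suc q → f i < w) → f q < e q → value w (suc q) f < value w (suc q) e
  dominated {f} {e} f<w fq<eq = ≤-trans
    (+-monoˡ-< (f q * w ^ q) (value< w q (lower {f} f<w)))
    (≤-trans (*-monoˡ-≤ (w ^ q) fq<eq) (m≤n+m (e q * w ^ q) (value w q e)))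
  top : g q ≡ h q
  top with <-cmp (g q) (h q)
  ... | tri< g<h _ _ = contradiction eq (<⇒≢ (dominated {g} {h} g<w g<h))
  ... | tri≈ _ g≡h _ = g≡h
  ... | tri> _ _ h<g = contradiction (sym eq) (<⇒≢ (dominated {h} {g} h<w h<g))
  digit : ∀ i → i ≤ q → g i ≡ h i
  digit i i≤q with i ≟ q
  ... | yes refl = top
  ... | no i≢q   = value-injective w q {g} {h} (lower {g} g<w) (lower {h} h<w)
    (+-cancelʳ-≡ (g q * w ^ q) _ _ (trans eq (cong (λ d → value w q h + d * w ^ q) (sym top)))) i (≤∧≢⇒< i≤q i≢q)

-- Chain partitions by auction

record PartialOrderOn (n : ℕ) (_≤ᵇ_ : ℕ → ℕ → Bool) : Set where
  field
    reflexive     : ∀ {x} → x < n → (x ≤ᵇ x) ≡ true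
    transitive    : ∀ {x y z} → x < n → y < n → z < n → (x ≤ᵇ y) ≡ true → (y ≤ᵇ z) ≡ true → (x ≤ᵇ z) ≡ true
    antisymmetric : ∀ {x y} → x < n → y < n → (x ≤ᵇ y) ≡ true → (y ≤ᵇ x) ≡ true → x ≡ y

module Chains (n : ℕ) (leP : ℕ → ℕ → Bool) (order : PartialOrderOn n leP) where
  open PartialOrderOn order

  _⊏_ : ℕ → ℕ → Set
  x ⊏ y = leP x y ≡ true × x ≢ y

  -- The chains are the paths of nx; pv is its partial inverse.  A fixed point
  -- of nx is the top, and a fixed point of pv the bottom, of its chain.
  record Linked (nx pv : ℕ → ℕ) : Set where
    field
      nx<     : ∀ {x} → x < n → nx x < n
      pv<     : ∀ {y} → y < n → pv y < n
      matched : ∀ {x} → x < n → nx x ≢ x → x ⊏ nx x × pv (nx x) ≡ x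
      owned   : ∀ {y} → y < n → pv y ≢ y → nx (pv y) ≡ y

    pv⊏ : ∀ {y} → y < n → pv y ≢ y → pv y ⊏ y
    pv⊏ {y} y<n pv≢ = subst (pv y ⊏_) (owned y<n pv≢)
      (proj₁ (matched (pv< y<n) λ eq → pv≢ (trans (sym eq) (owned y<n pv≢))))

    nx-climbs : ∀ {x} → x < n → leP x (nx x) ≡ true
    nx-climbs {x} x<n with nx x ≟ x
    ... | yes eq = subst (λ y → leP x y ≡ true) (sym eq) (reflexive x<n)
    ... | no neq = proj₁ (proj₁ (matched x<n neq))

    iterate-nx< : ∀ d {x} → x < n → iterate nx x d < n
    iterate-nx< zero    x<n = x<n
    iterate-nx< (suc d) x<n = iterate-nx< d (nx< x<n)

    iterate-climbs : ∀ d {x} → x < n → leP x (iterate nx x d) ≡ true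
    iterate-climbs zero    x<n = reflexive x<n
    iterate-climbs (suc d) x<n =
      transitive x<n (nx< x<n) (iterate-nx< d (nx< x<n)) (nx-climbs x<n) (iterate-climbs d (nx< x<n))

  strictlyBelow : ℕ → ℕ → Bool
  strictlyBelow x z = leP z x ∧ not (z ≡ᵇ x)

  rank : ℕ → ℕ
  rank x = count n (strictlyBelow x)

  -- What is strictly below `x` is below `y` by transitivity and differs from `y` by antisymmetry;
  -- `x` itself is counted for `y` only.
  rank-strict : ∀ {x y} → x < n → y < n → x ⊏ y → rank x < rank y
  rank-strict {x} {y} x<n y<n (x≤y , x≢y) = ≤-trans (s≤s below)
    (≤-reflexive (count-remove n (strictlyBelow y) x<n
      (cong₂ (λ a b → a ∧ not b) x≤y (≢⇒≡ᵇ-false x≢y))))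
    where
    below : rank x ≤ count n (remove (strictlyBelow y) x)
    below = total-mono n step
      where
      step : ∀ z → z < n → bit (strictlyBelow x z) ≤ bit (remove (strictlyBelow y) x z)
      step z z<n with leP z x in zx | z ≡ᵇ x in z≡x
      ... | false | _     = z≤n
      ... | true  | true  = z≤n
      ... | true  | false = ≤-reflexive (sym (cong bit (trans
        (cong (if_then false else strictlyBelow y z) (≢⇒≡ᵇ-false (λ x≡z → z≢x (sym x≡z))))
        (cong₂ (λ a b → a ∧ not b) (transitive z<n x<n y<n zx x≤y)
          (≢⇒≡ᵇ-false λ z≡y → x≢y (antisymmetric x<n y<n x≤y (subst (λ w → leP w x ≡ true) z≡y zx)))))))
        where
        z≢x : z ≢ x
        z≢x eq = ≡true⇒≢false (trans (cong (_≡ᵇ x) eq) (≡ᵇ-refl x)) z≡x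

  iterate-last : ∀ (f : ℕ → ℕ) d x → iterate f x (suc d) ≡ f (iterate f x d)
  iterate-last f zero    x = refl
  iterate-last f (suc d) x = iterate-last f d (f x)

  -- Going back along `pv` strictly lowers the rank, so the walk ends at a bottom after at most
  -- `rank x` steps. This also bounds the way up by `n`.
  chain-bottom : ∀ {nx pv} → Linked nx pv → ∀ {x} → x < n →
                 ∃[ b ] ∃[ d ] b < n × pv b ≡ b × d ≤ n × iterate nx b d ≡ x
  chain-bottom {nx} {pv} linked {x} x<n =
    let b , d , b<n , pvb , d≤ , eq = go (rank x) x<n ≤-refl
    in b , d , b<n , pvb , ≤-trans d≤ (count≤ n _) , eq
    where
    open Linked linked
    go : ∀ r {x} → x < n → rank x ≤ r → ∃[ b ] ∃[ d ] b < n × pv b ≡ b × d ≤ r × iterate nx b d ≡ x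
    go r {x} x<n rank≤r with pv x ≟ x
    ... | yes eq = x , 0 , x<n , eq , z≤n , refl
    ... | no neq with r | ≤-trans (rank-strict (pv< x<n) x<n (pv⊏ x<n neq)) rank≤r
    ... | suc r′ | s≤s rank< =
      let b , d , b<n , pvb , d≤ , eq = go r′ (pv< x<n) rank<
      in b , suc d , b<n , pvb , s≤s d≤ ,
         trans (iterate-last nx d b) (trans (cong nx eq) (owned x<n neq))

  -- The prices 1, ..., n + 1 below this limit outnumber the `n` elements, so by the pigeonhole
  -- principle one of them is the price of no element; the cut is made there.
  limit : ℕ
  limit = n + 2

  record Auction (nx pv price : ℕ → ℕ) : Set where
    field
      linked  : Linked nx pv
      sold    : ∀ {y} → y < n → price y ≢ 0 → pv y ≢ y
      -- each owner paid at most one more than the cheapest alternative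
      thrifty : ∀ {x y} → x < n → nx x ≢ x → y < n → x ⊏ y → price (nx x) ≤ suc (price y)
      price≤  : ∀ {y} → y < n → price y ≤ limit
    open Linked linked public

  Satisfied : (nx price : ℕ → ℕ) → ℕ → Set
  Satisfied nx price x = nx x ≡ x → ∀ {y} → y < n → x ⊏ y → limit ≤ price y

  auction-start : ∀ {nx pv} → (∀ x → x < n → nx x ≡ x × pv x ≡ x) → Auction nx pv (λ _ → 0)
  auction-start fixed = record
    { linked = record
      { nx<     = λ x<n → subst (_< n) (sym (proj₁ (fixed _ x<n))) x<n
      ; pv<     = λ x<n → subst (_< n) (sym (proj₂ (fixed _ x<n))) x<n
      ; matched = λ x<n neq → contradiction (proj₁ (fixed _ x<n)) neq
      ; owned   = λ x<n neq → contradiction (proj₂ (fixed _ x<n)) neq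
      }
    ; sold    = λ _ neq → contradiction refl neq
    ; thrifty = λ _ _ _ _ → z≤n
    ; price≤  = λ _ → z≤n
    }

  -- A single specification for both cases of `release`, with or without an owner of `y`: whoever
  -- pointed to `y` points to itself afterwards. It leaves out `pv`, whose entry at `y` is
  -- overwritten by the sale.
  record Released (y : ℕ) (nx nx′ : ℕ → ℕ) : Set where
    field
      others : ∀ {z} → z < n → nx z ≢ y → nx′ z ≡ nx z
      loser  : ∀ {z} → z < n → nx z ≡ y → nx′ z ≡ z

  module _ {nx pv} (linked : Linked nx pv) {y} (y<n : y < n) where
    open Linked linked

    release-unowned : pv y ≡ y → Released y nx nx
    release-unowned pvy = record { others = λ _ _ → refl ; loser = loser }
      where
      loser : ∀ {z} → z < n → nx z ≡ y → nx z ≡ z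
      loser {z} z<n nxz with nx z ≟ z
      ... | yes eq = eq
      ... | no neq = contradiction
        (trans nxz (trans (sym pvy) (trans (cong pv (sym nxz)) (proj₂ (matched z<n neq))))) neq

    release-owned : pv y ≢ y → Released y nx (nx [ pv y ↦ pv y ])
    release-owned pvy = record
      { others = λ z<n nxz → update-other nx λ pvy≡z → nxz (trans (cong nx (sym pvy≡z)) (owned y<n pvy))
      ; loser  = loser }
      where
      loser : ∀ {z} → z < n → nx z ≡ y → (nx [ pv y ↦ pv y ]) z ≡ z
      loser {z} z<n nxz with pv y ≟ z
      ... | yes refl = update-same nx (pv y)
      ... | no pvy≢z with nx z ≟ z
      ... | yes eq = trans (update-other nx pvy≢z) eq
      ... | no neq = contradiction (trans (cong pv (sym nxz)) (proj₂ (matched z<n neq))) pvy≢z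

  -- The buyer is thrifty because `y` was the cheapest larger element, and everybody else stays
  -- thrifty because prices never fall. A loser becomes free, and `thrifty` makes no claim about
  -- free elements. `sold` persists because an owned element is only ever handed over to another
  -- owner.
  auction-sale : ∀ {nx pv price nx′} → Auction nx pv price →
    ∀ {x y} → x < n → nx x ≡ x → y < n → x ⊏ y → price y < limit →
    (∀ {z} → z < n → x ⊏ z → price y ≤ price z) → Released y nx nx′ →
    Auction (nx′ [ x ↦ y ]) (pv [ y ↦ x ]) (price [ y ↦ price y + 1 ])
  auction-sale {nx} {pv} {price} {nx′} auction {x} {y} x<n nxx y<n x⊏y py< cheapest released = record
    { linked  = record { nx< = nx″< ; pv< = pv′< ; matched = matched′ ; owned = owned′ }
    ; sold    = sold′
    ; thrifty = thrifty′
    ; price≤  = price≤′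
    }
    where
    open Auction auction
    open Released released
    nx″ = nx′ [ x ↦ y ]
    pv′ = pv [ y ↦ x ]
    price′ = price [ y ↦ price y + 1 ]

    dearer : ∀ z → price z ≤ price′ z
    dearer z with y ≟ z
    ... | yes refl = ≤-trans (m≤m+n (price y) 1) (≤-reflexive (sym (update-same price y)))
    ... | no y≢z   = ≤-reflexive (sym (update-other price y≢z))

    nx″-cases : ∀ z → z < n → (x ≡ z × nx″ z ≡ y) ⊎ nx″ z ≡ z ⊎ (x ≢ z × nx z ≢ y × nx″ z ≡ nx z)
    nx″-cases z z<n with x ≟ z | nx z ≟ y
    ... | yes refl | _      = inj₁ (refl , update-same nx′ x)
    ... | no x≢z   | yes eq = inj₂ (inj₁ (trans (update-other nx′ x≢z) (loser z<n eq)))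
    ... | no x≢z   | no neq = inj₂ (inj₂ (x≢z , neq , trans (update-other nx′ x≢z) (others z<n neq)))

    nx″< : ∀ {z} → z < n → nx″ z < n
    nx″< {z} z<n with nx″-cases z z<n
    ... | inj₁ (_ , eq)              = subst (_< n) (sym eq) y<n
    ... | inj₂ (inj₁ eq)             = subst (_< n) (sym eq) z<n
    ... | inj₂ (inj₂ (_ , _ , eq))   = subst (_< n) (sym eq) (nx< z<n)

    pv′< : ∀ {z} → z < n → pv′ z < n
    pv′< {z} z<n with y ≟ z
    ... | yes refl = subst (_< n) (sym (update-same pv y)) x<n
    ... | no y≢z   = subst (_< n) (sym (update-other pv y≢z)) (pv< z<n)

    matched′ : ∀ {z} → z < n → nx″ z ≢ z → z ⊏ nx″ z × pv′ (nx″ z) ≡ z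
    matched′ {z} z<n neq with nx″-cases z z<n
    ... | inj₁ (refl , eq)    = subst (x ⊏_) (sym eq) x⊏y , trans (cong pv′ eq) (update-same pv y)
    ... | inj₂ (inj₁ eq)      = contradiction eq neq
    ... | inj₂ (inj₂ (_ , nxz≢y , eq)) =
      let z⊏ , pvnx = matched z<n (λ e → neq (trans eq e))
      in subst (z ⊏_) (sym eq) z⊏ ,
         trans (cong pv′ eq) (trans (update-other pv (λ y≡ → nxz≢y (sym y≡))) pvnx)

    owned′ : ∀ {z} → z < n → pv′ z ≢ z → nx″ (pv′ z) ≡ z
    owned′ {z} z<n neq with y ≟ z
    ... | yes refl = trans (cong nx″ (update-same pv y)) (update-same nx′ x)
    ... | no y≢z   = trans (cong nx″ pv′z) (trans (update-other nx′ x≢pvz)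
                       (trans (others (pv< z<n) (λ eq → y≢z (trans (sym eq) nxpv))) nxpv))
      where
      pv′z : pv′ z ≡ pv z
      pv′z = update-other pv y≢z
      pvz≢z : pv z ≢ z
      pvz≢z eq = neq (trans pv′z eq)
      nxpv : nx (pv z) ≡ z
      nxpv = owned z<n pvz≢z
      x≢pvz : x ≢ pv z
      x≢pvz eq = pvz≢z (trans (sym eq) (trans (sym nxx) (trans (cong nx eq) nxpv)))

    sold′ : ∀ {z} → z < n → price′ z ≢ 0 → pv′ z ≢ z
    sold′ {z} z<n neq with y ≟ z
    ... | yes refl = λ eq → proj₂ x⊏y (trans (sym (update-same pv y)) eq)
    ... | no y≢z   = λ eq → sold z<n (λ e → neq (trans (update-other price y≢z) e))
                             (trans (sym (update-other pv y≢z)) eq)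

    thrifty′ : ∀ {z v} → z < n → nx″ z ≢ z → v < n → z ⊏ v → price′ (nx″ z) ≤ suc (price′ v)
    thrifty′ {z} {v} z<n neq v<n z⊏v with nx″-cases z z<n
    ... | inj₁ (refl , eq) = ≤-trans (≤-reflexive (trans (cong price′ eq)
                               (trans (update-same price y) (+-comm (price y) 1))))
                               (s≤s (≤-trans (cheapest v<n z⊏v) (dearer v)))
    ... | inj₂ (inj₁ eq)   = contradiction eq neq
    ... | inj₂ (inj₂ (_ , nxz≢y , eq)) = ≤-trans (≤-reflexive (trans (cong price′ eq)
                               (update-other price (λ y≡ → nxz≢y (sym y≡)))))
                               (≤-trans (thrifty z<n (λ e → neq (trans eq e)) v<n z⊏v) (s≤s (dearer v)))

    price≤′ : ∀ {z} → z < n → price′ z ≤ limit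
    price≤′ {z} z<n with y ≟ z
    ... | yes refl = ≤-trans (≤-reflexive (trans (update-same price y) (+-comm (price y) 1))) py<
    ... | no y≢z   = ≤-trans (≤-reflexive (update-other price y≢z)) (price≤ z<n)

  unused-price : ∀ price → ∃[ j ] 1 ≤ j × j < limit × (∀ {y} → y < n → price y ≢ j)
  unused-price price
    with ¬∀⟶∃¬ (suc n) (λ j → ∃[ y ] price (toℕ {n} y) ≡ suc (toℕ j))
           (λ j → any? λ y → price (toℕ y) ≟ suc (toℕ j)) all-used
    where
    all-used : ¬ (∀ (j : Fin (suc n)) → ∃[ y ] price (toℕ {n} y) ≡ suc (toℕ j))
    all-used used =
      let i , j , i<j , same = pigeonhole ≤-refl (λ j → proj₁ (used j))
      in <⇒≢ i<j (suc-injective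
           (trans (sym (proj₂ (used i))) (trans (cong (λ y → price (toℕ y)) same) (proj₂ (used j)))))
  ... | j , none = suc (toℕ j) , s≤s z≤n ,
    ≤-trans (s≤s (s≤s (≤-pred (toℕ<n j)))) (≤-reflexive (+-comm 2 n)) ,
    λ y<n eq → none (fromℕ< y<n , trans (cong price (toℕ-fromℕ< y<n)) eq)

  bottoms : (ℕ → ℕ) → ℕ → Bool
  bottoms pv y = pv y ≡ᵇ y

  -- Complementary slackness at the unused price j (the analogue of König's
  -- theorem): the elements priced below j whose chain successor, if any, is
  -- priced above j.
  antichain-of-size-bottoms : ∀ {nx pv price} → Auction nx pv price →
    (∀ {x} → x < n → Satisfied nx price x) →
    ∃[ A ] count n (bottoms pv) ≤ count n A ×
      (∀ {x y} → x < n → y < n → A x ≡ true → A y ≡ true → ¬ (x ⊏ y))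
  antichain-of-size-bottoms {nx} {pv} {price} auction satisfied
    with j , 1≤j , j<limit , unused ← unused-price price =
      A , complement≤ , independent
    where
    open Auction auction
    A : ℕ → Bool
    A x = (price x ≤ᵇ j) ∧ ((nx x ≡ᵇ x) ∨ (j <ᵇ price (nx x)))

    A-sound : ∀ {x} → A x ≡ true → price x ≤ j × (nx x ≡ x ⊎ j < price (nx x))
    A-sound {x} ax with price x ≤ᵇ j in e₁ | nx x ≡ᵇ x in e₂ | j <ᵇ price (nx x) in e₃ | ax
    ... | true | true  | _    | refl = ≤ᵇ⇒≤ _ _ (≡true⇒T e₁) , inj₁ (≡ᵇ⇒≡ _ _ (≡true⇒T e₂))
    ... | true | false | true | refl = ≤ᵇ⇒≤ _ _ (≡true⇒T e₁) , inj₂ (<ᵇ⇒< _ _ (≡true⇒T e₃))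

    A-complete : ∀ {x} → price x ≤ j → nx x ≡ x ⊎ j < price (nx x) → A x ≡ true
    A-complete {x} p≤j (inj₁ eq) = cong₂ (λ a b → a ∧ (b ∨ (j <ᵇ price (nx x))))
      (T⇒≡true (≤⇒≤ᵇ p≤j)) (T⇒≡true (≡⇒≡ᵇ _ _ eq))
    A-complete {x} p≤j (inj₂ j<) with nx x ≡ᵇ x
    ... | true  = cong (_∧ true) (T⇒≡true (≤⇒≤ᵇ p≤j))
    ... | false = cong₂ _∧_ (T⇒≡true (≤⇒≤ᵇ p≤j)) (T⇒≡true (<⇒<ᵇ j<))

    independent : ∀ {x y} → x < n → y < n → A x ≡ true → A y ≡ true → ¬ (x ⊏ y)
    independent {x} {y} x<n y<n ax ay x⊏y with A-sound {y} ay | nx x ≟ x | A-sound {x} ax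
    ... | py≤j , _ | yes eq | _ = <⇒≱ j<limit (≤-trans (satisfied x<n eq y<n x⊏y) py≤j)
    ... | py≤j , _ | no neq | _ , inj₁ eq = neq eq
    -- Thrift gives `price (nx x) ≤ suc (price y)`, so `j ≤ price y`. Together with `price y ≤ j`
    -- the price `j` would be in use.
    ... | py≤j , _ | no neq | _ , inj₂ j< =
      unused y<n (≤-antisym py≤j (≤-pred (≤-trans j< (thrifty x<n neq y<n x⊏y))))

    -- Injects the complement of `A` into the elements that are not bottoms. An element priced above
    -- `j` has been sold and is its own image; any other element outside `A` has a successor priced
    -- at most `j`. The two kinds of images lie on different sides of `j`, so they cannot collide.
    image : ℕ → ℕ
    image x = if price x ≤ᵇ j then nx x else x

    image-cases : ∀ {x} → not (A x) ≡ true →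
      (j < price x × image x ≡ x) ⊎ (nx x ≢ x × price (nx x) ≤ j × image x ≡ nx x)
    image-cases {x} ¬ax with price x ≤? j
    ... | no p≰j = inj₁ (≰⇒> p≰j ,
      cong (if_then nx x else x) (≢true⇒≡false λ eq → p≰j (≤ᵇ⇒≤ _ _ (≡true⇒T eq))))
    ... | yes p≤j = inj₂ (outside (λ eq → A-complete p≤j (inj₁ eq)) ,
      ≮⇒≥ (outside λ j< → A-complete p≤j (inj₂ j<)) , cong (if_then nx x else x) (T⇒≡true (≤⇒≤ᵇ p≤j)))
      where
      outside : ∀ {B : Set} → (B → A x ≡ true) → ¬ B
      outside f b = ≡true⇒≢false ¬ax (cong not (f b))

    unowned : ∀ {y} → pv y ≢ y → not (bottoms pv y) ≡ true
    unowned pv≢ = cong not (≢⇒≡ᵇ-false pv≢)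

    into : ∀ x → x < n → not (A x) ≡ true → image x < n × not (bottoms pv (image x)) ≡ true
    into x x<n ¬ax with image-cases ¬ax
    ... | inj₁ (j<p , eq) = subst (λ z → z < n × not (bottoms pv z) ≡ true) (sym eq)
      (x<n , unowned (sold x<n λ p≡0 → <⇒≱ j<p (≤-trans (≤-reflexive p≡0) z≤n)))
    ... | inj₂ (nx≢ , _ , eq) = subst (λ z → z < n × not (bottoms pv z) ≡ true) (sym eq)
      (nx< x<n , unowned λ e → nx≢ (trans (sym e) (proj₂ (matched x<n nx≢))))

    injective : ∀ x y → x < n → y < n → not (A x) ≡ true → not (A y) ≡ true → image x ≡ image y → x ≡ y
    injective x y x<n y<n ¬ax ¬ay same with image-cases ¬ax | image-cases ¬ay
    ... | inj₁ (_ , e) | inj₁ (_ , e′) = trans (sym e) (trans same e′)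
    ... | inj₁ (j<p , e) | inj₂ (_ , p≤j , e′) =
      contradiction (subst (λ z → price z ≤ j) (trans (sym e′) (trans (sym same) e)) p≤j) (<⇒≱ j<p)
    ... | inj₂ (_ , p≤j , e) | inj₁ (j<p , e′) =
      contradiction (subst (λ z → price z ≤ j) (trans (sym e) (trans same e′)) p≤j) (<⇒≱ j<p)
    ... | inj₂ (nx≢ , _ , e) | inj₂ (nx≢′ , _ , e′) = trans (sym (proj₂ (matched x<n nx≢)))
      (trans (cong pv (trans (sym e) (trans same e′))) (proj₂ (matched y<n nx≢′)))

    complement≤ : count n (bottoms pv) ≤ count n A
    complement≤ = +-cancelʳ-≤ (count n (λ x → not (A x))) _ _ (begin
      count n (bottoms pv) + count n (λ x → not (A x))
        ≤⟨ +-monoʳ-≤ (count n (bottoms pv)) (count-injection n {q = λ y → not (bottoms pv y)} image into injective) ⟩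
      count n (bottoms pv) + count n (λ y → not (bottoms pv y))
        ≡⟨ count-not n (bottoms pv) ⟩
      n
        ≡⟨ count-not n A ⟨
      count n A + count n (λ x → not (A x)) ∎)
      where open ≤-Reasoning

-- The greedy search for an embedding

module Greedy (n : ℕ) (leP : ℕ → ℕ → Bool) (order : PartialOrderOn n leP)
              (k : ℕ) (leQ : ℕ → ℕ → Bool) where
  open PartialOrderOn order
  open Chains n leP order

  Agree : (ℕ → ℕ) → ℕ → ℕ → Set
  Agree m p q = leQ p q ≡ leP (m p) (m q)

  InRange : (ℕ → ℕ) → Set
  InRange m = ∀ q → q < k → m q < n

  IsEmbedding : (ℕ → ℕ) → Set
  IsEmbedding m = InRange m × (∀ p q → p < k → q < k → Agree m p q)

  module _ {nx pv} (linked : Linked nx pv) {ε} (embedding : IsEmbedding ε) where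
    open Linked linked

    -- d q is the number of steps from m q up to ε q along its chain.
    Under : (ℕ → ℕ) → ℕ → Set
    Under m t = ∃[ d ] (∀ q → q < k → iterate nx (m q) (d q) ≡ ε q) × total k d + t ≤ k * n

    under-pred : ∀ {m t} → Under m (suc t) → Under m t
    under-pred (d , reach , bound) = d , reach , ≤-trans (+-monoʳ-≤ (total k d) (n≤1+n _)) bound

    -- In `Under` the number `t` counts moves already made. At `k * n` the budget is exhausted,
    -- every remaining distance is zero, and `m` coincides with `ε`.
    under-end : ∀ {m} → Under m (k * n) → ∀ p q → p < k → q < k → Agree m p q
    under-end {m} (d , reach , bound) p q p<k q<k =
      trans (proj₂ embedding p q p<k q<k) (sym (cong₂ leP (arrived p p<k) (arrived q q<k)))
      where
      arrived : ∀ q → q < k → m q ≡ ε q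
      arrived q q<k = trans (cong (iterate nx (m q)) (sym (total≡0 k
        (n≤0⇒n≡0 (+-cancelʳ-≤ (k * n) (total k d) 0 bound)) q q<k))) (reach q q<k)

    under-step : ∀ {m t q} → q < k → (∀ d → iterate nx (m q) d ≡ ε q → d ≢ 0) →
                 Under m t → Under (m [ q ↦ nx (m q) ]) (suc t)
    under-step {m} {t} {q} q<k ahead (d , reach , bound) with d q in dq
    ... | zero  = contradiction dq (ahead (d q) (reach q q<k))
    ... | suc e = d [ q ↦ e ] , reach′ , (begin
      total k (d [ q ↦ e ]) + suc t  ≡⟨ +-suc _ t ⟩
      suc (total k (d [ q ↦ e ]) + t) ≡⟨ cong (_+ t) (suc-injective (begin-equality
        suc (suc (total k (d [ q ↦ e ])))     ≡⟨ cong suc drop ⟩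
        suc (total k d) ∎)) ⟩
      total k d + t                  ≤⟨ bound ⟩
      k * n                          ∎)
      where
      open ≤-Reasoning
      drop : suc (total k (d [ q ↦ e ])) ≡ total k d
      drop = +-cancelʳ-≡ e _ _ (trans (sym (+-suc _ e))
        (trans (cong (total k (d [ q ↦ e ]) +_) (sym dq)) (total-update k d q<k)))
      reach′ : ∀ p → p < k → iterate nx ((m [ q ↦ nx (m q) ]) p) ((d [ q ↦ e ]) p) ≡ ε p
      reach′ p p<k with q ≟ p
      ... | yes refl = trans (cong₂ (iterate nx) (update-same m q) (update-same d q))
                         (trans (cong (iterate nx (m q)) (sym dq)) (reach q q<k))
      ... | no q≢p   = trans (cong₂ (iterate nx) (update-other m q≢p) (update-other d q≢p)) (reach p p<k)

    module _ {m t} (range : InRange m) (under : Under m t) {p q} (p<k : p < k) (q<k : q < k) where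
      private
        εp<n = proj₁ embedding p p<k
        εq<n = proj₁ embedding q q<k
        agree = proj₂ embedding p q p<k q<k
        climb : ∀ q → q < k → leP (m q) (ε q) ≡ true
        climb q q<k = let d , reach , _ = under in
          subst (λ x → leP (m q) x ≡ true) (reach q q<k) (iterate-climbs (d q) (range q q<k))

      -- As m p ≼ ε p ≼ ε q, the element ε q lies strictly above m q.
      raise-upper : leQ p q ≡ true → leP (m p) (m q) ≡ false → Under (m [ q ↦ nx (m q) ]) (suc t)
      raise-upper p≤q mp≰mq = under-step q<k (λ { zero mq≡εq _ → ≡true⇒≢false
        (subst (λ x → leP (m p) x ≡ true) (sym mq≡εq) (transitive (range p p<k) εp<n εq<n (climb p p<k)
          (trans (sym agree) p≤q))) mp≰mq }) under

      -- If ε p were equal to m p, then ε p = m p ≼ m q ≼ ε q.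
      raise-lower : leQ p q ≡ false → leP (m p) (m q) ≡ true → Under (m [ p ↦ nx (m p) ]) (suc t)
      raise-lower p≰q mp≤mq = under-step p<k (λ { zero mp≡εp _ → ≡true⇒≢false
        (trans agree (subst (λ x → leP x (ε q) ≡ true) mp≡εp (transitive (range p p<k) (range q q<k) εq<n
          mp≤mq (climb q q<k)))) p≰q }) under

-- The algorithm

record Same (c : Cmd) (s z : Store) : Set where
  constructor same
  field
    sameVar   : ∀ x → T (keeps c x) → vars z x ≡ vars s x
    sameArray : ∀ j → T (keepsArray c j) → cells z j ≡ cells s j
open Same public

run-same : ∀ c s → Same c s (run c s)
run-same c s = same (λ _ k → frame c k s) (λ _ k → frameArray c k s)

-- Weakest precondition, computed through loop-free code only. A conditional becomes two hypotheses
-- about its test; a loop is left as a run, to be treated by `loop-rule`.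
wp : Cmd → (Store → Set) → Store → Set
wp noop                     R s = R s
wp (r ⇐ e)                  R s = R (setVar r (val e s) s)
wp (j at d ← e)             R s = R (setCell j (val d s) (val e s) s)
wp (c ▸ d)                  R s = wp c (wp d R) s
wp (when e then c else d)   R s = (val e s ≢ 0 → wp c R s) × (val e s ≡ 0 → wp d R s)
wp c@(for _ below _ do′ _)  R s = R (run c s)

wp-run : ∀ c R s → wp c R s → R (run c s)
wp-run noop                     R s p = p
wp-run (r ⇐ e)                  R s p = p
wp-run (j at d ← e)             R s p = p
wp-run (c ▸ d)                  R s p = wp-run d R (run c s) (wp-run c (wp d R) s p)
wp-run (when e then c else d)   R s (p , q) with val e s
... | zero  = wp-run d R s (q refl)
... | suc _ = wp-run c R s (p λ ())
wp-run (for _ below _ do′ _)    R s p = p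

run-wp : ∀ c R s → R (run c s) → wp c R s
run-wp noop                     R s p = p
run-wp (r ⇐ e)                  R s p = p
run-wp (j at d ← e)             R s p = p
run-wp (c ▸ d)                  R s p = run-wp c (wp d R) s (run-wp d R (run c s) p)
run-wp (when e then c else d)   R s p with val e s
... | zero  = (λ 0≢0 → contradiction refl 0≢0) , λ _ → run-wp d R s p
... | suc _ = (λ _ → run-wp c R s p) , λ ()
run-wp (for _ below _ do′ _)    R s p = p

-- `Same` travels along with the invariant, so that `I` has to speak only about what the body
-- changes.
loop-rule : ∀ r v c (I : ℕ → Store → Set) s {N} → vars s v ≡ N → T (keeps c r) →
  I 0 (setVar r 0 s) →
  (∀ i z → i < N → vars z r ≡ i → Same (for r below v do′ c) s z → I i z →
    I (suc i) (advance r (run c z))) →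
  I N (run (for r below v do′ c) s)
loop-rule r v c I s {N} vN kr start step = proj₂ (for-rule {r} {v} {c}
  (λ i z → Same (for r below v do′ c) s z × I i z) vN kr
  (same (λ x k → if-not (proj₁ (∧-split {not (r ≡ᵇ x)} k))) (λ _ _ → refl) , start)
  (λ i z i<N zr (sm , inv) → same
     (λ x k → trans (if-not (proj₁ (∧-split {not (r ≡ᵇ x)} k)))
       (trans (frame c (proj₂ (∧-split {not (r ≡ᵇ x)} k)) z) (sameVar sm x k)))
     (λ j k → trans (frameArray c k z) (sameArray sm j k))
   , step i z i<N zr sm inv))

Bound : Store → ℕ → ℕ → Set
Bound s v m = vars s v ≡ m

volume-bounds : ∀ {s l ms} → Pointwise (Bound s) l ms → volume l (vars s) ≡ product (map suc ms)
volume-bounds []       = refl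
volume-bounds {s} (b ∷ bs) = cong₂ (λ x y → suc x * y) b (volume-bounds {s} bs)

bit-true : ∀ {v b} → v ≡ bit b → v ≢ 0 → b ≡ true
bit-true {b = true}  _  _   = refl
bit-true {b = false} eq v≢0 = contradiction eq v≢0

bit-false : ∀ {v b} → v ≡ bit b → v ≡ 0 → b ≡ false
bit-false {b = false} _  _  = refl
bit-false {b = true} eq v≡0 = contradiction (trans (sym eq) v≡0) λ ()

-- The absolute difference: with truncated subtraction one summand is always zero, and the sum
-- vanishes exactly when the values are equal.
differ : Expr → Expr → Expr
differ d e = (d ⊝ e) ∔ (e ⊝ d)

differ≡0 : ∀ a b → (a ∸ b) + (b ∸ a) ≡ 0 → a ≡ b
differ≡0 a b eq = ≤-antisym (m∸n≡0⇒m≤n (m+n≡0⇒m≡0 (a ∸ b) eq)) (m∸n≡0⇒m≤n (m+n≡0⇒n≡0 (a ∸ b) eq))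

differ≢0 : ∀ a b → (a ∸ b) + (b ∸ a) ≢ 0 → a ≢ b
differ≢0 a b neq refl = neq (cong₂ _+_ (n∸n≡0 a) (n∸n≡0 a))

-- Variables, arrays and commands of the algorithm

inputA rowPA rowQA nextA prevA priceA bottomA guessA posA : Fin 16
inputA  = Fin.# 0
rowPA   = Fin.# 1
rowQA   = Fin.# 2
nextA   = Fin.# 3
prevA   = Fin.# 4
priceA  = Fin.# 5
bottomA = Fin.# 6
guessA  = Fin.# 7
posA    = Fin.# 8

K N ROUNDS WIDTH GUESSES STEPS ACC X Y IT P Q BEST PRICE LIMIT FOUND GOOD CARRY : ℕ
K       = 0
N       = 1
ROUNDS  = 2
WIDTH   = 3
GUESSES = 4
STEPS   = 5
ACC     = 6
X       = 7
Y       = 8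
IT      = 9
P       = 10
Q       = 11
BEST    = 12
PRICE   = 13
LIMIT   = 14
FOUND   = 15
GOOD    = 16
CARRY   = 17

-- The position of each row of the matrix is tabulated beforehand, so that an order query needs an
-- addition but no multiplication.
leqP leqQ : Expr → Expr → Expr
leqP d e = inputA at (rowPA at d ∔ e)
leqQ d e = inputA at (rowQA at d ∔ e)

undercut : Cmd
undercut =
  when leqP (var X) (var Y) then
    when differ (var X) (var Y) then
      when var PRICE ⊝ priceA at var Y then
        (BEST ⇐ var Y ▸ PRICE ⇐ priceA at var Y)
      else noop
    else noop
  else noop

findCheapest : Cmd
-- Starting from the limit admits only prices strictly below it; if `PRICE` is still the limit at
-- the end, nothing was affordable.
findCheapest = PRICE ⇐ var LIMIT ▸ for Y below N do′ undercut

release : Cmd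
release =
  when differ (prevA at var BEST) (var BEST) then
    (nextA at (prevA at var BEST) ← prevA at var BEST)
  else noop

sell : Cmd
sell =
  release ▸
  (nextA at var X ← var BEST) ▸
  (prevA at var BEST ← var X) ▸
  (priceA at var BEST ← priceA at var BEST ∔ lit 1)

bid : Cmd
bid =
  when differ (nextA at var X) (var X) then noop
  else (findCheapest ▸ when var LIMIT ⊝ var PRICE then sell else noop)

auctionRound : Cmd
auctionRound = for X below N do′ bid

auction : Cmd
auction = for IT below ROUNDS do′ auctionRound

collect : Cmd
collect =
  when differ (prevA at var Y) (var Y) then noop
  else ((bottomA at var WIDTH ← var Y) ▸ WIDTH ⇐ var WIDTH ∔ lit 1)

collectBottoms : Cmd
collectBottoms = WIDTH ⇐ lit 0 ▸ for Y below N do′ collect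

raise : Cmd
raise = ACC ⇐ lit 0 ▸ for X below WIDTH do′ (ACC ⇐ var ACC ∔ var GUESSES) ▸ GUESSES ⇐ var ACC

countGuesses : Cmd
countGuesses = GUESSES ⇐ lit 1 ▸ for Q below K do′ raise

countSteps : Cmd
countSteps = STEPS ⇐ lit 0 ▸ for X below N do′ (STEPS ⇐ var STEPS ∔ var K)

place : Cmd
place = for Q below K do′ (posA at var Q ← bottomA at (guessA at var Q))

repair : Cmd
repair =
  when leqQ (var P) (var Q) then
    when leqP (posA at var P) (posA at var Q) then noop
    else (posA at var Q ← nextA at (posA at var Q))
  else
    when leqP (posA at var P) (posA at var Q) then
      (posA at var P ← nextA at (posA at var P))
    else noop

repairRow sweep settle : Cmd
repairRow = for Q below K do′ repair
sweep     = for P below K do′ repairRow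
settle    = for X below STEPS do′ sweep

-- If the prescription admits no embedding, then `settle` may end in any position, for instance with
-- elements stuck at the tops of their chains. Verification makes a positive answer sound regardless
-- of how the position was reached.
check checkRow verify : Cmd
check    =
  when differ (leqQ (var P) (var Q)) (leqP (posA at var P) (posA at var Q)) then GOOD ⇐ lit 0 else noop
checkRow = for Q below K do′ check
verify   = GOOD ⇐ lit 1 ▸ for P below K do′ checkRow

carryDigit increment : Cmd
carryDigit =
  when var CARRY then
    when differ (guessA at var Q ∔ lit 1) (var WIDTH) then
      ((guessA at var Q ← guessA at var Q ∔ lit 1) ▸ CARRY ⇐ lit 0)
    else (guessA at var Q ← lit 0)
  else noop
increment = CARRY ⇐ lit 1 ▸ for Q below K do′ carryDigit

record-success tryGuess search : Cmd
record-success = when var GOOD then FOUND ⇐ lit 1 else noop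
tryGuess       = place ▸ settle ▸ verify ▸ record-success ▸ increment
search         = FOUND ⇐ lit 0 ▸ for IT below GUESSES do′ tryGuess

fillRows : Fin 16 → ℕ → Cmd
fillRows j v = for X below v do′ ((j at var X ← var ACC) ▸ ACC ⇐ var ACC ∔ var v)

isolate isolateAll countRounds setup : Cmd
isolate     = (nextA at var X ← var X) ▸ (prevA at var X ← var X)
isolateAll  = for X below N do′ isolate
-- This is 4 n^2, which exceeds the largest possible sum of prices, n (n + 2), as soon as n is
-- positive.
countRounds = ROUNDS ⇐ lit 0 ▸ for X below N do′ (ROUNDS ⇐ var ROUNDS ∔ (var N ∔ var N ∔ var N ∔ var N))
-- The first two cells hold the sizes. After the rows of Q have been tabulated, `ACC` points to the
-- beginning of the matrix of P.
setup       = ACC ⇐ lit 2 ▸ fillRows rowQA K ▸ fillRows rowPA N ▸ isolateAll ▸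
              LIMIT ⇐ var N ∔ lit 2 ▸ countRounds

countWork : Cmd
countWork = countGuesses ▸ countSteps

-- Correctness of the stages

raise-correct : ∀ s → vars (run raise s) GUESSES ≡ vars s WIDTH * vars s GUESSES
raise-correct s = loop-rule X WIDTH (ACC ⇐ var ACC ∔ var GUESSES) (λ i z → vars z ACC ≡ i * vars s GUESSES)
  (setVar ACC 0 s) refl tt refl
  λ i z _ _ sm acc → trans (cong₂ _+_ acc (sameVar sm GUESSES tt)) (+-comm (i * vars s GUESSES) _)

countGuesses-correct : ∀ s → vars (run countGuesses s) GUESSES ≡ vars s WIDTH ^ vars s K
countGuesses-correct s = loop-rule Q K raise (λ q z → vars z GUESSES ≡ vars s WIDTH ^ q)
  (setVar GUESSES 1 s) refl tt refl
  λ q z _ _ sm guesses → trans (raise-correct z) (cong₂ _*_ (sameVar sm WIDTH tt) guesses)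

keepsTables : Cmd → Bool
keepsTables c = keeps c K ∧ keeps c N ∧ keepsArray c inputA ∧ keepsArray c rowPA ∧ keepsArray c rowQA

module Correctness (n : ℕ) (leP : ℕ → ℕ → Bool) (order : PartialOrderOn n leP)
                   (k : ℕ) (leQ : ℕ → ℕ → Bool) where
  open PartialOrderOn order
  open Chains n leP order
  open Greedy n leP order k leQ

  record Tables (s : Store) : Set where
    field
      var-K  : vars s K ≡ k
      var-N  : vars s N ≡ n
      tableP : ∀ {x y} → x < n → y < n → cells s inputA (cells s rowPA x + y) ≡ bit (leP x y)
      tableQ : ∀ {x y} → x < k → y < k → cells s inputA (cells s rowQA x + y) ≡ bit (leQ x y)

    valueP : ∀ {x y x′ y′} → x′ ≡ x → y′ ≡ y → x < n → y < n →
             cells s inputA (cells s rowPA x′ + y′) ≡ bit (leP x y)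
    valueP refl refl = tableP
  open Tables

  tables-same : ∀ c {s z} → T (keepsTables c) → Same c s z → Tables s → Tables z
  tables-same c {s} {z} kt sm tb =
    let kK , kt₁ = ∧-split {keeps c K} kt
        kN , kt₂ = ∧-split {keeps c N} kt₁
        kI , kt₃ = ∧-split {keepsArray c inputA} kt₂
        kP , kQ  = ∧-split {keepsArray c rowPA} kt₃
    in record
    { var-K  = trans (sameVar sm K kK) (var-K tb)
    ; var-N  = trans (sameVar sm N kN) (var-N tb)
    ; tableP = λ {x} {y} x<n y<n → trans
        (cong₂ (λ A R → A (R x + y)) (sameArray sm inputA kI) (sameArray sm rowPA kP)) (tableP tb x<n y<n)
    ; tableQ = λ {x} {y} x<k y<k → trans
        (cong₂ (λ A R → A (R x + y)) (sameArray sm inputA kI) (sameArray sm rowQA kQ)) (tableQ tb x<k y<k)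
    }

  tables-run : ∀ c {s} → T (keepsTables c) → Tables s → Tables (run c s)
  tables-run c kt = tables-same c kt (run-same c _)

  -- The scan after the candidates below `i`. The constructor is determined by `p`: it equals the
  -- limit precisely when no larger element seen so far is affordable.
  data Search (price : ℕ → ℕ) (x i p b : ℕ) : Set where
    priced-out : p ≡ limit → (∀ {y} → y < i → x ⊏ y → limit ≤ price y) → Search price x i p b
    cheapest   : b < n → x ⊏ b → price b ≡ p → p < limit →
                 (∀ {y} → y < i → x ⊏ y → price b ≤ price y) → Search price x i p b

  search-skip : ∀ {price x i p b} → (x ⊏ i → p ≤ price i) → Search price x i p b → Search price x (suc i) p b
  search-skip {price} {x} {i} dear (priced-out refl none) = priced-out refl all
    where
    all : ∀ {y} → y < suc i → x ⊏ y → limit ≤ price y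
    all {y} y<1+i x⊏y with y ≟ i
    ... | yes refl = dear x⊏y
    ... | no y≢i   = none (≤∧≢⇒< (≤-pred y<1+i) y≢i) x⊏y
  search-skip {price} {x} {i} {b = b} dear (cheapest b<n x⊏b refl p< least) = cheapest b<n x⊏b refl p< all
    where
    all : ∀ {y} → y < suc i → x ⊏ y → price b ≤ price y
    all {y} y<1+i x⊏y with y ≟ i
    ... | yes refl = dear x⊏y
    ... | no y≢i   = least (≤∧≢⇒< (≤-pred y<1+i) y≢i) x⊏y

  search-take : ∀ {price x i p b} → i < n → x ⊏ i → price i < p → Search price x i p b →
                Search price x (suc i) (price i) i
  search-take {price} {x} {i} {p} i<n x⊏i pi<p search = cheapest i<n x⊏i refl (<-≤-trans pi<p (p≤ search)) all
    where
    p≤ : ∀ {p b} → Search price x i p b → p ≤ limit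
    p≤ (priced-out refl _)     = ≤-refl
    p≤ (cheapest _ _ _ p<l _)  = <⇒≤ p<l
    old : ∀ {p b} → Search price x i p b → ∀ {y} → y < i → x ⊏ y → p ≤ price y
    old (priced-out refl none)       = none
    old (cheapest _ _ refl _ least)  = least
    all : ∀ {y} → y < suc i → x ⊏ y → price i ≤ price y
    all {y} y<1+i x⊏y with y ≟ i
    ... | yes refl = ≤-refl
    ... | no y≢i   = <⇒≤ (<-≤-trans pi<p (old search (≤∧≢⇒< (≤-pred y<1+i) y≢i) x⊏y))

  findCheapest-correct : ∀ s {x} → Tables s → vars s X ≡ x → x < n → vars s LIMIT ≡ limit →
    let z = run findCheapest s in Search (cells s priceA) x n (vars z PRICE) (vars z BEST)
  findCheapest-correct s {x} tb vX x<n vL =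
    loop-rule Y N undercut I (setVar PRICE (vars s LIMIT) s) (var-N tb) tt (priced-out vL λ ()) step
    where
    price = cells s priceA
    I : ℕ → Store → Set
    I i z = Search price x i (vars z PRICE) (vars z BEST)
    step : ∀ i z → i < n → vars z Y ≡ i → Same (for Y below N do′ undercut) (setVar PRICE (vars s LIMIT) s) z → I i z →
           I (suc i) (advance Y (run undercut z))
    step i z i<n vY sm inv = wp-run undercut (λ w → I (suc i) (advance Y w)) z (
      (λ under →
        (λ distinct →
          (λ cheaper → subst₂ (λ p y → Search price x (suc i) p y) (sym pY) (sym vY)
            (search-take i<n (bit-true le under , x≢ distinct)
              (subst (_< vars z PRICE) pY (m∸n≢0⇒n<m cheaper)) inv)) ,
          (λ dear → search-skip (λ _ → subst (vars z PRICE ≤_) pY (m∸n≡0⇒m≤n dear)) inv)) ,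
        (λ equal → search-skip (λ x⊏i → contradiction (x≡ equal) (proj₂ x⊏i)) inv)) ,
      (λ unrelated → search-skip (λ x⊏i → contradiction (bit-false le unrelated) (≡true⇒≢false (proj₁ x⊏i))) inv))
      where
      tz : Tables z
      tz = tables-same (for Y below N do′ undercut) tt sm (tables-run (PRICE ⇐ var LIMIT) tt tb)
      vXz : vars z X ≡ x
      vXz = trans (sameVar sm X tt) vX
      pY : cells z priceA (vars z Y) ≡ price i
      pY = trans (cong (λ A → A (vars z Y)) (sameArray sm priceA tt)) (cong price vY)
      le = valueP tz vXz vY x<n i<n
      x≢ : (vars z X ∸ vars z Y) + (vars z Y ∸ vars z X) ≢ 0 → x ≢ i
      x≢ d eq = differ≢0 (vars z X) (vars z Y) d (trans vXz (trans eq (sym vY)))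
      x≡ : (vars z X ∸ vars z Y) + (vars z Y ∸ vars z X) ≡ 0 → x ≡ i
      x≡ e = trans (sym vXz) (trans (differ≡0 (vars z X) (vars z Y) e) vY)

  SatisfiedBelow : ℕ → (nx price : ℕ → ℕ) → Set
  SatisfiedBelow i nx price = ∀ {x} → x < i → x < n → Satisfied nx price x

  satisfied-suc : ∀ {i nx price} → SatisfiedBelow i nx price → Satisfied nx price i →
                  SatisfiedBelow (suc i) nx price
  satisfied-suc {i} satisfied sat {x} x<1+i x<n with x ≟ i
  ... | yes refl = sat
  ... | no x≢i   = satisfied (≤∧≢⇒< (≤-pred x<1+i) x≢i) x<n

  -- In round t either the prices have risen t times or nobody wants to bid;
  -- after the first i bidders of the round the same holds for t + 1, unless one
  -- of the remaining bidders wants to bid.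
  Progress : ℕ → ℕ → (nx pv price : ℕ → ℕ) → Set
  Progress t i nx pv price = Auction nx pv price ×
    (t ≤ total n price ⊎ SatisfiedBelow n nx price) ×
    (suc t ≤ total n price ⊎ SatisfiedBelow i nx price)

  ProgressAt : ℕ → ℕ → Store → Set
  ProgressAt t i s = Progress t i (cells s nextA) (cells s prevA) (cells s priceA)

  progress-skip : ∀ {t i nx pv price} → Satisfied nx price i →
                  Progress t i nx pv price → Progress t (suc i) nx pv price
  progress-skip sat (auc , A , inj₁ risen)     = auc , A , inj₁ risen
  progress-skip sat (auc , A , inj₂ satisfied) = auc , A , inj₂ (satisfied-suc satisfied sat)

  progress-sale : ∀ {t nx pv price nx′ x y} → Progress t x nx pv price → x < n → nx x ≡ x → y < n → x ⊏ y →
    price y < limit → (∀ {z} → z < n → x ⊏ z → price y ≤ price z) → Released y nx nx′ →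
    Progress t (suc x) (nx′ [ x ↦ y ]) (pv [ y ↦ x ]) (price [ y ↦ price y + 1 ])
  progress-sale {t} {price = price} {x = x} {y} (auc , A , B) x<n nxx y<n x⊏y py< least released =
    auction-sale auc x<n nxx y<n x⊏y py< least released , inj₁ (<⇒≤ risen) , inj₁ risen
    where
    rise : total n (price [ y ↦ price y + 1 ]) ≡ suc (total n price)
    rise = +-cancelʳ-≡ (price y) _ _ (trans (total-update n price y<n)
      (trans (cong (total n price +_) (+-comm (price y) 1)) (+-suc (total n price) (price y))))
    t≤ : t ≤ total n price
    -- The buyer `x` itself refutes the alternative that everybody is satisfied.
    t≤ = [ id , (λ satisfied → contradiction (satisfied x<n x<n nxx y<n x⊏y) (<⇒≱ py<)) ]′ A
    risen : suc t ≤ total n (price [ y ↦ price y + 1 ])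
    risen = ≤-trans (s≤s t≤) (≤-reflexive (sym rise))

  progress-subst : ∀ {t i nx pv price nx′ pv′ price′} → nx′ ≡ nx → pv′ ≡ pv → price′ ≡ price →
                   Progress t i nx pv price → Progress t i nx′ pv′ price′
  progress-subst refl refl refl p = p

  sell-correct : ∀ {t} s → ProgressAt t (vars s X) s → vars s X < n → cells s nextA (vars s X) ≡ vars s X →
    vars s PRICE < limit → Search (cells s priceA) (vars s X) n (vars s PRICE) (vars s BEST) →
    ProgressAt t (suc (vars s X)) (run sell s)
  sell-correct s pr x<n nxx p< (priced-out p≡ _) = contradiction p≡ (<⇒≢ p<)
  sell-correct {t} s pr x<n nxx p< (cheapest y<n x⊏y p≡ _ least) =
    wp-run sell (ProgressAt t (suc (vars s X))) s
      ( (λ owned → progress-sale pr x<n nxx y<n x⊏y (subst (_< limit) (sym p≡) p<) least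
          (release-owned linked y<n (differ≢0 (cells s prevA (vars s BEST)) (vars s BEST) owned)))
      , (λ unowned → progress-sale pr x<n nxx y<n x⊏y (subst (_< limit) (sym p≡) p<) least
          (release-unowned linked y<n (differ≡0 (cells s prevA (vars s BEST)) (vars s BEST) unowned))) )
    where open Auction (proj₁ pr)

  bid-correct : ∀ {t} s → Tables s → vars s LIMIT ≡ limit → vars s X < n →
                ProgressAt t (vars s X) s → ProgressAt t (suc (vars s X)) (run bid s)
  bid-correct {t} s tb vL x<n pr = wp-run bid (ProgressAt t (suc (vars s X))) s
    ( (λ owner → progress-skip (λ nxx → contradiction nxx (differ≢0 _ (vars s X) owner)) pr)
    , (λ free → let nxx = differ≡0 (cells s nextA (vars s X)) (vars s X) free in
        (λ affordable → run-wp sell (ProgressAt t (suc (vars s X))) s₁ (subst (λ x → ProgressAt t (suc x) (run sell s₁)) vX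
          (sell-correct s₁ (subst (λ x → ProgressAt t x s₁) (sym vX) pr₁) (subst (_< n) (sym vX) x<n)
            (trans (cong₂ (λ A x → A x) (array nextA tt) vX) (trans nxx (sym vX)))
            (subst (vars s₁ PRICE <_) vL₁ (m∸n≢0⇒n<m affordable))
            (subst₂ (λ A x → Search A x n (vars s₁ PRICE) (vars s₁ BEST)) (sym (array priceA tt)) (sym vX) found))))
      , (λ exhausted → progress-skip (satisfied-by found (subst (_≤ vars s₁ PRICE) vL₁ (m∸n≡0⇒m≤n exhausted))) pr₁)) )
    where
    s₁ = run findCheapest s
    array : ∀ j → T (keepsArray findCheapest j) → cells s₁ j ≡ cells s j
    array j kj = frameArray findCheapest kj s
    vX : vars s₁ X ≡ vars s X
    vX = frame findCheapest tt s
    vL₁ : vars s₁ LIMIT ≡ limit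
    vL₁ = trans (frame findCheapest tt s) vL
    found : Search (cells s priceA) (vars s X) n (vars s₁ PRICE) (vars s₁ BEST)
    found = findCheapest-correct s tb refl x<n vL
    pr₁ : ProgressAt t (vars s X) s₁
    pr₁ = progress-subst (array nextA tt) (array prevA tt) (array priceA tt) pr
    satisfied-by : ∀ {x p b} → Search (cells s priceA) x n p b → limit ≤ p → Satisfied (cells s₁ nextA) (cells s₁ priceA) x
    satisfied-by (priced-out _ none) _ nxx y<n x⊏y =
      subst (λ A → limit ≤ A _) (sym (array priceA tt)) (none y<n x⊏y)
    satisfied-by (cheapest _ _ _ p< _) limit≤p = contradiction limit≤p (<⇒≱ p<)

  auctionRound-correct : ∀ {t} s → Tables s → vars s LIMIT ≡ limit →
                         ProgressAt t 0 s → ProgressAt t n (run auctionRound s)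
  auctionRound-correct {t} s tb vL pr = loop-rule X N bid (ProgressAt t) s (var-N tb) tt pr
    λ i z i<n vX sm pr-z → subst (λ x → ProgressAt t (suc x) (run bid z)) vX
      (bid-correct z (tables-same auctionRound tt sm tb) (trans (sameVar sm LIMIT tt) vL)
        (subst (_< n) (sym vX) i<n) (subst (λ x → ProgressAt t x z) (sym vX) pr-z))

  -- If somebody still wanted to bid after all rounds, the prices would sum to at least the number
  -- of rounds, hence to more than `n * limit`; but each of the `n` prices is at most `limit`.
  auction-correct : ∀ s → Tables s → vars s LIMIT ≡ limit → n * limit < vars s ROUNDS →
    Auction (cells s nextA) (cells s prevA) (cells s priceA) →
    let z = run auction s in
    Auction (cells z nextA) (cells z prevA) (cells z priceA) ×
    (∀ {x} → x < n → Satisfied (cells z nextA) (cells z priceA) x)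
  auction-correct s tb vL enough auc =
    finish {run auction s} (loop-rule IT ROUNDS auctionRound I s refl tt (auc , inj₁ z≤n)
      λ i z _ _ sm (auc-z , A) → next {z = run auctionRound z} (auctionRound-correct z (tables-same auction tt sm tb)
        (trans (sameVar sm LIMIT tt) vL) (auc-z , A , inj₂ λ ())))
    where
    I : ℕ → Store → Set
    I t z = Auction (cells z nextA) (cells z prevA) (cells z priceA) ×
            (t ≤ total n (cells z priceA) ⊎ SatisfiedBelow n (cells z nextA) (cells z priceA))
    next : ∀ {t z} → ProgressAt t n z → I (suc t) (advance IT z)
    next (auc , _ , B) = auc , B
    finish : ∀ {z} → I (vars s ROUNDS) z → Auction (cells z nextA) (cells z prevA) (cells z priceA) ×
             (∀ {x} → x < n → Satisfied (cells z nextA) (cells z priceA) x)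
    finish (auc , inj₂ satisfied) = auc , λ x<n → satisfied x<n x<n
    finish (auc , inj₁ many)      = contradiction (≤-trans many (total≤ n λ _ y<n → Auction.price≤ auc y<n)) (<⇒≱ enough)

  record Bottoms (pv : ℕ → ℕ) (w : ℕ) (bottom : ℕ → ℕ) : Set where
    field
      listed  : ∀ {y} → y < n → pv y ≡ y → ∃[ c ] c < w × bottom c ≡ y
      bottom< : ∀ {c} → c < w → bottom c < n

  collectBottoms-correct : ∀ s → Tables s → let z = run collectBottoms s in
    vars z WIDTH ≡ count n (bottoms (cells s prevA)) × Bottoms (cells s prevA) (vars z WIDTH) (cells z bottomA)
  collectBottoms-correct s tb =
    let w≡ , listed , bottom< = loop-rule Y N collect I (setVar WIDTH 0 s) (var-N tb) tt
          (refl , (λ ()) , (λ ())) step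
    in w≡ , record { listed = λ y<n → listed y<n ; bottom< = bottom< }
    where
    pv = cells s prevA
    I : ℕ → Store → Set
    I i z = vars z WIDTH ≡ count i (bottoms pv) ×
            (∀ {y} → y < i → pv y ≡ y → ∃[ c ] c < vars z WIDTH × cells z bottomA c ≡ y) ×
            (∀ {c} → c < vars z WIDTH → cells z bottomA c < n)
    step : ∀ i z → i < n → vars z Y ≡ i → Same (for Y below N do′ collect) (setVar WIDTH 0 s) z → I i z →
           I (suc i) (advance Y (run collect z))
    step i z i<n refl sm (w≡ , listed , bottom<) = wp-run collect (λ w → I (suc i) (advance Y w)) z
      ( (λ upper → let pvi = λ eq → differ≢0 (cells z prevA i) i upper (trans (cong (λ A → A i) pv≡) eq) in
          trans w≡ (sym (trans (cong (λ b → count i (bottoms pv) + bit b) (≢⇒≡ᵇ-false pvi)) (+-identityʳ _)))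
        , old-listed pvi
        , bottom<)
      , (λ lowest → let pvi = trans (sym (cong (λ A → A i) pv≡)) (differ≡0 (cells z prevA i) i lowest) in
          cong₂ _+_ w≡ (sym (cong bit (trans (cong (_≡ᵇ i) pvi) (≡ᵇ-refl i))))
        , new-listed
        , new-bottom<) )
      where
      pv≡ : cells z prevA ≡ pv
      pv≡ = sameArray sm prevA tt
      old-listed : pv i ≢ i → ∀ {y} → y < suc i → pv y ≡ y → ∃[ c ] c < vars z WIDTH × cells z bottomA c ≡ y
      old-listed pvi {y} y<1+i pvy with y ≟ i
      ... | yes refl = contradiction pvy pvi
      ... | no y≢i   = listed (≤∧≢⇒< (≤-pred y<1+i) y≢i) pvy
      b′ = cells z bottomA [ vars z WIDTH ↦ i ]
      new-listed : ∀ {y} → y < suc i → pv y ≡ y → ∃[ c ] c < vars z WIDTH + 1 × b′ c ≡ y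
      new-listed {y} y<1+i pvy with y ≟ i
      ... | yes refl = vars z WIDTH , ≤-reflexive (+-comm 1 _) , update-same (cells z bottomA) (vars z WIDTH)
      ... | no y≢i   = let c , c<w , eq = listed (≤∧≢⇒< (≤-pred y<1+i) y≢i) pvy in
        c , <-≤-trans c<w (m≤m+n _ 1) , trans (update-other (cells z bottomA) (λ w≡c → <⇒≢ c<w (sym w≡c))) eq
      new-bottom< : ∀ {c} → c < vars z WIDTH + 1 → b′ c < n
      new-bottom< {c} c< with vars z WIDTH ≟ c
      ... | yes refl = subst (_< n) (sym (update-same (cells z bottomA) (vars z WIDTH))) i<n
      ... | no w≢c   = subst (_< n) (sym (update-other (cells z bottomA) w≢c))
        (bottom< (≤∧≢⇒< (≤-pred (≤-trans c< (≤-reflexive (+-comm _ 1)))) (λ c≡w → w≢c (sym c≡w))))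

  countSteps-correct : ∀ s → Tables s → vars (run countSteps s) STEPS ≡ k * n
  countSteps-correct s tb = trans (loop-rule X N (STEPS ⇐ var STEPS ∔ var K) (λ i z → vars z STEPS ≡ i * k)
    (setVar STEPS 0 s) (var-N tb) tt refl
    λ i z _ _ sm steps → trans (cong₂ _+_ steps (trans (sameVar sm K tt) (var-K tb))) (+-comm (i * k) k)) (*-comm n k)

  place-correct : ∀ s → Tables s → ∀ q → q < k →
                  cells (run place s) posA q ≡ cells s bottomA (cells s guessA q)
  place-correct s tb = loop-rule Q K (posA at var Q ← bottomA at (guessA at var Q)) I s (var-K tb) tt (λ _ ()) step
    where
    I : ℕ → Store → Set
    I i z = ∀ q → q < i → cells z posA q ≡ cells s bottomA (cells s guessA q)
    step : ∀ i z → i < k → vars z Q ≡ i → Same place s z → I i z →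
           I (suc i) (advance Q (run (posA at var Q ← bottomA at (guessA at var Q)) z))
    step i z _ refl sm placed q q<1+i with q ≟ i
    ... | yes refl = trans (update-same (cells z posA) q)
      (cong₂ (λ B G → B (G q)) (sameArray sm bottomA tt) (sameArray sm guessA tt))
    ... | no q≢i   = trans (update-other (cells z posA) (λ i≡q → q≢i (sym i≡q))) (placed q (≤∧≢⇒< (≤-pred q<1+i) q≢i))

  Settled : (ℕ → ℕ) → Set
  Settled m = ∀ p q → p < k → q < k → Agree m p q

  -- Agreement on the pairs lexicographically before `(p , q)`, which is the order in which a sweep
  -- visits them.
  SettledBefore : ℕ → ℕ → (ℕ → ℕ) → Set
  SettledBefore p q m = ∀ p′ q′ → p′ < k → q′ < k → p′ < p ⊎ (p′ ≡ p × q′ < q) → Agree m p′ q′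

  settled-next : ∀ {p q m} → SettledBefore p q m → Agree m p q → SettledBefore p (suc q) m
  settled-next before agree p′ q′ p′<k q′<k (inj₁ p′<p) = before p′ q′ p′<k q′<k (inj₁ p′<p)
  settled-next {q = q} before agree p′ q′ p′<k q′<k (inj₂ (refl , q′<1+q)) with q′ ≟ q
  ... | yes refl = agree
  ... | no q′≢q  = before p′ q′ p′<k q′<k (inj₂ (refl , ≤∧≢⇒< (≤-pred q′<1+q) q′≢q))

  settled-row : ∀ {p m} → SettledBefore p k m → SettledBefore (suc p) 0 m
  settled-row {p} before p′ q′ p′<k q′<k (inj₁ p′<1+p) with p′ ≟ p
  ... | yes refl = before p′ q′ p′<k q′<k (inj₂ (refl , q′<k))
  ... | no p′≢p  = before p′ q′ p′<k q′<k (inj₁ (≤∧≢⇒< (≤-pred p′<1+p) p′≢p))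

  module Settling {nx pv} (linked : Linked nx pv) (start : ℕ → ℕ) where
    open Linked linked

    Candidate : Set
    Candidate = ∃[ ε ] ∃[ embedding ] Under linked {ε} embedding start 0

    Near : Candidate → (ℕ → ℕ) → ℕ → Set
    Near (ε , embedding , _) = Under linked embedding

    -- Apart from the range everything is relative to a candidate, so only the range is claimed when
    -- there is none. For a candidate, the first alternative carries the guarantee of the `t`
    -- earlier sweeps; the second one says what the current sweep has achieved, either a further
    -- move or no violation among the pairs visited.
    Sweep : ℕ → ℕ → ℕ → (ℕ → ℕ) → Set
    Sweep t p q m = InRange m × (∀ c → (Settled m ⊎ Near c m t) × (Near c m (suc t) ⊎ SettledBefore p q m))

    in-range-step : ∀ {m} q → q < k → InRange m → InRange (m [ q ↦ nx (m q) ])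
    in-range-step {m} q q<k range p p<k with q ≟ p
    ... | yes refl = subst (_< n) (sym (update-same m q)) (nx< (range q q<k))
    ... | no q≢p   = subst (_< n) (sym (update-other m q≢p)) (range p p<k)

    sweep-agree : ∀ {t p q m} → Agree m p q → Sweep t p q m → Sweep t p (suc q) m
    sweep-agree agree (range , near) = range , λ c → proj₁ (near c) ,
      [ inj₁ , (λ before → inj₂ (settled-next before agree)) ]′ (proj₂ (near c))

    sweep-move : ∀ {t p q m r} → p < k → q < k → r < k → ¬ Agree m p q →
      (∀ c → Near c m t → Near c (m [ r ↦ nx (m r) ]) (suc t)) →
      Sweep t p q m → Sweep t p (suc q) (m [ r ↦ nx (m r) ])
    sweep-move {p = p} {q} {r = r} p<k q<k r<k ¬agree closer (range , near) = in-range-step r r<k range , λ c →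
      let nearer = [ (λ settled → contradiction (settled p q p<k q<k) ¬agree) , closer c ]′ (proj₁ (near c))
      -- However many moves a sweep makes, it is credited with one: a later move of the same sweep
      -- starts again from the count `t`.
      in inj₂ (under-pred linked (proj₁ (proj₂ c)) nearer) , inj₁ nearer

    repair-correct : ∀ {t p q} z → Tables z → cells z nextA ≡ nx → vars z P ≡ p → vars z Q ≡ q → p < k → q < k →
      Sweep t p q (cells z posA) → Sweep t p (suc q) (cells (run repair z) posA)
    repair-correct {t} {p} {q} z tb refl refl refl p<k q<k sw@(range , near) =
      wp-run repair (λ w → Sweep t p (suc q) (cells w posA)) z
        ( (λ p≤q → let p≤q′ = bit-true leq p≤q in
            (λ mp≤mq → sweep-agree (trans p≤q′ (sym (bit-true lep mp≤mq))) sw)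
          , (λ mp≰mq → let mp≰mq′ = bit-false lep mp≰mq in
              sweep-move p<k q<k q<k (λ agree → ≡true⇒≢false (trans (sym agree) p≤q′) mp≰mq′)
                (λ c under → raise-upper linked (proj₁ (proj₂ c)) range under p<k q<k p≤q′ mp≰mq′) sw))
        , (λ p≰q → let p≰q′ = bit-false leq p≰q in
            (λ mp≤mq → let mp≤mq′ = bit-true lep mp≤mq in
              sweep-move p<k q<k p<k (λ agree → ≡true⇒≢false (trans agree mp≤mq′) p≰q′)
                (λ c under → raise-lower linked (proj₁ (proj₂ c)) range under p<k q<k p≰q′ mp≤mq′) sw)
          , (λ mp≰mq → sweep-agree (trans p≰q′ (sym (bit-false lep mp≰mq))) sw)) )
      where
      leq = tableQ tb p<k q<k
      lep = tableP tb (range p p<k) (range q q<k)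

    repairRow-correct : ∀ {t p} z → Tables z → cells z nextA ≡ nx → vars z P ≡ p → p < k →
      Sweep t p 0 (cells z posA) → Sweep t (suc p) 0 (cells (run repairRow z) posA)
    repairRow-correct {t} {p} z tb nx≡ vP p<k sw =
      let range , near = loop-rule Q K repair (λ q y → Sweep t p q (cells y posA)) z (var-K tb) tt sw
            λ q y q<k vQ sm sw-y → repair-correct y (tables-same repairRow tt sm tb)
              (trans (sameArray sm nextA tt) nx≡) (trans (sameVar sm P tt) vP) vQ p<k q<k sw-y
      in range , λ c → proj₁ (near c) , [ inj₁ , (λ before → inj₂ (settled-row before)) ]′ (proj₂ (near c))

    sweep-correct : ∀ {t} z → Tables z → cells z nextA ≡ nx →
      InRange (cells z posA) × (∀ c → Settled (cells z posA) ⊎ Near c (cells z posA) t) →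
      let m = cells (run sweep z) posA in InRange m × (∀ c → Settled m ⊎ Near c m (suc t))
    sweep-correct {t} z tb nx≡ (range , near) =
      let range′ , near′ = loop-rule P K repairRow (λ p y → Sweep t p 0 (cells y posA)) z (var-K tb) tt
            (range , λ c → near c , inj₂ λ { _ _ _ _ (inj₁ ()) ; _ _ _ _ (inj₂ (_ , ())) })
            λ p y p<k vP sm → repairRow-correct y (tables-same sweep tt sm tb)
              (trans (sameArray sm nextA tt) nx≡) vP p<k
      in range′ , λ c → [ inj₂ , (λ before → inj₁ λ p q p<k q<k → before p q p<k q<k (inj₁ p<k)) ]′ (proj₂ (near′ c))

    -- After `k * n` sweeps either all pairs agree or `k * n` moves have been credited. In the
    -- latter case the position has reached the embedding of the candidate.
    settle-correct : ∀ s → Tables s → cells s nextA ≡ nx → vars s STEPS ≡ k * n → cells s posA ≡ start → InRange start →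
      let m = cells (run settle s) posA in InRange m × (Candidate → Settled m)
    settle-correct s tb nx≡ steps refl range =
      let range′ , near = loop-rule X STEPS sweep
            (λ t y → InRange (cells y posA) × (∀ c → Settled (cells y posA) ⊎ Near c (cells y posA) t)) s steps tt
            (range , λ c → inj₂ (proj₂ (proj₂ c)))
            λ t y _ _ sm → sweep-correct y (tables-same settle tt sm tb) (trans (sameArray sm nextA tt) nx≡)
      in range′ , λ c → [ id , under-end linked (proj₁ (proj₂ c)) ]′ (near c)

  bit-injective : ∀ {a b} → bit a ≡ bit b → a ≡ b
  bit-injective {true}  {true}  _ = refl
  bit-injective {false} {false} _ = refl

  Verdict : (answer : ℕ) → Set → Set → Set
  Verdict answer yes-case no-case = (answer ≡ 1 × yes-case) ⊎ (answer ≡ 0 × no-case)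

  Checked : ℕ → ℕ → (ℕ → ℕ) → ℕ → Set
  Checked p q m good = Verdict good (SettledBefore p q m) (¬ Settled m)

  check-correct : ∀ {p q} z → Tables z → vars z P ≡ p → vars z Q ≡ q → p < k → q < k → InRange (cells z posA) →
    Checked p q (cells z posA) (vars z GOOD) →
    let y = run check z in Checked p (suc q) (cells y posA) (vars y GOOD)
  check-correct {p} {q} z tb refl refl p<k q<k range checked =
    wp-run check (λ y → Checked p (suc q) (cells y posA) (vars y GOOD)) z
      ( (λ different → inj₂ (refl , λ settled → differ≢0 (bitQ z) (bitP z) different
          (trans leq (trans (cong bit (settled p q p<k q<k)) (sym lep)))))
      , (λ agreeing → [ (λ { (good , before) → inj₁ (good , settled-next before (bit-injective
            (trans (sym leq) (trans (differ≡0 (bitQ z) (bitP z) agreeing) lep)))) })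
          , inj₂ ]′ checked) )
    where
    leq = tableQ {z} tb p<k q<k
    lep = tableP {z} tb (range p p<k) (range q q<k)
    bitQ bitP : Store → ℕ
    bitQ = val (leqQ (var P) (var Q))
    bitP = val (leqP (posA at var P) (posA at var Q))

  checkRow-correct : ∀ {p} z → Tables z → vars z P ≡ p → p < k → InRange (cells z posA) →
    Checked p 0 (cells z posA) (vars z GOOD) → Checked (suc p) 0 (cells z posA) (vars (run checkRow z) GOOD)
  checkRow-correct {p} z tb vP p<k range checked =
    [ (λ { (good , before) → inj₁ (good , settled-row before) }) , inj₂ ]′
      (loop-rule Q K check (λ q y → Checked p q (cells z posA) (vars y GOOD)) z (var-K tb) tt checked step)
    where
    step : ∀ q y → q < k → vars y Q ≡ q → Same checkRow z y → Checked p q (cells z posA) (vars y GOOD) →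
           Checked p (suc q) (cells z posA) (vars (run check y) GOOD)
    step q y q<k vQ sm checked-y =
      subst (λ m → Checked p (suc q) m (vars (run check y) GOOD)) (trans (frameArray check tt y) pos≡)
        (check-correct y (tables-same checkRow tt sm tb) (trans (sameVar sm P tt) vP) vQ p<k q<k
          (subst InRange (sym pos≡) range) (subst (λ m → Checked p q m (vars y GOOD)) (sym pos≡) checked-y))
      where
      pos≡ : cells y posA ≡ cells z posA
      pos≡ = sameArray sm posA tt

  verify-correct : ∀ s → Tables s → InRange (cells s posA) →
    Verdict (vars (run verify s) GOOD) (Settled (cells s posA)) (¬ Settled (cells s posA))
  verify-correct s tb range =
    [ (λ { (good , before) → inj₁ (good , λ p q p<k q<k → before p q p<k q<k (inj₁ p<k)) }) , inj₂ ]′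
      (loop-rule P K checkRow (λ p y → Checked p 0 (cells s posA) (vars y GOOD)) (setVar GOOD 1 s) (var-K tb) tt
        (inj₁ (refl , λ { _ _ _ _ (inj₁ ()) ; _ _ _ _ (inj₂ (_ , ())) })) step)
    where
    step : ∀ p y → p < k → vars y P ≡ p → Same (for P below K do′ checkRow) (setVar GOOD 1 s) y →
           Checked p 0 (cells s posA) (vars y GOOD) →
           Checked (suc p) 0 (cells s posA) (vars (run checkRow y) GOOD)
    step p y p<k vP sm checked =
      subst (λ m → Checked (suc p) 0 m (vars (run checkRow y) GOOD)) pos≡
        (checkRow-correct y (tables-same (for P below K do′ checkRow) tt sm (tables-run (GOOD ⇐ lit 1) tt tb)) vP p<k
          (subst InRange (sym pos≡) range) (subst (λ m → Checked p 0 m (vars y GOOD)) (sym pos≡) checked))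
      where
      pos≡ : cells y posA ≡ cells s posA
      pos≡ = sameArray sm posA tt

  -- Enumerating the prescriptions with an odometer

  Digits : ℕ → (ℕ → ℕ) → Set
  Digits w g = ∀ q → q < k → g q < w

  value-update : ∀ w q g v → value w (suc q) (g [ q ↦ v ]) ≡ value w q g + v * w ^ q
  value-update w q g v = cong₂ _+_
    (total-cong q λ i i<q → cong (_* w ^ i) (update-other g (λ q≡i → <⇒≢ i<q (sym q≡i))))
    (cong (_* w ^ q) (update-same g q))

  module Increment (w : ℕ) (g : ℕ → ℕ) where

    -- The state after `q` digits: these hold the incremented numeral up to a carry of weight
    -- `w ^ q`, and the digits from `q` onwards are still the old ones.
    Carrying : ℕ → (ℕ → ℕ) → ℕ → Set
    Carrying q h carry = Digits w h × (∀ i → q ≤ i → h i ≡ g i) × carry ≤ 1 ×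
                         value w q h + carry * w ^ q ≡ suc (value w q g)

    digits-update : ∀ {h q v} → Digits w h → v < w → Digits w (h [ q ↦ v ])
    digits-update {h} {q} digits v<w i i<k with q ≟ i
    ... | yes refl = subst (_< w) (sym (update-same h q)) v<w
    ... | no q≢i   = subst (_< w) (sym (update-other h q≢i)) (digits i i<k)

    carry-over : ∀ {q h} → q < k → Carrying q h 1 → h q + 1 ≡ w → Carrying (suc q) (h [ q ↦ 0 ]) 1
    carry-over {q} {h} q<k (digits , rest , _ , eq) full =
      digits-update {h} {q} digits (≤-<-trans z≤n (digits q q<k)) ,
      (λ i q<i → trans (update-other h (<⇒≢ q<i)) (rest i (<⇒≤ q<i))) ,
      ≤-refl ,
      (begin
        value w (suc q) (h [ q ↦ 0 ]) + 1 * (w * w ^ q)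
          ≡⟨ cong₂ (λ a b → a + 1 * (b * w ^ q)) (value-update w q h 0) (sym full) ⟩
        value w q h + 0 * w ^ q + 1 * ((h q + 1) * w ^ q)
          ≡⟨ rearrange (value w q h) (h q) (w ^ q) ⟩
        value w q h + 1 * w ^ q + h q * w ^ q
          ≡⟨ cong₂ (λ a b → a + b * w ^ q) eq (rest q ≤-refl) ⟩
        suc (value w q g) + g q * w ^ q ∎)
      where
      open ≡-Reasoning
      open +-*-Solver
      rearrange : ∀ a d x → a + 0 * x + 1 * ((d + 1) * x) ≡ a + 1 * x + d * x
      rearrange = solve 3 (λ a d x → a :+ con 0 :* x :+ con 1 :* ((d :+ con 1) :* x)
                                     := a :+ con 1 :* x :+ d :* x) refl

    carry-stop : ∀ {q h} → q < k → Carrying q h 1 → h q + 1 ≢ w → Carrying (suc q) (h [ q ↦ h q + 1 ]) 0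
    carry-stop {q} {h} q<k (digits , rest , _ , eq) room =
      digits-update {h} {q} digits (≤∧≢⇒< (≤-trans (≤-reflexive (+-comm (h q) 1)) (digits q q<k)) room) ,
      (λ i q<i → trans (update-other h (<⇒≢ q<i)) (rest i (<⇒≤ q<i))) ,
      z≤n ,
      (begin
        value w (suc q) (h [ q ↦ h q + 1 ]) + 0 * (w * w ^ q)
          ≡⟨ cong (_+ 0 * (w * w ^ q)) (value-update w q h (h q + 1)) ⟩
        value w q h + (h q + 1) * w ^ q + 0
          ≡⟨ rearrange (value w q h) (h q) (w ^ q) ⟩
        value w q h + 1 * w ^ q + h q * w ^ q
          ≡⟨ cong₂ (λ a b → a + b * w ^ q) eq (rest q ≤-refl) ⟩
        suc (value w q g) + g q * w ^ q ∎)
      where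
      open ≡-Reasoning
      open +-*-Solver
      rearrange : ∀ a d x → a + (d + 1) * x + 0 ≡ a + 1 * x + d * x
      rearrange = solve 3 (λ a d x → a :+ (d :+ con 1) :* x :+ con 0 := a :+ con 1 :* x :+ d :* x) refl

    carry-done : ∀ {q h} → Carrying q h 0 → Carrying (suc q) h 0
    carry-done {q} {h} (digits , rest , _ , eq) =
      digits , (λ i q<i → rest i (<⇒≤ q<i)) , z≤n ,
      (begin
        value w q h + h q * w ^ q + 0  ≡⟨ +-identityʳ _ ⟩
        value w q h + h q * w ^ q      ≡⟨ cong₂ (λ a b → a + b * w ^ q) (trans (sym (+-identityʳ _)) eq) (rest q ≤-refl) ⟩
        suc (value w q g) + g q * w ^ q ∎)
      where open ≡-Reasoning

    carry-end : ∀ {h carry} → Carrying k h carry → Digits w h × (suc (value w k g) < w ^ k → value w k h ≡ suc (value w k g))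
    carry-end {h} {zero} (digits , _ , _ , eq) = digits , λ _ → trans (sym (+-identityʳ _)) eq
    -- A carry surviving all digits means that the incremented number is at least `w ^ k`.
    carry-end {h} {suc c} (digits , _ , _ , eq) = digits , λ small → contradiction
      (≤-trans (m≤m+n (w ^ k) (c * w ^ k)) (≤-trans (m≤n+m _ (value w k h)) (≤-reflexive eq))) (<⇒≱ small)

  increment-correct : ∀ s {w} → Tables s → vars s WIDTH ≡ w → Digits w (cells s guessA) →
    let g = cells s guessA ; h = cells (run increment s) guessA in
    Digits w h × (suc (value w k g) < w ^ k → value w k h ≡ suc (value w k g))
  increment-correct s {w} tb refl digits = carry-end {carry = vars (run increment s) CARRY}
    (loop-rule Q K carryDigit (λ q y → Carrying q (cells y guessA) (vars y CARRY)) (setVar CARRY 1 s) (var-K tb) tt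
      (digits , (λ _ _ → refl) , ≤-refl , refl) step)
    where
    open Increment w (cells s guessA)
    one : ∀ {c} → c ≤ 1 → c ≢ 0 → c ≡ 1
    one {zero}        _         c≢0 = contradiction refl c≢0
    one {suc zero}    _         _   = refl
    one {suc (suc _)} (s≤s ())  _
    step : ∀ q y → q < k → vars y Q ≡ q → Same (for Q below K do′ carryDigit) (setVar CARRY 1 s) y →
           Carrying q (cells y guessA) (vars y CARRY) →
           Carrying (suc q) (cells (run carryDigit y) guessA) (vars (run carryDigit y) CARRY)
    step q y q<k refl sm carrying = wp-run carryDigit (λ z → Carrying (suc q) (cells z guessA) (vars z CARRY)) y
      ( (λ carry≢0 → let carry≡1 = one (proj₁ (proj₂ (proj₂ carrying))) carry≢0
                         carrying₁ = subst (Carrying q h) carry≡1 carrying in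
          (λ room → carry-stop q<k carrying₁ λ full → differ≢0 (h q + 1) (vars y WIDTH) room (trans full (sym width≡)))
        , (λ full → subst (Carrying (suc q) (h [ q ↦ 0 ])) (sym carry≡1)
            (carry-over q<k carrying₁ (trans (differ≡0 (h q + 1) (vars y WIDTH) full) width≡))))
      , (λ carry≡0 → subst (Carrying (suc q) h) (sym carry≡0) (carry-done (subst (Carrying q h) carry≡0 carrying))) )
      where
      h = cells y guessA
      width≡ : vars y WIDTH ≡ w
      width≡ = sameVar sm WIDTH tt

  choice : ∀ {A : Set} {R : ℕ → A → Set} → A → (∀ q → q < k → ∃[ a ] R q a) → ∃[ h ] (∀ q → q < k → R q (h q))
  choice {A} {R} default given = (λ q → proj₁ (pick q)) , λ q → proj₂ (pick q)
    where
    pick : ∀ q → ∃[ a ] (q < k → R q a)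
    pick q with q <? k
    ... | yes q<k = let a , r = given q q<k in a , λ _ → r
    ... | no q≮k  = default , λ q<k → contradiction q<k q≮k

  module Searching {nx pv} (linked : Linked nx pv) {w bottom} (bots : Bottoms pv w bottom) where
    open Bottoms bots

    -- A prescription realised by an embedding `ε`: starting from the bottoms that it selects, `ε`
    -- is reachable within the whole budget. The start is any `m` that agrees with these bottoms
    -- below `k`, because array contents are known only there.
    Target : (ℕ → ℕ) → Set
    Target h = Digits w h × ∃[ ε ] ∃[ embedding ]
      (∀ {m} → (∀ q → q < k → m q ≡ bottom (h q)) → Under linked {ε} embedding m 0)

    -- Each `ε q` lies on the chain above some bottom, at distance at most `n`. The distances
    -- therefore sum to at most `k * n`, the budget of `Under`.
    target : ∀ {ε} → IsEmbedding ε → ∃[ h ] Target h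
    target {ε} embedding = (λ q → proj₁ (f q)) , (λ q q<k → proj₁ (f-spec q q<k)) , ε , embedding ,
      λ placed → (λ q → proj₂ (f q)) ,
        (λ q q<k → trans (cong (λ b → iterate nx b (proj₂ (f q))) (placed q q<k)) (proj₂ (proj₂ (f-spec q q<k)))) ,
        ≤-trans (≤-reflexive (+-identityʳ _)) (total≤ k λ q q<k → proj₁ (proj₂ (f-spec q q<k)))
      where
      route : ∀ q → q < k → ∃[ cd ] proj₁ cd < w × proj₂ cd ≤ n × iterate nx (bottom (proj₁ cd)) (proj₂ cd) ≡ ε q
      route q q<k =
        let b , d , b<n , pvb , d≤n , eq = chain-bottom linked (proj₁ embedding q q<k)
            c , c<w , bot≡ = listed b<n pvb
        in (c , d) , c<w , d≤n , trans (cong (λ x → iterate nx x d) bot≡) eq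
      choices = choice (0 , 0) route
      f = proj₁ choices
      f-spec = proj₂ choices

    record Ready (z : Store) : Set where
      field
        tables   : Tables z
        next≡    : cells z nextA ≡ nx
        bottom≡  : cells z bottomA ≡ bottom
        width≡   : vars z WIDTH ≡ w
        steps≡   : vars z STEPS ≡ k * n
    open Ready

    ready-same : ∀ c {s z} → T (keepsTables c ∧ keepsArray c nextA ∧ keepsArray c bottomA ∧ keeps c WIDTH ∧ keeps c STEPS) →
                 Same c s z → Ready s → Ready z
    ready-same c kept sm rd =
      let kT , kept₁ = ∧-split {keepsTables c} kept
          kN , kept₂ = ∧-split {keepsArray c nextA} kept₁
          kB , kept₃ = ∧-split {keepsArray c bottomA} kept₂
          kW , kS    = ∧-split {keeps c WIDTH} kept₃
      in record
      { tables  = tables-same c kT sm (tables rd)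
      ; next≡   = trans (sameArray sm nextA kN) (next≡ rd)
      ; bottom≡ = trans (sameArray sm bottomA kB) (bottom≡ rd)
      ; width≡  = trans (sameVar sm WIDTH kW) (width≡ rd)
      ; steps≡  = trans (sameVar sm STEPS kS) (steps≡ rd)
      }

    attempt : Cmd
    attempt = place ▸ settle ▸ verify

    attempt-correct : ∀ s → Ready s → Digits w (cells s guessA) →
      Verdict (vars (run attempt s) GOOD) (∃[ ε ] IsEmbedding ε)
        (∀ h → Target h → ¬ (∀ q → q < k → cells s guessA q ≡ h q))
    attempt-correct s rd digits =
      [ (λ { (good , settled) → inj₁ (good , cells s₂ posA , range₂ , settled) })
      , (λ { (bad , ¬settled) → inj₂ (bad , λ { h (_ , ε , embedding , under) hit → ¬settled (settles
          (ε , embedding , under λ q q<k → trans (placed q q<k) (cong bottom (hit q q<k)))) }) })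
      ]′ (verify-correct s₂ (tables rd₂) range₂)
      where
      s₁ = run place s
      s₂ = run settle s₁
      rd₁ = ready-same place tt (run-same place s) rd
      rd₂ = ready-same settle tt (run-same settle s₁) rd₁
      placed : ∀ q → q < k → cells s₁ posA q ≡ bottom (cells s guessA q)
      placed q q<k = trans (place-correct s (tables rd) q q<k) (cong (λ B → B (cells s guessA q)) (bottom≡ rd))
      open Settling linked (cells s₁ posA)
      settled₂ = settle-correct s₁ (tables rd₁) (next≡ rd₁) (steps≡ rd₁) refl
        λ q q<k → subst (_< n) (sym (placed q q<k)) (bottom< (digits q q<k))
      range₂ = proj₁ settled₂
      settles = proj₂ settled₂

    -- `it` attempts have been made. The guess is the numeral of `it` only while `it < w ^ k`, since
    -- the increment after the last attempt overflows. As long as nothing is found, every target has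
    -- a number not yet passed; at `w ^ k` no such number remains.
    Explored : ℕ → ℕ → (ℕ → ℕ) → Set
    Explored it found g = Digits w g × (it < w ^ k → value w k g ≡ it) ×
      Verdict found (∃[ ε ] IsEmbedding ε) (∀ h → Target h → it ≤ value w k h)

    tryGuess-correct : ∀ {it} s → Ready s → it < w ^ k → Explored it (vars s FOUND) (cells s guessA) →
      let z = run tryGuess s in Explored (suc it) (vars z FOUND) (cells z guessA)
    tryGuess-correct {it} s rd it<W (digits , value≡ , found) =
      let digits′ , value′ = increment-correct s₄ (tables rd₄) (width≡ rd₄) (subst (Digits w) (sym guess₄) digits)
      in digits′ ,
         (λ 1+it<W → trans (value′ (subst (λ v → suc v < w ^ k) (sym value₄) 1+it<W)) (cong suc value₄)) ,
         subst (λ f → Verdict f (∃[ ε ] IsEmbedding ε) (∀ h → Target h → suc it ≤ value w k h))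
           (sym (frame increment tt s₄)) verdict
      where
      s₃ = run attempt s
      s₄ = run record-success s₃
      rd₄ = ready-same (attempt ▸ record-success) tt (run-same (attempt ▸ record-success) s) rd
      guess₄ : cells s₄ guessA ≡ cells s guessA
      guess₄ = frameArray (attempt ▸ record-success) tt s
      value₄ : value w k (cells s₄ guessA) ≡ it
      value₄ = trans (cong (value w k) guess₄) (value≡ it<W)
      old-found = subst (λ f → Verdict f (∃[ ε ] IsEmbedding ε) (∀ h → Target h → it ≤ value w k h))
        (sym (frame attempt tt s)) found
      verdict : Verdict (vars s₄ FOUND) (∃[ ε ] IsEmbedding ε) (∀ h → Target h → suc it ≤ value w k h)
      verdict = wp-run record-success
        (λ z → Verdict (vars z FOUND) (∃[ ε ] IsEmbedding ε) (∀ h → Target h → suc it ≤ value w k h)) s₃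
        ( (λ good → inj₁ (refl ,
            [ proj₂ , (λ bad → contradiction (proj₁ bad) good) ]′ (attempt-correct s rd digits)))
        , (λ bad → [ inj₁ , (λ { (none , later) → inj₂ (none , λ h tg → ≤∧≢⇒< (later h tg) (missed bad h tg)) }) ]′ old-found) )
        where
        missed : vars s₃ GOOD ≡ 0 → ∀ h → Target h → it ≢ value w k h
        missed bad h tg@(digits-h , _) it≡ =
          [ (λ good → contradiction (trans (sym bad) (proj₁ good)) λ ())
          , (λ miss → proj₂ miss h tg (value-injective w k digits digits-h (trans (value≡ it<W) it≡)))
          ]′ (attempt-correct s rd digits)

    search-correct : ∀ s → Ready s → vars s GUESSES ≡ w ^ k → 0 < w → cells s guessA ≡ (λ _ → 0) →
      Verdict (vars (run search s) FOUND) (∃[ ε ] IsEmbedding ε) (¬ (∃[ ε ] IsEmbedding ε))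
    search-correct s rd guesses 0<w guess≡ =
      let _ , _ , verdict = loop-rule IT GUESSES tryGuess (λ it z → Explored it (vars z FOUND) (cells z guessA))
            (setVar FOUND 0 s) guesses tt start
            λ it z it<W _ sm → tryGuess-correct z
              (ready-same (for IT below GUESSES do′ tryGuess) tt sm
                (ready-same (FOUND ⇐ lit 0) tt (run-same (FOUND ⇐ lit 0) s) rd)) it<W
      in [ inj₁ , (λ { (none , later) → inj₂ (none , λ { (ε , embedding) →
             let h , tg = target embedding in <⇒≱ (value< w k (proj₁ tg)) (later h tg) }) }) ]′ verdict
      where
      start : Explored 0 0 (cells s guessA)
      start rewrite guess≡ = (λ _ _ → 0<w) , (λ _ → zeros k) , inj₂ (refl , λ _ _ → z≤n)
        where
        zeros : ∀ q → value w q (λ _ → 0) ≡ 0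
        zeros zero    = refl
        zeros (suc q) = trans (+-identityʳ _) (zeros q)

  cells-setCell : ∀ j i v s → cells (setCell j i v s) j ≡ cells s j [ i ↦ v ]
  cells-setCell j i v s = cong (if_then cells s j [ i ↦ v ] else cells s j) (≡ᵇ-refl (toℕ j))

  fillRows-correct : ∀ j v s {a m} → T (keeps (fillRows j v) v) → vars s v ≡ m → vars s ACC ≡ a →
    let z = run (fillRows j v) s in
    vars z ACC ≡ a + m * m × (∀ x → x < m → cells z j x ≡ a + x * m)
  fillRows-correct j v s {a} {m} kept v≡m acc =
    loop-rule X v _ I s v≡m tt (trans acc (sym (+-identityʳ a)) , λ _ ()) step
    where
    I : ℕ → Store → Set
    I i z = vars z ACC ≡ a + i * m × (∀ x → x < i → cells z j x ≡ a + x * m)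
    step : ∀ i z → i < m → vars z X ≡ i → Same (fillRows j v) s z → I i z →
           I (suc i) (advance X (run ((j at var X ← var ACC) ▸ ACC ⇐ var ACC ∔ var v) z))
    step i z _ refl sm (acc-z , rows) =
      trans (cong₂ _+_ acc-z (trans (sameVar sm v kept) v≡m))
        (trans (+-assoc a (i * m) m) (cong (a +_) (+-comm (i * m) m))) ,
      λ x x<1+i → trans (cong (λ A → A x) (cells-setCell j i (vars z ACC) z)) (row x x<1+i)
      where
      row : ∀ x → x < suc i → (cells z j [ i ↦ vars z ACC ]) x ≡ a + x * m
      row x x<1+i with x ≟ i
      ... | yes refl = trans (update-same (cells z j) x) acc-z
      ... | no x≢i   = trans (update-other (cells z j) (λ i≡x → x≢i (sym i≡x))) (rows x (≤∧≢⇒< (≤-pred x<1+i) x≢i))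

  isolateAll-correct : ∀ s → vars s N ≡ n → let z = run isolateAll s in
    ∀ x → x < n → cells z nextA x ≡ x × cells z prevA x ≡ x
  isolateAll-correct s N≡n = loop-rule X N isolate I s N≡n tt (λ _ ()) step
    where
    I : ℕ → Store → Set
    I i z = ∀ x → x < i → cells z nextA x ≡ x × cells z prevA x ≡ x
    step : ∀ i z → i < n → vars z X ≡ i → Same isolateAll s z → I i z → I (suc i) (advance X (run isolate z))
    step i z _ refl sm fixed x x<1+i with x ≟ i
    ... | yes refl = update-same (cells z nextA) x , update-same (cells z prevA) x
    ... | no x≢i   = let nx , pv = fixed x (≤∧≢⇒< (≤-pred x<1+i) x≢i) in
      trans (update-other (cells z nextA) (λ i≡x → x≢i (sym i≡x))) nx ,
      trans (update-other (cells z prevA) (λ i≡x → x≢i (sym i≡x))) pv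

  countRounds-correct : ∀ s → vars s N ≡ n → vars (run countRounds s) ROUNDS ≡ n * (n + n + n + n)
  countRounds-correct s N≡n =
    loop-rule X N (ROUNDS ⇐ var ROUNDS ∔ (var N ∔ var N ∔ var N ∔ var N)) (λ i z → vars z ROUNDS ≡ i * (n + n + n + n))
      (setVar ROUNDS 0 s) N≡n tt refl
      λ i z _ _ sm rounds → trans
        (cong₂ (λ r m → r + (m + m + m + m)) rounds (trans (sameVar sm N tt) N≡n)) (+-comm (i * (n + n + n + n)) _)

  record Loaded (s : Store) : Set where
    field
      load-K  : vars s K ≡ k
      load-N  : vars s N ≡ n
      inputQ  : ∀ {x y} → x < k → y < k → cells s inputA (2 + x * k + y) ≡ bit (leQ x y)
      inputP  : ∀ {x y} → x < n → y < n → cells s inputA (2 + k * k + x * n + y) ≡ bit (leP x y)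
      price≡0 : cells s priceA ≡ λ _ → 0
      guess≡0 : cells s guessA ≡ λ _ → 0

  record Prepared (z : Store) : Set where
    field
      tables  : Tables z
      limit≡  : vars z LIMIT ≡ limit
      rounds≡ : vars z ROUNDS ≡ n * (n + n + n + n)
      fixed   : ∀ x → x < n → cells z nextA x ≡ x × cells z prevA x ≡ x
      price≡  : cells z priceA ≡ λ _ → 0
      guess≡  : cells z guessA ≡ λ _ → 0

  setup-correct : ∀ s → Loaded s → Prepared (run setup s)
  setup-correct s loaded = record
    { tables  = tables₁
    ; limit≡  = trans (frame countRounds tt (run (LIMIT ⇐ var N ∔ lit 2) sI))
        (cong (_+ 2) (trans (frame (rowsP ▸ isolateAll) tt s) load-N))
    ; rounds≡ = countRounds-correct (run (LIMIT ⇐ var N ∔ lit 2) sI)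
        (trans (frame (rowsP ▸ isolateAll) tt s) load-N)
    ; fixed   = λ x x<n →
        let nx , pv = isolateAll-correct sP (trans (frame rowsP tt s) load-N) x x<n
        in trans (cong (λ A → A x) (frameArray (LIMIT ⇐ var N ∔ lit 2 ▸ countRounds) tt sI)) nx ,
           trans (cong (λ A → A x) (frameArray (LIMIT ⇐ var N ∔ lit 2 ▸ countRounds) tt sI)) pv
    ; price≡  = trans (frameArray setup tt s) price≡0
    ; guess≡  = trans (frameArray setup tt s) guess≡0
    }
    where
    open Loaded loaded
    rowsQ : Cmd
    rowsQ = ACC ⇐ lit 2 ▸ fillRows rowQA K
    rowsP : Cmd
    rowsP = rowsQ ▸ fillRows rowPA N
    sQ sP sI : Store
    sQ = run rowsQ s
    sP = run rowsP s
    sI = run isolateAll sP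

    rowQ-spec = fillRows-correct rowQA K (run (ACC ⇐ lit 2) s) tt load-K refl
    rowP-spec = fillRows-correct rowPA N sQ tt (trans (frame rowsQ tt s) load-N) (proj₁ rowQ-spec)
    after-rows : Cmd
    after-rows = isolateAll ▸ LIMIT ⇐ var N ∔ lit 2 ▸ countRounds

    tables₁ : Tables (run setup s)
    tables₁ = record
      { var-K  = trans (frame setup tt s) load-K
      ; var-N  = trans (frame setup tt s) load-N
      ; tableP = λ {x} {y} x<n y<n → trans
          (cong₂ (λ A r → A (r + y)) (frameArray setup tt s)
            (trans (cong (λ A → A x) (frameArray after-rows tt sP)) (proj₂ rowP-spec x x<n)))
          (inputP x<n y<n)
      ; tableQ = λ {x} {y} x<k y<k → trans
          (cong₂ (λ A r → A (r + y)) (frameArray setup tt s)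
            (trans (cong (λ A → A x) (frameArray (fillRows rowPA N ▸ after-rows) tt sQ)) (proj₂ rowQ-spec x x<k)))
          (inputQ x<k y<k)
      }

  countWork-correct : ∀ s → Tables s →
    let z = run countWork s in vars z GUESSES ≡ vars s WIDTH ^ k × vars z STEPS ≡ k * n
  countWork-correct s tb =
    trans (frame countSteps tt (run countGuesses s))
      (trans (countGuesses-correct s) (cong (vars s WIDTH ^_) (var-K tb))) ,
    countSteps-correct (run countGuesses s) (tables-run countGuesses tt tb)

  -- The stores between the five stages, and the loop bounds in force there.
  record Solution (s : Store) : Set where
    field
      {s₁ s₂ s₃ s₄ s₅} : Store
      {w}       : ℕ
      s₁≡       : s₁ ≡ run setup s
      s₂≡       : s₂ ≡ run auction s₁
      s₃≡       : s₃ ≡ run collectBottoms s₂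
      s₄≡       : s₄ ≡ run countWork s₃
      s₅≡       : s₅ ≡ run search s₄
      0<w       : 0 < w
      antichain : ∃[ A ] w ≤ count n A × (∀ {x y} → x < n → y < n → A x ≡ true → A y ≡ true → ¬ (x ⊏ y))
      verdict   : Verdict (vars s₅ FOUND) (∃[ ε ] IsEmbedding ε) (¬ (∃[ ε ] IsEmbedding ε))
      bounds₀   : Pointwise (Bound s) (K ∷ N ∷ []) (k ∷ n ∷ [])
      bounds₁   : Pointwise (Bound s₁) (ROUNDS ∷ N ∷ N ∷ []) (n * (n + n + n + n) ∷ n ∷ n ∷ [])
      bounds₂   : Pointwise (Bound s₂) (N ∷ []) (n ∷ [])
      bounds₃   : Pointwise (Bound s₃) (K ∷ WIDTH ∷ N ∷ []) (k ∷ w ∷ n ∷ [])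
      bounds₄   : Pointwise (Bound s₄) (GUESSES ∷ STEPS ∷ K ∷ K ∷ []) (w ^ k ∷ k * n ∷ k ∷ k ∷ [])

  array-kept : ∀ c j s {z} → T (keepsArray c j) → z ≡ run c s → cells z j ≡ cells s j
  array-kept c j s kept refl = frameArray c kept s

  -- The intermediate stores are variables tied by equations, so that the claims about one stage do
  -- not depend on how earlier stages arrived at their stores.
  solve-stages : ∀ {s s₁ s₂ s₃ s₄ s₅} → Loaded s → 0 < n → s₁ ≡ run setup s → s₂ ≡ run auction s₁ →
    s₃ ≡ run collectBottoms s₂ → s₄ ≡ run countWork s₃ → s₅ ≡ run search s₄ → Solution s
  solve-stages {s} {s₁} {s₂} {s₃} {s₄} {s₅} loaded 0<n s₁≡ s₂≡ s₃≡ s₄≡ s₅≡ = record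
    { s₁≡       = s₁≡
    ; s₂≡       = s₂≡
    ; s₃≡       = s₃≡
    ; s₄≡       = s₄≡
    ; s₅≡       = s₅≡
    ; 0<w       = 0<w
    ; antichain =
        let A , large , independent = antichain-of-size-bottoms (proj₁ sold) (proj₂ sold)
        in A , subst (_≤ count n A) (sym (proj₁ collected)) large , independent
    ; verdict   = subst (λ z → Verdict (vars z FOUND) (∃[ ε ] IsEmbedding ε) (¬ (∃[ ε ] IsEmbedding ε))) (sym s₅≡)
        (search-correct s₄ ready (proj₁ counted) 0<w
          (trans (array-kept countWork guessA s₃ tt s₄≡) (trans (array-kept collectBottoms guessA s₂ tt s₃≡)
            (trans (array-kept auction guessA s₁ tt s₂≡) guess≡))))
    ; bounds₀   = load-K ∷ load-N ∷ []
    ; bounds₁   = rounds≡ ∷ var-N tables ∷ var-N tables ∷ []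
    ; bounds₂   = var-N tables₂ ∷ []
    ; bounds₃   = var-K tables₃ ∷ refl ∷ var-N tables₃ ∷ []
    ; bounds₄   = proj₁ counted ∷ proj₂ counted ∷ var-K tables₄ ∷ var-K tables₄ ∷ []
    }
    where
    open Loaded loaded using (load-K; load-N)
    prepared : Prepared s₁
    prepared = subst Prepared (sym s₁≡) (setup-correct s loaded)
    open Prepared prepared

    enough : n * limit < vars s₁ ROUNDS
    enough = subst (n * limit <_) (sym rounds≡) (subst (λ m → m * (m + 2) < m * (m + m + m + m)) (m+[n∸m]≡n 0<n)
      -- The slack is 4 n^2 - n (n + 2) - 1 = (n - 1) (3 n + 1), expressed in n - 1; the two sides
      -- meet at n = 1.
      (m+n≤o⇒m≤o _ {(n ∸ 1) * (3 * (n ∸ 1) + 4)} (≤-reflexive (identity (n ∸ 1)))))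
      where
      open +-*-Solver
      identity : ∀ m → suc ((1 + m) * (1 + m + 2)) + m * (3 * m + 4)
                       ≡ (1 + m) * ((1 + m) + (1 + m) + (1 + m) + (1 + m))
      identity = solve 1 (λ m → let m′ = con 1 :+ m in
        con 1 :+ (m′ :* (m′ :+ con 2)) :+ m :* (con 3 :* m :+ con 4) := m′ :* (m′ :+ m′ :+ m′ :+ m′)) refl

    sold : Auction (cells s₂ nextA) (cells s₂ prevA) (cells s₂ priceA) ×
           (∀ {x} → x < n → Satisfied (cells s₂ nextA) (cells s₂ priceA) x)
    sold = subst (λ z → Auction (cells z nextA) (cells z prevA) (cells z priceA) ×
                        (∀ {x} → x < n → Satisfied (cells z nextA) (cells z priceA) x)) (sym s₂≡)
      (auction-correct s₁ tables limit≡ enough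
        (subst (Auction (cells s₁ nextA) (cells s₁ prevA)) (sym price≡) (auction-start fixed)))

    tables₂ : Tables s₂
    tables₂ = subst Tables (sym s₂≡) (tables-run auction tt tables)
    tables₃ : Tables s₃
    tables₃ = subst Tables (sym s₃≡) (tables-run collectBottoms tt tables₂)
    tables₄ : Tables s₄
    tables₄ = subst Tables (sym s₄≡) (tables-run countWork tt tables₃)

    collected : vars s₃ WIDTH ≡ count n (bottoms (cells s₂ prevA)) ×
                Bottoms (cells s₂ prevA) (vars s₃ WIDTH) (cells s₃ bottomA)
    collected = subst (λ z → vars z WIDTH ≡ count n (bottoms (cells s₂ prevA)) ×
                             Bottoms (cells s₂ prevA) (vars z WIDTH) (cells z bottomA)) (sym s₃≡)
      (collectBottoms-correct s₂ tables₂)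

    counted : vars s₄ GUESSES ≡ vars s₃ WIDTH ^ k × vars s₄ STEPS ≡ k * n
    counted = subst (λ z → vars z GUESSES ≡ vars s₃ WIDTH ^ k × vars z STEPS ≡ k * n) (sym s₄≡)
      (countWork-correct s₃ tables₃)

    0<w : 0 < vars s₃ WIDTH
    0<w = let _ , _ , b<n , pvb , _ = chain-bottom (Auction.linked (proj₁ sold)) 0<n
              _ , c<w , _ = Bottoms.listed (proj₂ collected) b<n pvb
          in ≤-<-trans z≤n c<w

    open Searching (Auction.linked (proj₁ sold)) (proj₂ collected)
    ready : Ready s₄
    ready = record
      { tables  = tables₄
      ; next≡   = trans (array-kept countWork nextA s₃ tt s₄≡) (array-kept collectBottoms nextA s₂ tt s₃≡)
      ; bottom≡ = array-kept countWork bottomA s₃ tt s₄≡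
      ; width≡  = trans (cong (λ z → vars z WIDTH) s₄≡) (frame countWork tt s₃)
      ; steps≡  = proj₂ counted
      }

  solution : ∀ {s} → Loaded s → 0 < n → Solution s
  solution loaded 0<n = solve-stages loaded 0<n refl refl refl refl refl

-- Encoding of the input

contents-++ʳ : ∀ xs {ys} a → contents (xs ++ ys) (length xs + a) ≡ contents ys a
contents-++ʳ []       a = refl
contents-++ʳ (x ∷ xs) a = contents-++ʳ xs a

contents-++ˡ : ∀ xs {ys a} → a < length xs → contents (xs ++ ys) a ≡ contents xs a
contents-++ˡ (x ∷ xs) {a = zero}  _         = refl
contents-++ˡ (x ∷ xs) {a = suc a} (s≤s a<) = contents-++ˡ xs a<

contents-beyond : ∀ xs {a} → length xs ≤ a → contents xs a ≡ 0
contents-beyond []       _        = refl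
contents-beyond (x ∷ xs) (s≤s a≥) = contents-beyond xs a≥

contents-tabulate : ∀ {n} (f : Fin n → ℕ) y → contents (tabulate f) (toℕ y) ≡ f y
contents-tabulate f zero    = refl
contents-tabulate f (suc y) = contents-tabulate (λ z → f (suc z)) y

matrix : ∀ {m n} → (Fin m → Fin n → ℕ) → List ℕ
matrix f = concat (tabulate λ x → tabulate (f x))

length-matrix : ∀ {m n} (f : Fin m → Fin n → ℕ) → length (matrix f) ≡ m * n
length-matrix {zero}  f = refl
length-matrix {suc m} f = trans (length-++ (tabulate (f zero)))
  (cong₂ _+_ (length-tabulate (f zero)) (length-matrix (λ x → f (suc x))))

contents-matrix : ∀ {m n} (f : Fin m → Fin n → ℕ) x y → contents (matrix f) (toℕ x * n + toℕ y) ≡ f x y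
contents-matrix f zero y = trans
  (contents-++ˡ (tabulate (f zero)) (subst (toℕ y <_) (sym (length-tabulate (f zero))) (toℕ<n y)))
  (contents-tabulate (f zero) y)
contents-matrix {n = n} f (suc x) y = begin
  contents (matrix f) (n + toℕ x * n + toℕ y)
    ≡⟨ cong (contents (matrix f)) (+-assoc n (toℕ x * n) (toℕ y)) ⟩
  contents (matrix f) (n + (toℕ x * n + toℕ y))
    ≡⟨ cong (λ l → contents (matrix f) (l + (toℕ x * n + toℕ y))) (length-tabulate (f zero)) ⟨
  contents (matrix f) (length (tabulate (f zero)) + (toℕ x * n + toℕ y))
    ≡⟨ contents-++ʳ (tabulate (f zero)) (toℕ x * n + toℕ y) ⟩
  contents (matrix (λ x → f (suc x))) (toℕ x * n + toℕ y)
    ≡⟨ contents-matrix (λ x → f (suc x)) x y ⟩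
  f (suc x) y ∎
  where open ≡-Reasoning

index< : ∀ {m n x y} → x < m → y < n → x * n + y < m * n
index< {m} {n} {x} {y} x<m y<n = ≤-trans (+-monoʳ-< (x * n) y<n)
  (≤-trans (≤-reflexive (+-comm (x * n) n)) (*-monoˡ-≤ n x<m))

size-tabulate : ∀ n (A : ℕ → Bool) → ∣ Vec.tabulate {n = n} (λ x → A (toℕ x)) ∣ ≡ count n A
size-tabulate zero    A = refl
size-tabulate (suc n) A = trans (head (A 0)) (sym (total-front n (λ i → bit (A i))))
  where
  tail = Vec.tabulate {n = n} (λ x → A (suc (toℕ x)))
  head : ∀ b → ∣ b Vec.∷ tail ∣ ≡ bit b + count n (λ i → A (suc i))
  head true  = cong suc (size-tabulate n (λ i → A (suc i)))
  head false = size-tabulate n (λ i → A (suc i))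

does-true : ∀ {A : Set} (d : Dec A) → does d ≡ true → A
does-true (yes a) _ = a

nonzero : ℕ → Bool
nonzero v = not (v ≡ᵇ 0)

nonzero-bit : ∀ {v b} → v ≡ bit b → nonzero v ≡ b
nonzero-bit {b = true}  refl = refl
nonzero-bit {b = false} refl = refl

module Encoding (Q P : FinitePoset) where
  module FQ = FinitePoset Q
  module FP = FinitePoset P

  k n : ℕ
  k = size Q
  n = size P

  input : List ℕ
  input = k ∷ n ∷ orderMatrix Q ++ orderMatrix P

  -- Read off the input list rather than the order relation, which makes them total on natural
  -- numbers without converting indices to `Fin`.
  leQ leP : ℕ → ℕ → Bool
  leQ x y = nonzero (contents input (2 + x * k + y))
  leP x y = nonzero (contents input (2 + k * k + x * n + y))

  private
    entriesQ : Fin k → Fin k → ℕ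
    entriesQ x y = bit (does (x FQ.≼? y))
    entriesP : Fin n → Fin n → ℕ
    entriesP x y = bit (does (x FP.≼? y))

  length-input : length input ≡ 2 + k * k + n * n
  length-input = cong (2 +_) (trans (length-++ (orderMatrix Q))
    (cong₂ _+_ (length-matrix entriesQ) (length-matrix entriesP)))

  private
    contentsQ : ∀ x y → contents input (2 + toℕ x * k + toℕ y) ≡ bit (does (x FQ.≼? y))
    contentsQ x y = trans
      (contents-++ˡ (orderMatrix Q) (subst (toℕ x * k + toℕ y <_) (sym (length-matrix entriesQ)) (index< (toℕ<n x) (toℕ<n y))))
      (contents-matrix entriesQ x y)

    contentsP : ∀ x y → contents input (2 + k * k + toℕ x * n + toℕ y) ≡ bit (does (x FP.≼? y))
    contentsP x y = begin
      contents M (k * k + toℕ x * n + toℕ y)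
        ≡⟨ cong (contents M) (+-assoc (k * k) (toℕ x * n) (toℕ y)) ⟩
      contents M (k * k + (toℕ x * n + toℕ y))
        ≡⟨ cong (λ l → contents M (l + (toℕ x * n + toℕ y)))
             (length-matrix entriesQ) ⟨
      contents M (length (orderMatrix Q) + (toℕ x * n + toℕ y))
        ≡⟨ contents-++ʳ (orderMatrix Q) _ ⟩
      contents (orderMatrix P) (toℕ x * n + toℕ y)
        ≡⟨ contents-matrix entriesP x y ⟩
      bit (does (x FP.≼? y)) ∎
      where
      open ≡-Reasoning
      M = orderMatrix Q ++ orderMatrix P

  does-leQ : ∀ x y → leQ (toℕ x) (toℕ y) ≡ does (x FQ.≼? y)
  does-leQ x y = nonzero-bit (contentsQ x y)

  does-leP : ∀ x y → leP (toℕ x) (toℕ y) ≡ does (x FP.≼? y)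
  does-leP x y = nonzero-bit (contentsP x y)

  entryQ : ∀ {x y} → x < k → y < k → contents input (2 + x * k + y) ≡ bit (leQ x y)
  entryQ {x} {y} x<k y<k = subst₂ (λ x y → contents input (2 + x * k + y) ≡ bit (leQ x y))
    (toℕ-fromℕ< x<k) (toℕ-fromℕ< y<k)
    (trans (contentsQ (fromℕ< x<k) (fromℕ< y<k)) (cong bit (sym (does-leQ (fromℕ< x<k) (fromℕ< y<k)))))

  entryP : ∀ {x y} → x < n → y < n → contents input (2 + k * k + x * n + y) ≡ bit (leP x y)
  entryP {x} {y} x<n y<n = subst₂ (λ x y → contents input (2 + k * k + x * n + y) ≡ bit (leP x y))
    (toℕ-fromℕ< x<n) (toℕ-fromℕ< y<n)
    (trans (contentsP (fromℕ< x<n) (fromℕ< y<n)) (cong bit (sym (does-leP (fromℕ< x<n) (fromℕ< y<n)))))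

  leP-fromℕ< : ∀ {x y} (x<n : x < n) (y<n : y < n) → leP x y ≡ does (fromℕ< x<n FP.≼? fromℕ< y<n)
  leP-fromℕ< x<n y<n = trans (sym (cong₂ leP (toℕ-fromℕ< x<n) (toℕ-fromℕ< y<n))) (does-leP _ _)

  leQ-fromℕ< : ∀ {x y} (x<k : x < k) (y<k : y < k) → leQ x y ≡ does (fromℕ< x<k FQ.≼? fromℕ< y<k)
  leQ-fromℕ< x<k y<k = trans (sym (cong₂ leQ (toℕ-fromℕ< x<k) (toℕ-fromℕ< y<k))) (does-leQ _ _)

  order : PartialOrderOn n leP
  order = record
    { reflexive     = λ x<n → intro x<n x<n FP.≼-refl
    ; transitive    = λ x<n y<n z<n xy yz → intro x<n z<n (FP.≼-trans (elim x<n y<n xy) (elim y<n z<n yz))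
    ; antisymmetric = λ x<n y<n xy yx → trans (sym (toℕ-fromℕ< x<n))
        (trans (cong toℕ (FP.antisym (elim x<n y<n xy) (elim y<n x<n yx))) (toℕ-fromℕ< y<n))
    }
    where
    intro : ∀ {x y} (x<n : x < n) (y<n : y < n) → fromℕ< x<n FP.≼ fromℕ< y<n → leP x y ≡ true
    intro x<n y<n le = trans (leP-fromℕ< x<n y<n) (dec-true (_ FP.≼? _) le)
    elim : ∀ {x y} (x<n : x < n) (y<n : y < n) → leP x y ≡ true → fromℕ< x<n FP.≼ fromℕ< y<n
    elim x<n y<n le = does-true (_ FP.≼? _) (trans (sym (leP-fromℕ< x<n y<n)) le)

  open Chains n leP order using (_⊏_)
  open Greedy n leP order k leQ using (IsEmbedding)

  embedding→ : Embedding Q P → ∃[ ε ] IsEmbedding ε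
  embedding→ (e , _ , e-order) = ε , (λ q q<k → subst (_< n) (sym (ε-fromℕ< q<k)) (toℕ<n _)) , agree
    where
    ε : ℕ → ℕ
    ε q with q <? k
    ... | yes q<k = toℕ (e (fromℕ< q<k))
    ... | no _    = 0
    ε-fromℕ< : ∀ {q} (q<k : q < k) → ε q ≡ toℕ (e (fromℕ< q<k))
    ε-fromℕ< {q} q<k with q <? k
    ... | yes _   = refl
    ... | no q≮k  = contradiction q<k q≮k
    same-does : ∀ {A B : Set} (a : Dec A) (b : Dec B) → (A → B) → (B → A) → does a ≡ does b
    same-does (yes a) b f g = sym (dec-true b (f a))
    same-does (no ¬a) b f g = sym (dec-false b λ y → ¬a (g y))
    agree : ∀ p q → p < k → q < k → leQ p q ≡ leP (ε p) (ε q)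
    agree p q p<k q<k = trans (leQ-fromℕ< p<k q<k) (trans
      (same-does (_ FQ.≼? _) (_ FP.≼? _)
        (Equivalence.to (e-order (fromℕ< p<k) (fromℕ< q<k))) (Equivalence.from (e-order (fromℕ< p<k) (fromℕ< q<k))))
      (sym (trans (cong₂ leP (ε-fromℕ< p<k) (ε-fromℕ< q<k)) (does-leP _ _))))

  embedding← : ∃[ ε ] IsEmbedding ε → Embedding Q P
  embedding← (ε , range , agree) = e , injective , λ p q → mk⇔ to from
    where
    e : Fin k → Fin n
    e q = fromℕ< (range (toℕ q) (toℕ<n q))
    same-does : ∀ p q → does (p FQ.≼? q) ≡ does (e p FP.≼? e q)
    same-does p q = trans (sym (does-leQ p q))
      (trans (agree (toℕ p) (toℕ q) (toℕ<n p) (toℕ<n q)) (leP-fromℕ< (range (toℕ p) (toℕ<n p)) (range (toℕ q) (toℕ<n q))))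
    to : ∀ {p q} → p FQ.≼ q → e p FP.≼ e q
    to {p} {q} le = does-true (e p FP.≼? e q) (trans (sym (same-does p q)) (dec-true (p FQ.≼? q) le))
    from : ∀ {p q} → e p FP.≼ e q → p FQ.≼ q
    from {p} {q} le = does-true (p FQ.≼? q) (trans (same-does p q) (dec-true (e p FP.≼? e q) le))
    -- Equal images are below each other, so by reflection of the order `p` and `q` are below each
    -- other, and antisymmetry applies.
    injective : ∀ {p q} → e p ≡ e q → p ≡ q
    injective {p} {q} eq = FQ.antisym (from (subst (e p FP.≼_) eq FP.≼-refl)) (from (subst (FP._≼ e p) eq FP.≼-refl))

  -- Applied to the antichain of the auction, this caps the number of chains, which is the base of
  -- the exponential, by the width.
  count≤width : ∀ A → (∀ {x y} → x < n → y < n → A x ≡ true → A y ≡ true → ¬ (x ⊏ y)) → count n A ≤ width P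
  count≤width A independent = subst (_≤ width P) (size-tabulate n A)
    (proj₂ (FP.width-isWidth) S λ x y x∈S y∈S x≢y → apart x∈S y∈S x≢y , apart y∈S x∈S λ y≡x → x≢y (sym y≡x))
    where
    S : Subset n
    S = Vec.tabulate (λ x → A (toℕ x))
    member : ∀ {x} → x ∈ S → A (toℕ x) ≡ true
    member {x} x∈S = trans (sym (lookup∘tabulate (λ x → A (toℕ x)) x)) ([]=⇒lookup x∈S)
    apart : ∀ {x y} → x ∈ S → y ∈ S → x ≢ y → ¬ (x FP.≼ y)
    apart {x} {y} x∈S y∈S x≢y x≼y = independent (toℕ<n x) (toℕ<n y) (member x∈S) (member y∈S)
      (trans (does-leP x y) (dec-true (x FP.≼? y) x≼y) , λ eq → x≢y (toℕ-injective eq))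

-- The machine program

-- A positive `m` satisfies `suc m ≤ 2 * m`, so passing from the volume to the plain product of the
-- bounds costs one factor 2 per loop bound.
product-suc : ∀ {ms} → All (1 ≤_) ms → product (map suc ms) ≤ 2 ^ length ms * product ms
product-suc []                  = ≤-refl
product-suc {m ∷ ms} (1≤m ∷ ps) = ≤-trans
  (*-mono-≤ (≤-trans (+-monoˡ-≤ m 1≤m) (≤-reflexive (cong (m +_) (sym (+-identityʳ m))))) (product-suc ps))
  (≤-reflexive ([m*n]*[o*p]≡[m*o]*[n*p] 2 m (2 ^ length ms) (product ms)))

module Volumes {k n w : ℕ} (1≤k : 1 ≤ k) (1≤n : 1 ≤ n) (1≤w : 1 ≤ w) where
  W G : ℕ
  W = w ^ k
  G = W * k ^ 4 * n ^ 4

  private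
    1≤W : 1 ≤ W
    1≤W = m^n>0 w {{>-nonZero 1≤w}} k

    infixr 7 _·_
    _·_ : ∀ {a b} → 1 ≤ a → 1 ≤ b → 1 ≤ a * b
    _·_ = *-mono-≤ {1} {_} {1}

    -- Compares monomials: the missing factor `b` is at least 1, and a ring identity multiplies it
    -- in.
    cofactor : ∀ a {b c} → 1 ≤ b → a * b ≡ c → a ≤ c
    cofactor a 1≤b eq = ≤-trans (≤-trans (≤-reflexive (sym (*-identityʳ a))) (*-monoʳ-≤ a 1≤b)) (≤-reflexive eq)

    w≤W : w ≤ W
    w≤W = subst (λ e → w ≤ w ^ e) (m+[n∸m]≡n 1≤k) (cofactor w (m^n>0 w {{>-nonZero 1≤w}} (k ∸ 1)) refl)

    open +-*-Solver
    power4 : ∀ {m} → Polynomial m → Polynomial m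
    power4 x = x :* (x :* (x :* (x :* con 1)))

  1≤G : 1 ≤ G
  1≤G = (1≤W · m^n>0 k {{>-nonZero 1≤k}} 4) · m^n>0 n {{>-nonZero 1≤n}} 4

  setup≤ : product (k ∷ n ∷ []) ≤ G
  setup≤ = cofactor _ (1≤W · (1≤k · 1≤k · 1≤k) · (1≤n · 1≤n · 1≤n))
    (solve 3 (λ k n W → (k :* (n :* con 1)) :* (W :* ((k :* (k :* k)) :* (n :* (n :* n))))
                        := W :* power4 k :* power4 n) refl k n W)

  auction≤ : product (n * (n + n + n + n) ∷ n ∷ n ∷ []) ≤ 4 * G
  auction≤ = cofactor _ (1≤W · (1≤k · 1≤k · 1≤k · 1≤k))
    (solve 3 (λ k n W → (n :* (n :+ n :+ n :+ n)) :* (n :* (n :* con 1)) :* (W :* (k :* (k :* (k :* k))))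
                        := con 4 :* (W :* power4 k :* power4 n)) refl k n W)

  collect≤ : product (n ∷ []) ≤ G
  collect≤ = ≤-trans (cofactor _ 1≤k (*-comm (n * 1) k)) setup≤

  count≤G : product (k ∷ w ∷ n ∷ []) ≤ G
  count≤G = ≤-trans (*-monoʳ-≤ k (*-monoˡ-≤ (n * 1) w≤W)) (cofactor _ ((1≤k · 1≤k · 1≤k) · (1≤n · 1≤n · 1≤n))
    (solve 3 (λ k n W → k :* (W :* (n :* con 1)) :* ((k :* (k :* k)) :* (n :* (n :* n)))
                        := W :* power4 k :* power4 n) refl k n W))

  search≤ : product (W ∷ k * n ∷ k ∷ k ∷ []) ≤ G
  search≤ = cofactor _ (1≤k · 1≤n · 1≤n · 1≤n)
    (solve 3 (λ k n W → W :* ((k :* n) :* (k :* (k :* con 1))) :* (k :* (n :* (n :* n)))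
                        := W :* power4 k :* power4 n) refl k n W)

  input≤ : 2 + k * k + n * n ≤ 4 * G
  input≤ = ≤-trans (+-mono-≤ (+-mono-≤ (*-monoʳ-≤ 2 1≤G) kk≤) nn≤)
    (≤-reflexive (solve 1 (λ G → con 2 :* G :+ G :+ G := con 4 :* G) refl G))
    where
    kk≤ : k * k ≤ G
    kk≤ = cofactor _ (1≤W · (1≤k · 1≤k) · (1≤n · 1≤n · 1≤n · 1≤n))
      (solve 3 (λ k n W → k :* k :* (W :* ((k :* k) :* (n :* (n :* (n :* n))))) := W :* power4 k :* power4 n) refl k n W)
    nn≤ : n * n ≤ G
    nn≤ = cofactor _ (1≤W · (1≤n · 1≤n) · (1≤k · 1≤k · 1≤k · 1≤k))
      (solve 3 (λ k n W → n :* n :* (W :* ((n :* n) :* (k :* (k :* (k :* k))))) := W :* power4 k :* power4 n) refl k n W)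

-- Locating the end of the input and copying it into an array

addSquare : ℕ → Cmd
addSquare v = for X below v do′ (ACC ⇐ var ACC ∔ var v)

sizeInput : Cmd
sizeInput = ACC ⇐ lit 2 ▸ addSquare K ▸ addSquare N

addSquare-correct : ∀ v → T (keeps (addSquare v) v) → ∀ s {m} → vars s v ≡ m →
                    vars (run (addSquare v) s) ACC ≡ vars s ACC + m * m
addSquare-correct v kept s {m} v≡m =
  loop-rule X v (ACC ⇐ var ACC ∔ var v) (λ i z → vars z ACC ≡ vars s ACC + i * m) s v≡m tt (sym (+-identityʳ _))
    λ i z _ _ sm acc → trans (cong₂ _+_ acc (trans (sameVar sm v kept) v≡m))
      (trans (+-assoc (vars s ACC) (i * m) m) (cong (vars s ACC +_) (+-comm (i * m) m)))

sizeInput-correct : ∀ s → vars (run sizeInput s) ACC ≡ 2 + vars s K * vars s K + vars s N * vars s N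
sizeInput-correct s = trans
  (addSquare-correct N tt (run rows s) (frame rows tt s))
  (cong (_+ vars s N * vars s N) (addSquare-correct K tt (setVar ACC 2 s) refl))
  where
  rows : Cmd
  rows = ACC ⇐ lit 2 ▸ addSquare K

-- With base 0 the interleaved arrays cover the whole memory, so every state with 0 in register 0
-- represents a store. Commands that write no array can thus be simulated before the arrays have
-- their final place.
view : State → Store
view σ = store (λ r → regs σ (suc r)) (λ j i → mem σ (address 0 j i))

represents-view : ∀ {σ} → regs σ 0 ≡ 0 → Represents 0 σ (view σ)
represents-view base = record { base = base ; registers = λ _ → refl ; memory = λ _ _ → refl }

address-surjective : ∀ a → address 0 (fromℕ< (m%n<n a 16)) (a / 16) ≡ a
address-surjective a = trans (cong₂ _+_ (times16≡ (a / 16)) (toℕ-fromℕ< (m%n<n a 16)))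
  (trans (+-comm _ (a % 16)) (sym (m≡m%n+[m/n]*n a 16)))

memory-kept : ∀ c {σ τ} → (∀ j → T (keepsArray c j)) → Represents 0 τ (run c (view σ)) → ∀ a → mem τ a ≡ mem σ a
memory-kept c {σ} {τ} kept R a = subst (λ a → mem τ a ≡ mem σ a) (address-surjective a)
  (trans (memory R j (a / 16)) (cong (λ A → A (a / 16)) (frameArray c (kept j) (view σ))))
  where j = fromℕ< (m%n<n a 16)

-- Written directly for the machine: it reads an absolute address below the base, which no array of
-- the loop language reaches.
copyCell : Program
copyCell = mem[ reg 0 ⊕ (double (double (double (double (reg (suc X))))) ⊕ # 0) ]≔ mem[ reg (suc X) ]

copyTime : ℕ
copyTime = 4 + (suc (cost (reg 0 ⊕ (double (double (double (double (reg (suc X))))) ⊕ # 0)) + 2) + 4)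

-- What the copying loop leaves unchanged is what this command leaves unchanged.
copyShape : Cmd
copyShape = (inputA at var X ← lit 0) ▸ X ⇐ lit 0

copy-loop : ∀ m i (f : ℕ → ℕ) {b σ s} → Represents b σ s → vars s X ≡ i → i + m ≡ b →
  (∀ a → a < b → mem σ a ≡ f a) → (∀ a → a < i → cells s inputA a ≡ f a) →
  ∃[ s′ ] Outcome b (loop (suc X) 0 copyCell) σ s′ (4 + m * copyTime) × Same copyShape s s′ ×
          (∀ a → a < b → cells s′ inputA a ≡ f a)
copy-loop zero i f {s = s} R sX i≡b low copied =
  s , outcome (⇓-exit (trans (cong₂ _∸_ (base R) (trans (registers R X) sX))
        (m≤n⇒m∸n≡0 (≤-reflexive (trans (sym i≡b) (+-identityʳ i)))))) R ≤-refl ,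
  same (λ _ _ → refl) (λ _ _ → refl) , λ a a<b → copied a (subst (a <_) (trans (sym i≡b) (+-identityʳ i)) a<b)
copy-loop (suc m) i f {b} {σ} {s} R sX i+m≡b low copied =
  let s″ , outcome run″ R″ time″ , sm , done = copy-loop m (suc i) f R′ refl (trans (sym (+-suc i m)) i+m≡b) low′ copied′
  in s″ ,
     outcome (⇓-loop test (⇓-seq ⇓-store ⇓-assign) run″) R″
       (≤-trans (+-monoʳ-≤ copyTime time″) (≤-reflexive (rearrange copyTime (m * copyTime)))) ,
     same (λ x k → trans (sameVar sm x k) (if-not k)) (λ j k → trans (sameArray sm j k) (if-not (proj₁ (∧-split {not (toℕ inputA ≡ᵇ toℕ j)} k)))) ,
     done
  where
  rearrange : ∀ c x → c + (4 + x) ≡ 4 + (c + x)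
  rearrange = +-*-Solver.solve 2 (λ c x → c :+ (con 4 :+ x) := con 4 :+ (c :+ x)) refl
    where open +-*-Solver
  i<b : i < b
  i<b = subst (i <_) i+m≡b (m<m+n i (s≤s z≤n))
  rX : regs σ (suc X) ≡ i
  rX = trans (registers R X) sX
  test : regs σ 0 ∸ regs σ (suc X) ≢ 0
  test eq = <⇒≱ i<b (subst₂ _≤_ (base R) rX (m∸n≡0⇒m≤n eq))
  cell : mem σ (regs σ (suc X)) ≡ f i
  cell = trans (cong (mem σ) rX) (low i i<b)
  s′ = setVar X (suc i) (setCell inputA i (f i) s)
  R′ = represents-setVar X (represents-setCell inputA {i = i} R (cong₂ (λ b i → address b inputA i) (base R) rX) cell)
         (trans (cong (_+ 1) rX) (+-comm i 1))
  -- Every array cell has an address of at least `b`, so writing the copy leaves the source intact.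
  low′ : ∀ a → a < b → (mem σ [ address (regs σ 0) inputA (regs σ (suc X)) ↦ mem σ (regs σ (suc X)) ]) a ≡ f a
  low′ a a<b = trans (update-other (mem σ) λ eq → <⇒≱ a<b (subst₂ _≤_ (base R) eq (m≤m+n (regs σ 0) _))) (low a a<b)
  copied′ : ∀ a → a < suc i → (cells s inputA [ i ↦ f i ]) a ≡ f a
  copied′ a a<1+i with i ≟ a
  ... | yes refl = update-same (cells s inputA) i
  ... | no i≢a   = trans (update-other (cells s inputA) i≢a) (copied a (≤∧≢⇒< (≤-pred a<1+i) (λ a≡i → i≢a (sym a≡i))))

load stages program : Program
load = compile sizeInput ⨟ (0 ≔ reg (suc ACC)) ⨟ (suc X ≔ # 0) ⨟ loop (suc X) 0 copyCell
stages = compile setup ⨟ compile auction ⨟ compile collectBottoms ⨟ compile countWork ⨟ compile search ⨟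
         (0 ≔ reg (suc FOUND))
program =
  (suc K ≔ mem[ # 0 ]) ⨟ (suc N ≔ mem[ # 1 ]) ⨟
  -- An empty Q embeds into every P. A nonempty Q does not embed into an empty P, and `skip` leaves
  -- the output at its initial value 0. In the remaining case both sizes are positive.
  if reg (suc K) then (if reg (suc N) then (load ⨟ stages) else′ skip) else′ (0 ≔ # 1)

loadTime : ℕ → ℕ → ℕ
loadTime k n = weight sizeInput * product (suc k ∷ suc n ∷ []) + (2 + (2 + (4 + (2 + k * k + n * n) * copyTime)))

-- Running time and correctness

-- In each product the exponent of 2 is the length of the list of loop bounds, by `product-suc`, and
-- the next factor is the coefficient of `G` in `Volumes`; it is 4 for the auction with its 4 n^2
-- rounds. The final 2 pays for moving the answer to register 0.
stagesBudget loadBudget timeBudget : ℕ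
stagesBudget =
  weight setup * (2 ^ 2 * 1) + (weight auction * (2 ^ 3 * 4) + (weight collectBottoms * (2 ^ 1 * 1) +
  (weight countWork * (2 ^ 3 * 1) + (weight search * (2 ^ 4 * 1) + 2))))
loadBudget = weight sizeInput * (2 ^ 2 * 1) + (8 + 4 * copyTime)
-- Reading the two sizes takes 3 steps each and the two tests 2 each. The eleventh step is the
-- `skip` for an empty P.
timeBudget = 11 + (loadBudget + stagesBudget)

record Within (G t c : ℕ) : Set where
  constructor within
  field
    bound : t ≤ c * G
open Within

infixr 6 _⊞_
_⊞_ : ∀ {G s t c d} → Within G s c → Within G t d → Within G (s + t) (c + d)
_⊞_ {G} {c = c} {d} (within s≤) (within t≤) =
  within (≤-trans (+-mono-≤ s≤ t≤) (≤-reflexive (sym (*-distribʳ-+ G c d))))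

constant-time : ∀ m {G} → 1 ≤ G → Within G m m
constant-time m 1≤G = within (≤-trans (≤-reflexive (sym (*-identityʳ m))) (*-monoʳ-≤ m 1≤G))

with-overhead : ∀ c {G t} → Within G t c → 10 + t ≤ (11 + c) * (1 + G)
with-overhead c {G} (within t≤) = ≤-trans
  (+-mono-≤ (≤-trans (n≤1+n 10) (m≤m*n 11 (suc G))) (≤-trans t≤ (*-monoʳ-≤ c (n≤1+n G))))
  (≤-reflexive (sym (*-distribʳ-+ (1 + G) 11 c)))

simulate-within : ∀ c {l ms b σ s s′} → Nested l c → s′ ≡ run c s → Pointwise (Bound s) l ms →
                  Represents b σ s → Outcome b (compile c) σ s′ (weight c * product (map suc ms))
simulate-within c {l} {s = s} nested refl bounds R =
  let outcome run₁ R₁ time₁ = simulate l c nested R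
  in outcome run₁ R₁ (≤-trans time₁ (≤-reflexive (cong (weight c *_) (volume-bounds {s} bounds))))

stage-time : ∀ c {t ms} e {G} → t ≤ weight c * product (map suc ms) → All (1 ≤_) ms → product ms ≤ e * G →
             Within G t (weight c * (2 ^ length ms * e))
stage-time c {t} {ms} e {G} time positive bound = within (begin
  t                                           ≤⟨ time ⟩
  weight c * product (map suc ms)             ≤⟨ *-monoʳ-≤ (weight c) (product-suc positive) ⟩
  weight c * (2 ^ length ms * product ms)     ≤⟨ *-monoʳ-≤ (weight c) (*-monoʳ-≤ (2 ^ length ms) bound) ⟩
  weight c * (2 ^ length ms * (e * G))        ≡⟨ cong (weight c *_) (*-assoc (2 ^ length ms) e G) ⟨
  weight c * (2 ^ length ms * e * G)          ≡⟨ *-assoc (weight c) (2 ^ length ms * e) G ⟨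
  weight c * (2 ^ length ms * e) * G          ∎)
  where open ≤-Reasoning

module Running (Q P : FinitePoset) where
  open Encoding Q P
  open Correctness n leP order k leQ
  open Greedy n leP order k leQ using (IsEmbedding)

  load-correct : ∀ {σ} → regs σ 0 ≡ 0 → regs σ 1 ≡ k → regs σ 2 ≡ n → (∀ a → mem σ a ≡ contents input a) →
    ∃[ s ] Outcome (2 + k * k + n * n) load σ s (loadTime k n) × Loaded s
  load-correct {σ} r0 r1 r2 mem≡ =
    let s′ , outcome run₂ R₂ time₂ , sm , copied = copy-loop (2 + k * k + n * n) 0 (contents input)
          {s = s₃} R₃ refl refl (λ a _ → trans (memory-kept sizeInput {σ} {σ₁} (λ _ → tt) R₁ a) (mem≡ a)) (λ _ ())
    in s′ ,
      outcome (⇓-seq run₁ (⇓-seq ⇓-assign (⇓-seq ⇓-assign run₂))) R₂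
        (+-mono-≤ time₁
          (+-monoʳ-≤ 2 (+-monoʳ-≤ 2 time₂))) ,
      record
        { load-K  = trans (sameVar sm K tt) (trans (registers R₁ K) (trans (frame sizeInput tt (view σ)) r1))
        ; load-N  = trans (sameVar sm N tt) (trans (registers R₁ N) (trans (frame sizeInput tt (view σ)) r2))
        ; inputQ  = λ x<k y<k → trans (copied _ (≤-trans (+-monoʳ-< 2 (index< x<k y<k)) (m≤m+n _ _))) (entryQ x<k y<k)
        ; inputP  = λ {x} {y} x<n y<n → trans
            (copied _ (subst (_< 2 + k * k + n * n) (sym (+-assoc (2 + k * k) (x * n) y))
              (+-monoʳ-< (2 + k * k) (index< x<n y<n)))) (entryP x<n y<n)
        ; price≡0 = sameArray sm priceA tt
        ; guess≡0 = sameArray sm guessA tt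
        }
    where
    sized = simulate-within sizeInput {K ∷ N ∷ []} {k ∷ n ∷ []} {s = view σ} _ refl (r1 ∷ r2 ∷ []) (represents-view {σ} r0)
    open Outcome sized renaming (run⇓ to run₁; result to R₁; time≤ to time₁; final to σ₁; time to t₁)
    σ₃ : State
    σ₃ = ⟪ (regs σ₁ [ 0 ↦ regs σ₁ (suc ACC) ]) [ suc X ↦ 0 ] , mem σ₁ ⟫
    s₃ : Store
    s₃ = store (λ r → regs σ₃ (suc r)) (λ _ _ → 0)
    R₃ : Represents (2 + k * k + n * n) σ₃ s₃
    R₃ = record
      { base      = trans (registers R₁ ACC) (trans (sizeInput-correct (view σ))
                      (cong₂ (λ k n → 2 + k * k + n * n) r1 r2))
      ; registers = λ _ → refl
      -- Behind the input the memory is still 0, so all arrays start as zero, which provides the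
      -- initial prices and the first guess.
      ; memory    = λ j i → trans (memory-kept sizeInput {σ} {σ₁} (λ _ → tt) R₁ _) (trans (mem≡ (address (2 + k * k + n * n) j i))
                      (contents-beyond input (≤-trans (≤-reflexive length-input) (m≤m+n (2 + k * k + n * n) _))))
      }

  module _ (1≤k : 1 ≤ k) (1≤n : 1 ≤ n) where

    Answered : Program → State → ℕ → Set
    Answered p σ c = ∃[ t ] ∃[ τ ] (p , σ ⇓[ t ] τ) ×
      Verdict (output τ) (∃[ ε ] IsEmbedding ε) (¬ (∃[ ε ] IsEmbedding ε)) ×
      Within (width P ^ k * k ^ 4 * n ^ 4) t c

    module Stages {b σ s} (R : Represents b σ s) (solution : Solution s) where
      open Solution solution
      open Volumes 1≤k 1≤n 0<w

      private
        o₁ = simulate-within setup _ s₁≡ bounds₀ R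
        o₂ = simulate-within auction _ s₂≡ bounds₁ (Outcome.result o₁)
        o₃ = simulate-within collectBottoms _ s₃≡ bounds₂ (Outcome.result o₂)
        o₄ = simulate-within countWork _ s₄≡ bounds₃ (Outcome.result o₃)
        o₅ = simulate-within search _ s₅≡ bounds₄ (Outcome.result o₄)

        1*G : ∀ {m} → m ≤ G → m ≤ 1 * G
        1*G m≤G = ≤-trans m≤G (≤-reflexive (sym (+-identityʳ G)))

        1≤W : 1 ≤ W
        1≤W = m^n>0 w {{>-nonZero 0<w}} k

        1≤4n : 1 ≤ n * (n + n + n + n)
        1≤4n = *-mono-≤ {1} {n} {1} 1≤n (≤-trans 1≤n (m≤n+m n (n + n + n)))

        w≤width : w ≤ width P
        w≤width = let A , large , independent = antichain in ≤-trans large (count≤width A independent)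

        widen : ∀ {t c} → Within G t c → Within (width P ^ k * k ^ 4 * n ^ 4) t c
        widen {c = c} (within t≤) =
          within (≤-trans t≤ (*-monoʳ-≤ c (*-monoˡ-≤ (n ^ 4) (*-monoˡ-≤ (k ^ 4) (^-monoˡ-≤ k w≤width)))))

        copy-time : Within G ((2 + k * k + n * n) * copyTime) (4 * copyTime)
        copy-time = within (begin
          (2 + k * k + n * n) * copyTime  ≤⟨ *-monoˡ-≤ copyTime input≤ ⟩
          4 * G * copyTime                ≡⟨ *-assoc 4 G copyTime ⟩
          4 * (G * copyTime)              ≡⟨ cong (4 *_) (*-comm G copyTime) ⟩
          4 * (copyTime * G)              ≡⟨ *-assoc 4 copyTime G ⟨
          4 * copyTime * G                ∎)
          where open ≤-Reasoning

      load-time : Within (width P ^ k * k ^ 4 * n ^ 4) (loadTime k n) loadBudget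
      load-time = widen (stage-time sizeInput 1 ≤-refl (1≤k ∷ 1≤n ∷ []) (1*G setup≤) ⊞
                         constant-time 8 1≤G ⊞ copy-time)

      stages-result : Answered stages σ stagesBudget
      stages-result = _ , _ ,
        ⇓-seq (Outcome.run⇓ o₁) (⇓-seq (Outcome.run⇓ o₂) (⇓-seq (Outcome.run⇓ o₃) (⇓-seq (Outcome.run⇓ o₄)
          (⇓-seq (Outcome.run⇓ o₅) ⇓-assign)))) ,
        subst (λ v → Verdict v (∃[ ε ] IsEmbedding ε) (¬ (∃[ ε ] IsEmbedding ε)))
          (sym (registers (Outcome.result o₅) FOUND)) verdict ,
        widen
          (stage-time setup 1 (Outcome.time≤ o₁) (1≤k ∷ 1≤n ∷ []) (1*G setup≤) ⊞
           stage-time auction 4 (Outcome.time≤ o₂) (1≤4n ∷ 1≤n ∷ 1≤n ∷ []) auction≤ ⊞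
           stage-time collectBottoms 1 (Outcome.time≤ o₃) (1≤n ∷ []) (1*G collect≤) ⊞
           stage-time countWork 1 (Outcome.time≤ o₄) (1≤k ∷ 0<w ∷ 1≤n ∷ []) (1*G count≤G) ⊞
           stage-time search 1 (Outcome.time≤ o₅)
             (1≤W ∷ *-mono-≤ {1} {k} {1} 1≤k 1≤n ∷ 1≤k ∷ 1≤k ∷ []) (1*G search≤) ⊞
           constant-time 2 1≤G)

    work-correct : ∀ {σ} → regs σ 0 ≡ 0 → regs σ 1 ≡ k → regs σ 2 ≡ n → (∀ a → mem σ a ≡ contents input a) →
                   Answered (load ⨟ stages) σ (loadBudget + stagesBudget)
    work-correct r0 r1 r2 mem≡ = after-load (load-correct r0 r1 r2 mem≡)
      where
      combine : ∀ {σ t₁ σ₁} → load , σ ⇓[ t₁ ] σ₁ → Within (width P ^ k * k ^ 4 * n ^ 4) t₁ loadBudget →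
                Answered stages σ₁ stagesBudget → Answered (load ⨟ stages) σ (loadBudget + stagesBudget)
      combine {t₁ = t₁} run₁ time₁ (t₂ , τ , run₂ , answer , time₂) =
        t₁ + t₂ , τ , ⇓-seq run₁ run₂ , answer ,
        time₁ ⊞ time₂
      after-load : ∀ {σ} → ∃[ s ] Outcome (2 + k * k + n * n) load σ s (loadTime k n) × Loaded s →
                   Answered (load ⨟ stages) σ (loadBudget + stagesBudget)
      after-load (s , outcome run₁ R₁ time₁ , loaded) =
        combine run₁ (within (≤-trans time₁ (bound (Stages.load-time R₁ (solution loaded 1≤n)))))
          (Stages.stages-result R₁ (solution loaded 1≤n))

  answer-correct : ∀ {v} → Verdict v (∃[ ε ] IsEmbedding ε) (¬ (∃[ ε ] IsEmbedding ε)) → CorrectAnswer (Embedding Q P) v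
  answer-correct (inj₁ (v≡1 , found)) = inj₁ (embedding← found , v≡1)
  answer-correct (inj₂ (v≡0 , none))  = inj₂ ((λ e → none (embedding→ e)) , v≡0)

  decide : ∃[ t ] ∃[ τ ] (program , initial input ⇓[ t ] τ) × CorrectAnswer (Embedding Q P) (output τ) ×
             t ≤ timeBudget * (1 + width P ^ k * k ^ 4 * n ^ 4)
  decide with k ≟ 0 | n ≟ 0
  ... | yes k≡0 | _ = _ , _ , ⇓-seq ⇓-assign (⇓-seq ⇓-assign (⇓-else k≡0 ⇓-assign)) ,
    inj₁ (embedding← ((λ _ → 0) , (λ q q<k → contradiction (subst (q <_) k≡0 q<k) n≮0) ,
                      λ p q p<k _ → contradiction (subst (p <_) k≡0 p<k) n≮0) , refl) ,
    ≤-trans (m≤m+n 10 (1 + (loadBudget + stagesBudget))) (m≤m*n timeBudget (suc _))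
  ... | no k≢0 | yes n≡0 = _ , _ , ⇓-seq ⇓-assign (⇓-seq ⇓-assign (⇓-then k≢0 (⇓-else n≡0 ⇓-skip))) ,
    inj₂ ((λ e → let ε , range , _ = embedding→ e in n≮0 (subst (ε 0 <_) n≡0 (range 0 (n≢0⇒n>0 k≢0)))) , refl) ,
    ≤-trans (m≤m+n 11 (loadBudget + stagesBudget)) (m≤m*n timeBudget (suc _))
  ... | no k≢0 | no n≢0 =
    let t , τ , run₁ , answer , time₁ = work-correct (n≢0⇒n>0 k≢0) (n≢0⇒n>0 n≢0)
          {⟪ (regs (initial input) [ suc K ↦ k ]) [ suc N ↦ n ] , contents input ⟫} refl refl refl (λ _ → refl)
    in _ , τ , ⇓-seq ⇓-assign (⇓-seq ⇓-assign (⇓-then k≢0 (⇓-then n≢0 run₁))) , answer-correct answer ,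
       with-overhead (loadBudget + stagesBudget) time₁

-- Fixed-parameter tractability

scale : ℕ → Exp → Exp
scale zero    e = # 0
scale (suc m) e = e ⊕ scale m e

eval-scale : ∀ m e s → eval (scale m e) s ≡ m * eval e s
eval-scale zero    e s = refl
eval-scale (suc m) e s = cong (eval e s +_) (eval-scale m e s)

parameterBound : Vec ℕ 2 → ℕ
parameterBound (w ∷ k ∷ []) = timeBudget * (1 + w ^ k)

parameterBound-computable : Computable parameterBound
parameterBound-computable =
  ((suc WIDTH ≔ mem[ # 0 ]) ⨟ (suc K ≔ mem[ # 1 ]) ⨟ compile countGuesses ⨟ (0 ≔ scale timeBudget (# 1 ⊕ reg (suc GUESSES)))) ,
  λ { (w ∷ k ∷ []) → computed w k }
  where
  computed : ∀ w k → ∃[ t ] ∃[ s ]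
    (((suc WIDTH ≔ mem[ # 0 ]) ⨟ (suc K ≔ mem[ # 1 ]) ⨟ compile countGuesses ⨟ (0 ≔ scale timeBudget (# 1 ⊕ reg (suc GUESSES))))
      , initial (w ∷ k ∷ []) ⇓[ t ] s) × output s ≡ timeBudget * (1 + w ^ k)
  computed w k =
    let outcome run₁ R₁ _ = simulate (K ∷ WIDTH ∷ []) countGuesses _ (represents-view {σ} refl)
    in _ , _ , ⇓-seq ⇓-assign (⇓-seq ⇓-assign (⇓-seq run₁ ⇓-assign)) ,
       trans (eval-scale timeBudget (# 1 ⊕ reg (suc GUESSES)) _)
         (cong (λ g → timeBudget * (1 + g)) (trans (registers R₁ GUESSES) (countGuesses-correct (view σ))))
    where
    σ : State
    σ = ⟪ (regs (initial (w ∷ k ∷ [])) [ suc WIDTH ↦ w ]) [ suc K ↦ k ] , contents (w ∷ k ∷ []) ⟫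

k*n≤k*k+n*n : ∀ k n → k * n ≤ k * k + n * n
k*n≤k*k+n*n k n with ≤-total k n
... | inj₁ k≤n = ≤-trans (*-monoˡ-≤ n k≤n) (m≤n+m (n * n) (k * k))
... | inj₂ n≤k = ≤-trans (*-monoʳ-≤ k n≤k) (m≤m+n (k * k) (n * n))

-- The matrices make the input length at least k n, so its fourth power absorbs k^4 n^4; being
-- positive, that power absorbs the summand 1 too. This is where the exponent 4 of the polynomial
-- factor comes from.
parameters-times-length : ∀ c W k n →
  c * (1 + W * k ^ 4 * n ^ 4) ≤ c * (1 + W) * (2 + k * k + n * n) ^ 4
parameters-times-length c W k n = begin
  c * (1 + W * k ^ 4 * n ^ 4)      ≡⟨ cong (λ x → c * (1 + x)) (*-assoc W (k ^ 4) (n ^ 4)) ⟩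
  c * (1 + W * (k ^ 4 * n ^ 4))    ≡⟨ cong (λ x → c * (1 + W * x)) fourth ⟩
  c * (1 + W * (k * n) ^ 4)        ≤⟨ *-monoʳ-≤ c (+-mono-≤ (m^n>0 L 4) (*-monoʳ-≤ W (^-monoˡ-≤ 4 kn≤L))) ⟩
  c * (L ^ 4 + W * L ^ 4)          ≡⟨ *-assoc c (1 + W) (L ^ 4) ⟨
  c * (1 + W) * L ^ 4              ∎
  where
  open ≤-Reasoning
  L = 2 + k * k + n * n
  fourth : k ^ 4 * n ^ 4 ≡ (k * n) ^ 4
  fourth = +-*-Solver.solve 2 (λ k n → k :^ 4 :* n :^ 4 := (k :* n) :^ 4) refl k n
    where open +-*-Solver
  kn≤L : k * n ≤ L
  kn≤L = ≤-trans (k*n≤k*k+n*n k n) (m≤n+m (k * k + n * n) 2)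

theorem3p1 : FixedParameterTractable EmbeddingProblem (λ (Q , P) → width P ∷ size Q ∷ [])
    × SolvableInTimeO EmbeddingProblem
    (λ (Q , P) → width P ^ size Q * size Q ^ 4 * size P ^ 4)
theorem3p1 =
  (program , parameterBound , 4 , parameterBound-computable , λ (Q , P) →
    let t , τ , run⇓ , answer , time≤ = Running.decide Q P
    in t , τ , run⇓ , answer ,
       ≤-trans time≤ (subst (λ l → timeBudget * (1 + width P ^ size Q * size Q ^ 4 * size P ^ 4) ≤
                                   timeBudget * (1 + width P ^ size Q) * l ^ 4) (sym (Encoding.length-input Q P))
         (parameters-times-length timeBudget (width P ^ size Q) (size Q) (size P)))) ,
  (program , timeBudget , λ (Q , P) → Running.decide Q P)
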